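{- Let $q$ be a prime power and $\Delta$ an $n\times n$ diagonal matrix over $\mathbb{F}_q$ with $n$ distinct diagonal entries. For every $C=(c_1<\dots<c_m)\subseteq[n]$ with $|C|=m$ and every partition $\mu=(\mu_1,\dots,\mu_k)$ with positive parts and $\mu_1=m$, the number of $m$-dimensional subspaces of $\mathbb{F}_q^n$ with pivots $C$ and $\Delta$-profile $\mu$ is $$\sigma^C_n(\mu)=(q-1)^{\sum_{j\ge2}\mu_j}q^{\sum_{j\ge2}\binom{\mu_j}{2}}\sum_{T}c_q(T),$$ the sum over all multilinear tableaux $T$ of shape $\mu'$ (the conjugate of $\mu$) whose support is a subset of $[n]$ and whose first column is $C$.
   Context: $W$ has $\Delta$-profile $\mu$ if $\dim(W+\Delta W+\dots+\Delta^{j-1}W)=\mu_1+\dots+\mu_j$ for $1\le j\le k$ and $\dim(W+\dots+\Delta^{k-1}W)=\dim(W+\dots+\Delta^kW)$. An $m$-dimensional subspace $W$ has pivots $C=(c_1<\dots<c_m)$ if the $m\times n$ matrix in reduced row echelon form whose rows span $W$ has its leading $1$ in row $i$ in column $c_i$. A multilinear tableau of shape $\lambda=(\lambda_1,\dots,\lambda_r)$ is an array $(T_{ij})$, $1\le j\le\lambda_i$, of distinct positive integers with rows increasing left to right and columns increasing top to bottom; its support is its set of entries. For $2\le j\le\lambda_i$, $c_{ij}(T)=\#\{i'\ge i:\text{cell }(i',j-1)\text{ exists and }T_{i',j-1}<T_{ij}\}$ and $c_q(T)=\prod_i\prod_{j=2}^{\lambda_i}[c_{ij}(T)]_q$, with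 $[a]_q=1+q+\dots+q^{a-1}$. -}

module Defs where

open import Level using (0ℓ)
open import Data.Nat as ℕ using (ℕ; zero; suc; _∸_; _^_; _<ᵇ_; _≡ᵇ_; _≤_)
open import Data.Nat.Combinatorics using () renaming (_C_ to _choose_)
open import Data.Bool using (Bool; true; false; _∧_; if_then_else_)
open import Data.Fin using (Fin; toℕ)
open import Data.Nat.ListAction using (sum; product)
open import Data.Bool.ListAction using (and; all)
open import Data.List using (List; []; _∷_; length; map; filter; filterᵇ;
  take; drop; upTo; concatMap; foldr; allFin; concat; applyUpTo)
open import Data.List.Relation.Unary.All using (All)
open import Data.List.Relation.Unary.Linked using (Linked)
open import Data.List.Relation.Unary.Unique.Propositional using (Unique)
open import Data.List.Membership.Propositional using (_∈_)
open import Data.Maybe using (Maybe; just; nothing)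
open import Data.Product using (Σ; ∃; _×_; _,_)
open import Data.Empty using (⊥)
open import Relation.Nullary using (¬_)
open import Relation.Binary.PropositionalEquality using (_≡_; _≢_)
open import Algebra.Structures using (IsCommutativeRing)
open import Function using (_∘_)

record FiniteField (q : ℕ) : Set₁ where
  infixl 6 _+_
  infixl 7 _*_
  field
    F      : Set
    _+_ _*_ : F → F → F
    -_     : F → F
    0# 1#  : F
    _⁻¹    : F → F
    isCommutativeRing : IsCommutativeRing _≡_ _+_ _*_ -_ 0# 1#
    0≢1    : 0# ≢ 1#
    inverse : ∀ x → x ≢ 0# → x * (x ⁻¹) ≡ 1#
    elements : List F
    elements-unique   : Unique elements
    elements-complete : ∀ x → x ∈ elements
    elements-card     : length elements ≡ q

module LinAlg {q : ℕ} (𝔽 : FiniteField q) where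
  open FiniteField 𝔽

  Vect : ℕ → Set
  Vect n = Fin n → F

  _≗ᵥ_ : ∀ {n} → Vect n → Vect n → Set
  x ≗ᵥ y = ∀ i → x i ≡ y i

  ∑ : ∀ {d} → (Fin d → F) → F
  ∑ {zero}  f = 0#
  ∑ {suc d} f = f Fin.zero + ∑ (f ∘ Fin.suc)
    where import Data.Fin as Fin

  lincomb : ∀ {d n} → (Fin d → F) → (Fin d → Vect n) → Vect n
  lincomb a v i = ∑ (λ k → a k * v k i)

  LinIndep : ∀ {d n} → (Fin d → Vect n) → Set
  LinIndep v = ∀ a → (∀ i → lincomb a v i ≡ 0#) → ∀ k → a k ≡ 0#

  record Subspace (n : ℕ) : Set₁ where
    field
      mem   : Vect n → Set
      resp  : ∀ {x y} → x ≗ᵥ y → mem x → mem y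
      zero∈ : mem (λ _ → 0#)
      add∈  : ∀ {x y} → mem x → mem y → mem (λ i → x i + y i)
      scale∈ : ∀ c {x} → mem x → mem (λ i → c * x i)
  open Subspace public

  HasDim : ∀ {n} → (Vect n → Set) → ℕ → Set
  HasDim {n} P d = Σ (Fin d → Vect n) λ v →
    (∀ k → P (v k)) × LinIndep v × (∀ x → P x → ∃ λ a → x ≗ᵥ lincomb a v)

  pow : F → ℕ → F
  pow x zero    = 1#
  pow x (suc e) = x * pow x e

  Δpow : ∀ {n} → (Fin n → F) → ℕ → Vect n → Vect n
  Δpow δ e w i = pow (δ i) e * w i

  Krylov : ∀ {n} → (Fin n → F) → ℕ → Subspace n → (Vect n → Set)
  Krylov {n} δ j W x = Σ (Fin j → Vect n) λ w →
    (∀ t → mem W (w t)) × (x ≗ᵥ (λ i → ∑ (λ t → Δpow δ (toℕ t) (w t) i)))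

  HasProfile : ∀ {n} → (Fin n → F) → Subspace n → List ℕ → Set
  HasProfile δ W μ =
    (∀ j → 1 ≤ j → j ≤ length μ → HasDim (Krylov δ j W) (sum (take j μ)))
    × ∃ λ d → HasDim (Krylov δ (length μ) W) d
            × HasDim (Krylov δ (suc (length μ)) W) d

  IsRREF : ∀ {m n} → (Fin m → Fin n) → (Fin m → Vect n) → Set
  IsRREF C R =
    (∀ r → R r (C r) ≡ 1#)
    × (∀ r t → toℕ t ℕ.< toℕ (C r) → R r t ≡ 0#)
    × (∀ r r' → r ≢ r' → R r' (C r) ≡ 0#)

  HasPivots : ∀ {m n} → (Fin m → Fin n) → Subspace n → Set
  HasPivots {m} {n} C W = Σ (Fin m → Vect n) λ R → IsRREF C R ×
    (∀ x → (mem W x → ∃ λ a → x ≗ᵥ lincomb a R)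
         × ((∃ λ a → x ≗ᵥ lincomb a R) → mem W x))

  SameSubspace : ∀ {n} → Subspace n → Subspace n → Set
  SameSubspace W W' = ∀ x → (mem W x → mem W' x) × (mem W' x → mem W x)

  HasCount : ∀ {n} → (Subspace n → Set) → ℕ → Set₁
  HasCount {n} P N = Σ (List (Subspace n)) λ L →
    length L ≡ N
    × All P L
    × Linked? L
    × (∀ W → P W → Σ (Subspace n) λ W' → (W' ∈ L) × SameSubspace W W')
    where
      Linked? : List (Subspace n) → Set₁
      Linked? [] = Data.Unit.Polymorphic.⊤ where import Data.Unit.Polymorphic
      Linked? (W ∷ L) = All (λ W' → ¬ SameSubspace W W') L × Linked? L

IsPartition : List ℕ → Set
IsPartition μ = All (λ x → 1 ≤ x) μ × Linked (λ a b → b ≤ a) μ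

conj : List ℕ → List ℕ
conj [] = []
conj μ@(μ₁ ∷ _) = applyUpTo (λ i → length (filter (λ x → suc i ℕ.≤? x) μ)) μ₁

nth : {A : Set} → List A → ℕ → Maybe A
nth [] _ = nothing
nth (x ∷ xs) zero = just x
nth (x ∷ xs) (suc i) = nth xs i

entry : List (List ℕ) → ℕ → ℕ → Maybe ℕ
entry T i j with nth T i
... | nothing = nothing
... | just row = nth row j

wordsOf : ℕ → ℕ → List (List ℕ)
wordsOf n zero = [] ∷ []
wordsOf n (suc ℓ) = concatMap (λ a → map (a ∷_) (wordsOf n ℓ)) (applyUpTo suc n)

fillings : ℕ → List ℕ → List (List (List ℕ))
fillings n [] = [] ∷ []
fillings n (ℓ ∷ λs) = concatMap (λ r → map (r ∷_) (fillings n λs)) (wordsOf n ℓ)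

strictInc : List ℕ → Bool
strictInc [] = true
strictInc (x ∷ []) = true
strictInc (x ∷ y ∷ xs) = (x <ᵇ y) ∧ strictInc (y ∷ xs)

noDup : List ℕ → Bool
noDup [] = true
noDup (x ∷ xs) = all (λ y → Data.Bool.not (x ≡ᵇ y)) xs ∧ noDup xs
  where import Data.Bool

colInc : List (List ℕ) → Bool
colInc T = and (concatMap (λ i → map (λ j → check (entry T i j) (entry T (suc i) j))
                                     (upTo (foldr ℕ._⊔_ 0 (map length T))))
                          (upTo (length T)))
  where
    check : Maybe ℕ → Maybe ℕ → Bool
    check _ nothing = true
    check (just a) (just b) = a <ᵇ b
    check nothing (just _) = false

firstCol : List (List ℕ) → List ℕ
firstCol [] = []
firstCol ([] ∷ T) = firstCol T
firstCol ((x ∷ _) ∷ T) = x ∷ firstCol T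

validTableau : List ℕ → List (List ℕ) → Bool
validTableau col T = and (map strictInc T) ∧ colInc T ∧ noDup (concat T)
                     ∧ listEq (firstCol T) col
  where
    listEq : List ℕ → List ℕ → Bool
    listEq [] [] = true
    listEq (a ∷ as) (b ∷ bs) = (a ≡ᵇ b) ∧ listEq as bs
    listEq _ _ = false

-- c_{ij}(T) (0-based i, j with j ≥ 1, i.e. paper's (i+1, j+1))
cij : List (List ℕ) → ℕ → ℕ → ℕ
cij T i j with entry T i j
... | nothing = 0
... | just t = length (filterᵇ (λ i' → below (entry T i' (j ∸ 1))) (applyUpTo (λ k → i ℕ.+ k) (length T ∸ i)))
  where
    below : Maybe ℕ → Bool
    below nothing = false
    below (just a) = a <ᵇ t

qint : ℕ → ℕ → ℕ
qint q a = sum (applyUpTo (q ^_) a)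

cq : ℕ → List (List ℕ) → ℕ
cq q T = product (concatMap (λ i → map (λ j → qint q (cij T i (suc j)))
                                       (upTo (rowLen i ∸ 1)))
                            (upTo (length T)))
  where
    rowLen : ℕ → ℕ
    rowLen i with nth T i
    ... | nothing = 0
    ... | just r = length r

tableauSum : ℕ → ℕ → List ℕ → List ℕ → ℕ
tableauSum q n λs col =
  sum (map (cq q) (filterᵇ (validTableau col) (fillings n λs)))

-- σ^C_n(μ) formula; C given 0-based, converted to [n] = {1..n}
sigma : ℕ → (n m : ℕ) → (Fin m → Fin n) → List ℕ → ℕ
sigma q n m C [] = 0
sigma q n m C (μ₁ ∷ μs) =
  (q ∸ 1) ^ sum μs ℕ.* q ^ sum (map (_choose 2) μs)
  ℕ.* tableauSum q n (conj (μ₁ ∷ μs)) (map (λ i → suc (toℕ (C i))) (allFin m))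

StrictlyIncreasing : ∀ {m n} → (Fin m → Fin n) → Set
StrictlyIncreasing C = ∀ i j → toℕ i ℕ.< toℕ j → toℕ (C i) ℕ.< toℕ (C j)

-- Let R be the reduced row echelon form of W, with pivots C, and let Y be the matrix with entries
-- R a b (δ b − δ a). Its rows live in the coordinates outside C, and Krylov (1 + j) W is the direct sum of W
-- and Krylov j of the row space of Y. Hence W has profile (m, μ₂, …) iff the row space of Y has profile
-- (μ₂, …). Since δ is injective, R can be recovered from Y, and Y is an arbitrary matrix supported on a < b
-- with a ∈ C, b ∉ C. Factor Y = Z R′ with R′ in reduced row echelon form, with pivots B: the factor Z is an
-- arbitrary C × B matrix supported on a < b with independent columns. Choosing its columns from left to right
-- there are ∏ᵢ (q ^ #{a ∈ C : a < bᵢ} − q ^ (i − 1)) such Z, so iterating gives a sum over chains of disjoint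
-- sets C, B, …, the columns of a tableau. Finally
-- q ^ a − q ^ (i − 1) = (q − 1) q ^ (i − 1) [a − i + 1]_q turns the product into the weight of two
-- consecutive columns, and it vanishes unless the rows increase.
module Submission where

open import Defs
open import Algebra.Bundles using (CommutativeRing)
open import Data.Nat as ℕ using (ℕ; zero; suc; _∸_; _^_; _≤_; z≤n; s≤s; _<ᵇ_; _≡ᵇ_)
import Data.Nat.Properties as ℕₚ
import Data.Bool.Properties as Boolₚ
open import Data.Nat.ListAction using (sum; product)
import Data.Nat.ListAction.Properties as ListActionₚ
open import Data.Nat.Combinatorics using (nC1≡n; nCk+nC[k+1]≡[n+1]C[k+1]) renaming (_C_ to _choose_)
open import Data.Nat.Tactic.RingSolver using (solve-∀)
open import Data.Bool using (Bool; true; false; _∧_; T; if_then_else_)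
open import Data.Bool.ListAction using (and; all)
open import Data.Fin as Fin using (Fin; toℕ; _≟_)
import Data.Fin.Properties as Finₚ
open import Data.Empty using (⊥)
open import Data.Unit using (⊤; tt)
open import Data.Product using (Σ; ∃; ∃₂; _×_; _,_; proj₁; proj₂)
open import Data.Sum using (_⊎_; inj₁; inj₂; [_,_]′)
open import Data.Maybe using (Maybe; just; nothing)
open import Data.List using (List; []; _∷_; _++_; length; map; filter; filterᵇ; take; drop; upTo;
  concatMap; foldr; allFin; concat; applyUpTo; lookup; _ʳ++_)
import Data.List.Properties as Listₚ
open import Data.List.Relation.Unary.All as All using (All; []; _∷_)
import Data.List.Relation.Unary.All.Properties as Allₚ
open import Data.List.Relation.Unary.Any as Any using (Any; here; there)
import Data.List.Relation.Unary.Any.Properties as Anyₚ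
open import Data.List.Relation.Unary.AllPairs as AllPairs using (AllPairs; []; _∷_)
import Data.List.Relation.Unary.AllPairs.Properties as AllPairsₚ
open import Data.List.Relation.Unary.Linked as Linked using (Linked; []; [-]; _∷_)
import Data.List.Relation.Unary.Linked.Properties as Linkedₚ
open import Data.List.Relation.Unary.Unique.Propositional using (Unique)
import Data.List.Relation.Unary.Unique.Propositional.Properties as Uniqueₚ
open import Data.List.Relation.Binary.Sublist.Propositional as Sublist using (_⊆_; []; _∷_; _∷ʳ_)
import Data.List.Relation.Binary.Sublist.Propositional.Properties as Sublistₚ
open import Data.List.Relation.Binary.Permutation.Propositional as Perm using (_↭_; ↭-refl; ↭-sym; ↭-trans; prep)
import Data.List.Relation.Binary.Permutation.Propositional.Properties as Permₚ
open import Data.List.Membership.Propositional using (_∈_; _∉_)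
import Data.List.Membership.Propositional.Properties as ∈ₚ
open import Data.List.Membership.Propositional.Properties.WithK using (unique∧set⇒bag)
open import Data.List.Relation.Binary.BagAndSetEquality using (∼bag⇒↭)
open import Function using (_∘_; id; Equivalence; mk⇔)
open import Relation.Nullary using (¬_; Dec; yes; no; does; ¬?; contradiction)
open import Relation.Nullary.Decidable using (toSum)
open import Relation.Unary using (Decidable)
open import Relation.Binary using (IsEquivalence; DecidableEquality; tri<; tri≈; tri>)
open import Relation.Binary.PropositionalEquality
  using (_≡_; _≢_; refl; sym; trans; cong; cong₂; subst; module ≡-Reasoning)
import Relation.Binary.PropositionalEquality as ≡

-- Row `a` of Y is the image of row `a` of R under the diagonal matrix minus `δ a` times that row,
-- so the diagonal matrix maps W into W plus the row space of Y. The sum is direct because Y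
-- vanishes in the columns C, while a vector of W is determined by its coordinates there. The factor
-- Z must consist of the columns of Y at the pivots B. Rows of R′ vanish left of their pivots, which
-- is why the support condition passes from Z to Y; independence of the columns of Z is what gives Y
-- and R′ the same row space, hence the same profile. The sets of admissible positions grow with i,
-- so the span of the earlier columns of Z, with q ^ (i - 1) elements, lies inside the space from
-- which column i is drawn. Vectors and matrices are compared entrywise, so the counting is done on
-- square echelon matrices up to pointwise equality and moved to subspaces at the end. The induction
-- ranges over echelon forms supported on a set `D` of columns, from which each pivot set is removed
-- in turn.

-- Finite enumerations up to an equivalence.

record Enumeration {A : Set} (_≈_ : A → A → Set) (P : A → Set) (N : ℕ) : Set where
  field
    list     : List A
    size     : length list ≡ N
    sound    : All P list
    distinct : AllPairs (λ x y → ¬ x ≈ y) list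
    covers   : ∀ x → P x → Any (x ≈_) list
open Enumeration public

resize : ∀ {A} {_≈_ : A → A → Set} {P M N} → M ≡ N → Enumeration _≈_ P M → Enumeration _≈_ P N
resize refl e = e

lookup-AllPairs : ∀ {A : Set} {R : A → A → Set} {xs} → AllPairs R xs →
  ∀ i j → i Fin.< j → R (lookup xs i) (lookup xs j)
lookup-AllPairs (px ∷ _)  Fin.zero    (Fin.suc j) _         = All.lookup px (∈ₚ.∈-lookup j)
lookup-AllPairs (_ ∷ pxs) (Fin.suc i) (Fin.suc j) (s≤s i<j) = lookup-AllPairs pxs i j i<j

lookup-distinct : ∀ {A : Set} {_≈_ : A → A → Set} {xs} → (∀ {x y} → x ≈ y → y ≈ x) →
  AllPairs (λ x y → ¬ x ≈ y) xs → ∀ i j → lookup xs i ≈ lookup xs j → i ≡ j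
lookup-distinct ≈-sym dist i j eq with Finₚ.<-cmp i j
... | tri< i<j _ _ = contradiction eq (lookup-AllPairs dist i j i<j)
... | tri≈ _ i≡j _ = i≡j
... | tri> _ _ j<i = contradiction (≈-sym eq) (lookup-AllPairs dist j i j<i)

filter-partition : ∀ {A : Set} {Q : A → Set} (Q? : Decidable Q) xs →
  length (filter Q? xs) ℕ.+ length (filter (¬? ∘ Q?) xs) ≡ length xs
filter-partition Q? []       = refl
filter-partition Q? (x ∷ xs) with Q? x
... | yes _ = cong suc (filter-partition Q? xs)
... | no  _ = trans (ℕₚ.+-suc _ _) (cong suc (filter-partition Q? xs))

sum-const : ∀ {A : Set} (f : A → ℕ) c xs → (∀ x → x ∈ xs → f x ≡ c) → sum (map f xs) ≡ length xs ℕ.* c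
sum-const f c []       _  = refl
sum-const f c (x ∷ xs) eq = cong₂ ℕ._+_ (eq x (here refl)) (sum-const f c xs (λ y → eq y ∘ there))

module _ {A : Set} {_≈_ : A → A → Set} (eqv : IsEquivalence _≈_) where
  private module E = IsEquivalence eqv

  -- Pigeonhole: the position in `ys` of an equivalent element is injective on the indices of `xs`,
  -- since two elements sent to one position would be equivalent to each other.
  enum-≤ : ∀ {xs ys : List A} → AllPairs (λ x y → ¬ x ≈ y) xs → All (λ x → Any (x ≈_) ys) xs →
    length xs ≤ length ys
  enum-≤ {xs} {ys} dist cov = Finₚ.injective⇒≤ {f = f} inj
    where
    at : ∀ i → Any (lookup xs i ≈_) ys
    at i = All.lookup cov (∈ₚ.∈-lookup i)
    f : Fin (length xs) → Fin (length ys)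
    f i = Any.index (at i)
    near : ∀ {i j} → f i ≡ f j → lookup xs i ≈ lookup xs j
    near {i} {j} eq = E.trans (Anyₚ.lookup-index (at i))
      (E.trans (E.reflexive (cong (lookup ys) eq)) (E.sym (Anyₚ.lookup-index (at j))))
    inj : ∀ {i j} → f i ≡ f j → i ≡ j
    inj eq = lookup-distinct E.sym dist _ _ (near eq)

  enum-size-≤ : ∀ {P Q M N} → (∀ x → P x → Q x) →
    Enumeration _≈_ P M → Enumeration _≈_ Q N → M ≤ N
  enum-size-≤ P⊆Q e f = ≡.subst₂ _≤_ (size e) (size f)
    (enum-≤ (distinct e) (All.map (λ {x} p → covers f x (P⊆Q x p)) (sound e)))

  enum-size-≡ : ∀ {P M N} → Enumeration _≈_ P M → Enumeration _≈_ P N → M ≡ N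
  enum-size-≡ e f = ℕₚ.≤-antisym (enum-size-≤ (λ _ p → p) e f) (enum-size-≤ (λ _ p → p) f e)

  enum-filter : ∀ {P Q : A → Set} {N} (Q? : Decidable Q) → (∀ {x y} → x ≈ y → Q x → Q y) →
    (e : Enumeration _≈_ P N) →
    Enumeration _≈_ (λ x → P x × Q x) (length (filter Q? (list e)))
  enum-filter {P} {Q} Q? resp e = record
    { list     = filter Q? (list e)
    ; size     = refl
    ; sound    = All.zip (Allₚ.filter⁺ Q? (sound e) , Allₚ.all-filter Q? (list e))
    ; distinct = AllPairsₚ.filter⁺ Q? (distinct e)
    ; covers   = λ x (p , q) → keep x q (list e) (covers e x p)
    }
    where
    keep : ∀ x → Q x → ∀ ys → Any (x ≈_) ys → Any (x ≈_) (filter Q? ys)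
    keep x q (y ∷ ys) x∈ with Q? y | x∈
    ... | yes _ | here x≈y = here x≈y
    ... | yes _ | there x∈′ = there (keep x q ys x∈′)
    ... | no ¬q | here x≈y = contradiction (resp x≈y q) ¬q
    ... | no _  | there x∈′ = keep x q ys x∈′

  -- Filtering `e` by `Q` gives a second enumeration of the predicate enumerated by `f`, so it has
  -- size `M`; the rejected part has the rest.
  enum-∖ : ∀ {P Q : A → Set} {M N} (Q? : Decidable Q) → (∀ {x y} → x ≈ y → Q x → Q y) →
    Enumeration _≈_ P N → Enumeration _≈_ (λ x → P x × Q x) M →
    Enumeration _≈_ (λ x → P x × ¬ Q x) (N ∸ M)
  enum-∖ {M = M} {N} Q? resp e f =
    resize eq (enum-filter (¬? ∘ Q?) (λ x≈y ¬q q → ¬q (resp (E.sym x≈y) q)) e)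
    where
    l = length (filter Q? (list e))
    l′ = length (filter (¬? ∘ Q?) (list e))
    l≡M : l ≡ M
    l≡M = enum-size-≡ (enum-filter Q? resp e) f
    eq : l′ ≡ N ∸ M
    eq = trans (sym (ℕₚ.m+n∸m≡n l l′))
               (cong₂ _∸_ (trans (filter-partition Q? (list e)) (size e)) l≡M)

-- Two-stage counting: choose `a`, then `b` in a family depending on `a`. In `onto`, the witness `b`
-- is asked for over every `a₀` equivalent to `a`, and must tolerate replacement by an equivalent
-- `b₀`, because only the listed representatives are available.
module _ {A B D : Set} {_≈₁_ : A → A → Set} {_≈₂_ : B → B → Set} {_≈₃_ : D → D → Set}
  {P : A → Set} {Q : A → B → Set} {R : D → Set} {N : ℕ}
  (e : Enumeration _≈₁_ P N) {f : A → ℕ}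
  (es : ∀ a → P a → Enumeration _≈₂_ (Q a) (f a))
  (g : A → B → D)
  (into : ∀ a b → P a → Q a b → R (g a b))
  (inj₁′ : ∀ a b a′ b′ → P a → Q a b → P a′ → Q a′ b′ → g a b ≈₃ g a′ b′ → a ≈₁ a′)
  (inj₂′ : ∀ a b b′ → P a → Q a b → Q a b′ → g a b ≈₃ g a b′ → b ≈₂ b′)
  (onto : ∀ d → R d → Σ A λ a → P a × (∀ a₀ → P a₀ → a ≈₁ a₀ →
     Σ B λ b → Q a₀ b × (∀ b₀ → Q a₀ b₀ → b ≈₂ b₀ → d ≈₃ g a₀ b₀)))
  where
  private
    go : ∀ xs → All P xs → List D
    go []       []       = []
    go (x ∷ xs) (p ∷ ps) = map (g x) (list (es x p)) ++ go xs ps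

    go-size : ∀ xs (ps : All P xs) → length (go xs ps) ≡ sum (map f xs)
    go-size []       []       = refl
    go-size (x ∷ xs) (p ∷ ps) = trans (Listₚ.length-++ (map (g x) (list (es x p))))
      (cong₂ ℕ._+_ (trans (Listₚ.length-map (g x) (list (es x p))) (size (es x p))) (go-size xs ps))

    go-sound : ∀ xs (ps : All P xs) → All R (go xs ps)
    go-sound []       []       = []
    go-sound (x ∷ xs) (p ∷ ps) =
      Allₚ.++⁺ (Allₚ.map⁺ (All.map (into x _ p) (sound (es x p)))) (go-sound xs ps)

    go-apart : ∀ x b → P x → Q x b → ∀ xs (ps : All P xs) → All (λ y → ¬ x ≈₁ y) xs →
      All (λ d → ¬ g x b ≈₃ d) (go xs ps)
    go-apart x b p q []       []         []       = []
    go-apart x b p q (y ∷ xs) (p′ ∷ ps) (x≉y ∷ x≉) =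
      Allₚ.++⁺ (Allₚ.map⁺ (All.map (λ q′ → x≉y ∘ inj₁′ x b y _ p q p′ q′) (sound (es y p′))))
               (go-apart x b p q xs ps x≉)

    go-distinct : ∀ xs (ps : All P xs) → AllPairs (λ x y → ¬ x ≈₁ y) xs →
      AllPairs (λ x y → ¬ x ≈₃ y) (go xs ps)
    go-distinct []       []       []         = []
    go-distinct (x ∷ xs) (p ∷ ps) (x≉ ∷ xs≉) = AllPairsₚ.++⁺
      (AllPairsₚ.map⁺ (separate (list (es x p)) (sound (es x p)) (distinct (es x p))))
      (go-distinct xs ps xs≉)
      (Allₚ.map⁺ (All.map (λ q → go-apart x _ p q xs ps x≉) (sound (es x p))))
      where
      separate : ∀ ys → All (Q x) ys → AllPairs (λ b b′ → ¬ b ≈₂ b′) ys →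
        AllPairs (λ b b′ → ¬ g x b ≈₃ g x b′) ys
      separate []       []       []         = []
      separate (y ∷ ys) (q ∷ qs) (y≉ ∷ ys≉) =
        All.map (λ (q′ , b≉) → b≉ ∘ inj₂′ x y _ p q q′) (All.zip (qs , y≉)) ∷ separate ys qs ys≉

    go-covers : ∀ {a d} → (∀ a₀ → P a₀ → a ≈₁ a₀ →
        Σ B λ b → Q a₀ b × (∀ b₀ → Q a₀ b₀ → b ≈₂ b₀ → d ≈₃ g a₀ b₀)) →
      ∀ xs (ps : All P xs) → Any (a ≈₁_) xs → Any (d ≈₃_) (go xs ps)
    go-covers h (x ∷ xs) (p ∷ ps) (here a≈x) with h x p a≈x
    ... | b , q , k = Anyₚ.++⁺ˡ (Anyₚ.map⁺ (pick (list (es x p)) (sound (es x p)) (covers (es x p) b q)))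
      where
      pick : ∀ ys → All (Q x) ys → Any (b ≈₂_) ys → Any (λ y → _ ≈₃ g x y) ys
      pick (y ∷ ys) (q′ ∷ _) (here b≈y) = here (k y q′ b≈y)
      pick (y ∷ ys) (_ ∷ qs) (there m)  = there (pick ys qs m)
    go-covers h (x ∷ xs) (p ∷ ps) (there a∈) =
      Anyₚ.++⁺ʳ (map (g x) (list (es x p))) (go-covers h xs ps a∈)

  enum-bind : Enumeration _≈₃_ R (sum (map f (list e)))
  enum-bind = record
    { list     = go (list e) (sound e)
    ; size     = go-size (list e) (sound e)
    ; sound    = go-sound (list e) (sound e)
    ; distinct = go-distinct (list e) (sound e) (distinct e)
    ; covers   = λ d r → let a , p , h = onto d r in
        go-covers h (list e) (sound e) (covers e a p)
    }

  enum-bind-const : ∀ {c} → (∀ a → P a → f a ≡ c) → Enumeration _≈₃_ R (N ℕ.* c)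
  enum-bind-const {c} eq = resize
    (trans (sum-const f c (list e) (λ x x∈ → eq x (All.lookup (sound e) x∈))) (cong (ℕ._* c) (size e)))
    enum-bind

enum-⊤ : Enumeration (_≡_ {A = ⊤}) (λ _ → ⊤) 1
enum-⊤ = record { list = tt ∷ [] ; size = refl ; sound = tt ∷ [] ; distinct = [] ∷ []
                ; covers = λ _ _ → here refl }

module _ {A D : Set} {_≈₁_ : A → A → Set} {_≈₃_ : D → D → Set} {P : A → Set} {R : D → Set} {N : ℕ}
  (g : A → D)
  (into : ∀ a → P a → R (g a))
  (inj : ∀ a a′ → P a → P a′ → g a ≈₃ g a′ → a ≈₁ a′)
  (onto : ∀ d → R d → Σ A λ a → P a × (∀ a₀ → P a₀ → a ≈₁ a₀ → d ≈₃ g a₀))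
  where

  enum-image : Enumeration _≈₁_ P N → Enumeration _≈₃_ R N
  enum-image e = resize (ℕₚ.*-identityʳ N) (enum-bind-const e {λ _ → 1}
    (λ _ _ → enum-⊤)
    (λ a _ → g a) (λ a _ p _ → into a p) (λ a _ a′ _ p _ p′ _ → inj a a′ p p′)
    (λ _ _ _ _ _ _ _ → refl)
    (λ d r → let a , p , k = onto d r in a , p , λ a₀ p₀ a≈ → tt , tt , λ _ _ _ → k a₀ p₀ a≈)
    (λ _ _ → refl))

enum-cong : ∀ {A : Set} {_≈_ : A → A → Set} {P Q N} → (∀ x → P x → Q x) → (∀ x → Q x → P x) →
  Enumeration _≈_ P N → Enumeration _≈_ Q N
enum-cong P⊆Q Q⊆P e = record { list = list e ; size = size e ; sound = All.map (λ {x} → P⊆Q x) (sound e)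
  ; distinct = distinct e ; covers = λ x → covers e x ∘ Q⊆P x }


-- Vectors, matrices and row spaces over a finite field.

module LinearAlgebra {q : ℕ} (𝔽 : FiniteField q) where
  open FiniteField 𝔽 public
  open LinAlg 𝔽 public

  commutativeRing : CommutativeRing _ _
  commutativeRing = record { isCommutativeRing = isCommutativeRing }

  open CommutativeRing commutativeRing public using
    (+-identityˡ; +-identityʳ; *-identityˡ; *-identityʳ; +-assoc; +-comm; *-assoc; *-comm;
     distribˡ; distribʳ; zeroˡ; zeroʳ; -‿inverseˡ; -‿inverseʳ; ring)
  open import Algebra.Properties.Ring ring public using (-‿distribˡ-*; -‿distribʳ-*; -0#≈0#; -‿+-comm)

  infixl 6 _-_
  _-_ : F → F → F
  x - y = x + - y

  1≢0 : 1# ≢ 0#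
  1≢0 = 0≢1 ∘ sym

  infix 4 _≟F_
  -- The position in the complete list `elements` determines the element, and positions are
  -- decidable.
  _≟F_ : DecidableEquality F
  x ≟F y with Any.index (elements-complete x) ≟ Any.index (elements-complete y)
  ... | yes i≡j = yes (trans (Anyₚ.lookup-index (elements-complete x))
                     (trans (cong (lookup elements) i≡j) (sym (Anyₚ.lookup-index (elements-complete y)))))
  ... | no  i≢j = no λ x≡y → i≢j (cong (Any.index ∘ elements-complete) x≡y)

  +-interchange : ∀ a b c d → (a + b) + (c + d) ≡ (a + c) + (b + d)
  +-interchange a b c d = trans (+-assoc a b (c + d)) (trans (cong (a +_)
    (trans (sym (+-assoc b c d)) (trans (cong (_+ d) (+-comm b c)) (+-assoc c b d))))
    (sym (+-assoc a c (b + d))))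

  *-swap : ∀ a b c → a * (b * c) ≡ b * (a * c)
  *-swap a b c = trans (sym (*-assoc a b c)) (trans (cong (_* c) (*-comm a b)) (*-assoc b a c))

  x-x≡0 : ∀ x → x - x ≡ 0#
  x-x≡0 = -‿inverseʳ

  x-0≡x : ∀ x → x - 0# ≡ x
  x-0≡x x = trans (cong (x +_) -0#≈0#) (+-identityʳ x)

  +-cancel-sub : ∀ x y → y + (x - y) ≡ x
  +-cancel-sub x y = trans (+-comm y (x - y)) (trans (+-assoc x (- y) y)
    (trans (cong (x +_) (-‿inverseˡ y)) (+-identityʳ x)))

  sub≡0⇒≡ : ∀ {x y} → x - y ≡ 0# → x ≡ y
  sub≡0⇒≡ {x} {y} eq = trans (sym (+-cancel-sub x y)) (trans (cong (y +_) eq) (+-identityʳ y))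

  0*≡0 : ∀ {x} y → x ≡ 0# → x * y ≡ 0#
  0*≡0 y eq = trans (cong (_* y) eq) (zeroˡ y)

  *0≡0 : ∀ x {y} → y ≡ 0# → x * y ≡ 0#
  *0≡0 x eq = trans (cong (x *_) eq) (zeroʳ x)

  0+0≡0 : ∀ {x y} → x ≡ 0# → y ≡ 0# → x + y ≡ 0#
  0+0≡0 ex ey = trans (cong₂ _+_ ex ey) (+-identityˡ 0#)

  0-0≡0 : ∀ {x y} → x ≡ 0# → y ≡ 0# → x - y ≡ 0#
  0-0≡0 ex ey = trans (cong₂ _-_ ex ey) (x-x≡0 0#)

  inverseˡ : ∀ x → x ≢ 0# → x ⁻¹ * x ≡ 1#
  inverseˡ x x≢0 = trans (*-comm _ x) (inverse x x≢0)

  ∑-cong : ∀ {d} {f g : Fin d → F} → (∀ i → f i ≡ g i) → ∑ f ≡ ∑ g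
  ∑-cong {zero}  eq = refl
  ∑-cong {suc d} eq = cong₂ _+_ (eq Fin.zero) (∑-cong (eq ∘ Fin.suc))

  ∑-zero : ∀ {d} {f : Fin d → F} → (∀ i → f i ≡ 0#) → ∑ f ≡ 0#
  ∑-zero {zero}  eq = refl
  ∑-zero {suc d} eq = 0+0≡0 (eq Fin.zero) (∑-zero (eq ∘ Fin.suc))

  ∑-+ : ∀ {d} (f g : Fin d → F) → ∑ (λ i → f i + g i) ≡ ∑ f + ∑ g
  ∑-+ {zero}  f g = sym (+-identityˡ 0#)
  ∑-+ {suc d} f g = trans (cong (_ +_) (∑-+ (f ∘ Fin.suc) (g ∘ Fin.suc))) (+-interchange _ _ _ _)

  *-∑ : ∀ {d} c (f : Fin d → F) → c * ∑ f ≡ ∑ (λ i → c * f i)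
  *-∑ {zero}  c f = zeroʳ c
  *-∑ {suc d} c f = trans (distribˡ c _ _) (cong (_ +_) (*-∑ c (f ∘ Fin.suc)))

  ∑-* : ∀ {d} (f : Fin d → F) c → ∑ f * c ≡ ∑ (λ i → f i * c)
  ∑-* f c = trans (*-comm _ c) (trans (*-∑ c f) (∑-cong λ i → *-comm c (f i)))

  ∑-swap : ∀ {d e} (f : Fin d → Fin e → F) → ∑ (λ i → ∑ (f i)) ≡ ∑ (λ j → ∑ (λ i → f i j))
  ∑-swap {zero}  {e} f = sym (∑-zero {e} λ _ → refl)
  ∑-swap {suc d} f = trans (cong (∑ (f Fin.zero) +_) (∑-swap (f ∘ Fin.suc))) (sym (∑-+ (f Fin.zero) _))

  ∑-single : ∀ {d} {f : Fin d → F} k → (∀ i → i ≢ k → f i ≡ 0#) → ∑ f ≡ f k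
  ∑-single Fin.zero    eq = trans (cong (_ +_) (∑-zero λ i → eq (Fin.suc i) λ ())) (+-identityʳ _)
  ∑-single {f = f} (Fin.suc k) eq = trans (cong₂ _+_ (eq Fin.zero λ ())
    (∑-single k λ i i≢k → eq (Fin.suc i) (i≢k ∘ Finₚ.suc-injective))) (+-identityˡ _)

  ∑-split : ∀ a {b} (f : Fin (a ℕ.+ b) → F) → ∑ f ≡ ∑ (λ i → f (i Fin.↑ˡ b)) + ∑ (λ j → f (a Fin.↑ʳ j))
  ∑-split zero    f = sym (+-identityˡ _)
  ∑-split (suc a) f = trans (cong (_ +_) (∑-split a (f ∘ Fin.suc))) (sym (+-assoc _ _ _))

  Mat : ℕ → ℕ → Set
  Mat d n = Fin d → Vect n

  _≗ₘ_ : ∀ {d n} → Mat d n → Mat d n → Set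
  X ≗ₘ Y = ∀ a → X a ≗ᵥ Y a

  infixl 7 _·_ _⊗_
  _·_ : ∀ {d n} → Vect d → Mat d n → Vect n
  _·_ = lincomb

  _⊗_ : ∀ {c d n} → Mat c d → Mat d n → Mat c n
  (X ⊗ Y) a = X a · Y

  ·-cong : ∀ {d n} {x y : Vect d} {M N : Mat d n} → x ≗ᵥ y → M ≗ₘ N → (x · M) ≗ᵥ (y · N)
  ·-cong x≗y M≗N i = ∑-cong λ k → cong₂ _*_ (x≗y k) (M≗N k i)

  ·-congˡ : ∀ {d n} {x y : Vect d} (M : Mat d n) → x ≗ᵥ y → (x · M) ≗ᵥ (y · M)
  ·-congˡ M x≗y = ·-cong {M = M} x≗y (λ _ _ → refl)

  ·-assoc : ∀ {c d n} (x : Vect c) (M : Mat c d) (N : Mat d n) → ((x · M) · N) ≗ᵥ (x · (M ⊗ N))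
  ·-assoc x M N i = begin
    ∑ (λ k → ∑ (λ j → x j * M j k) * N k i)     ≡⟨ ∑-cong (λ k → ∑-* (λ j → x j * M j k) (N k i)) ⟩
    ∑ (λ k → ∑ (λ j → x j * M j k * N k i))     ≡⟨ ∑-swap (λ k j → x j * M j k * N k i) ⟩
    ∑ (λ j → ∑ (λ k → x j * M j k * N k i))     ≡⟨ ∑-cong (λ j → ∑-cong λ k → *-assoc (x j) (M j k) (N k i)) ⟩
    ∑ (λ j → ∑ (λ k → x j * (M j k * N k i)))   ≡⟨ ∑-cong (λ j → *-∑ (x j) (λ k → M j k * N k i)) ⟨
    ∑ (λ j → x j * ∑ (λ k → M j k * N k i))     ∎
    where open ≡-Reasoning

  ·-+ : ∀ {d n} (x y : Vect d) (M : Mat d n) → ((λ k → x k + y k) · M) ≗ᵥ (λ i → (x · M) i + (y · M) i)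
  ·-+ x y M i = trans (∑-cong λ k → distribʳ (M k i) (x k) (y k)) (∑-+ (λ k → x k * M k i) (λ k → y k * M k i))

  ·-scale : ∀ {d n} c (x : Vect d) (M : Mat d n) → ((λ k → c * x k) · M) ≗ᵥ (λ i → c * (x · M) i)
  ·-scale c x M i = trans (∑-cong λ k → *-assoc c (x k) (M k i)) (sym (*-∑ c (λ k → x k * M k i)))

  ·-sub : ∀ {d n} (x y : Vect d) (M : Mat d n) → ((λ k → x k - y k) · M) ≗ᵥ (λ i → (x · M) i - (y · M) i)
  ·-sub x y M i = trans (·-+ x (λ k → - y k) M i) (cong ((x · M) i +_) (trans
    (∑-cong λ k → trans (cong (_* M k i) (neg (y k))) (*-assoc (- 1#) (y k) (M k i)))
    (trans (sym (*-∑ (- 1#) (λ k → y k * M k i))) (sym (neg _)))))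
    where
    neg : ∀ z → - z ≡ - 1# * z
    neg z = trans (cong -_ (sym (*-identityˡ z))) (-‿distribˡ-* 1# z)

  𝕀 : ∀ {n} → Mat n n
  𝕀 a b = if does (a ≟ b) then 1# else 0#

  𝕀-diag : ∀ {n} (a : Fin n) → 𝕀 a a ≡ 1#
  𝕀-diag a with a ≟ a
  ... | yes _  = refl
  ... | no a≢a = contradiction refl a≢a

  𝕀-off : ∀ {n} {a b : Fin n} → a ≢ b → 𝕀 a b ≡ 0#
  𝕀-off {a = a} {b} a≢b with a ≟ b
  ... | yes a≡b = contradiction a≡b a≢b
  ... | no _    = refl

  𝕀-sym : ∀ {n} (a b : Fin n) → 𝕀 a b ≡ 𝕀 b a
  𝕀-sym a b with a ≟ b
  ... | yes refl = sym (𝕀-diag a)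
  ... | no a≢b   = sym (𝕀-off (a≢b ∘ sym))

  𝕀-· : ∀ {d n} a (M : Mat d n) → (𝕀 a · M) ≗ᵥ M a
  𝕀-· a M i = trans (∑-single a λ k k≢a → 0*≡0 (M k i) (𝕀-off (k≢a ∘ sym)))
                    (trans (cong (_* M a i) (𝕀-diag a)) (*-identityˡ _))

  ·-𝕀 : ∀ {n} (x : Vect n) → (x · 𝕀) ≗ᵥ x
  ·-𝕀 x i = trans (∑-single i λ k k≢i → *0≡0 (x k) (𝕀-off k≢i))
                  (trans (cong (x i *_) (𝕀-diag i)) (*-identityʳ _))

  SumClosed : ∀ {d n} (W : Subspace n) (a : Vect d) (M : Mat d n) → (∀ k → mem W (M k)) → mem W (a · M)
  SumClosed {zero}  W a M M∈ = zero∈ W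
  SumClosed {suc d} W a M M∈ =
    add∈ W (scale∈ W (a Fin.zero) (M∈ Fin.zero)) (SumClosed W (a ∘ Fin.suc) (M ∘ Fin.suc) (M∈ ∘ Fin.suc))

  sub∈ : ∀ {n} (W : Subspace n) c {x y} → mem W x → mem W y → mem W (λ i → x i - c * y i)
  sub∈ W c {x} {y} x∈ y∈ = resp W (λ i → cong (x i +_) (sym (-‿distribˡ-* c (y i)))) (add∈ W x∈ (scale∈ W (- c) y∈))

  rowSp : ∀ {d n} → Mat d n → Subspace n
  rowSp M = record
    { mem    = λ x → ∃ λ a → x ≗ᵥ (a · M)
    ; resp   = λ x≗y (a , x≗) → a , λ i → trans (sym (x≗y i)) (x≗ i)
    ; zero∈  = (λ _ → 0#) , λ i → sym (∑-zero λ k → zeroˡ (M k i))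
    ; add∈   = λ (a , x≗) (b , y≗) → (λ k → a k + b k) , λ i → trans (cong₂ _+_ (x≗ i) (y≗ i)) (sym (·-+ a b M i))
    ; scale∈ = λ c (a , x≗) → (λ k → c * a k) , λ i → trans (cong (c *_) (x≗ i)) (sym (·-scale c a M i))
    }

  row∈ : ∀ {d n} (M : Mat d n) a → mem (rowSp M) (M a)
  row∈ M a = 𝕀 a , λ i → sym (𝕀-· a M i)

  rowSp-⊆ : ∀ {d n} (W : Subspace n) {M : Mat d n} → (∀ a → mem W (M a)) → ∀ {x} → mem (rowSp M) x → mem W x
  rowSp-⊆ W {M} M∈ (a , x≗) = resp W (λ i → sym (x≗ i)) (SumClosed W a M M∈)

  rowSp-same : ∀ {d e n} {M : Mat d n} {N : Mat e n} →
    (∀ a → mem (rowSp N) (M a)) → (∀ a → mem (rowSp M) (N a)) → SameSubspace (rowSp M) (rowSp N)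
  rowSp-same {M = M} {N} M∈ N∈ x = rowSp-⊆ (rowSp N) {M} M∈ , rowSp-⊆ (rowSp M) {N} N∈

infix 4 _∈?_
_∈?_ : ∀ {n} (a : Fin n) S → Dec (a ∈ S)
a ∈? S = Any.any? (a ≟_) S

-- Reduced row echelon forms and Gauss-Jordan elimination.

module RowReduction {q : ℕ} (𝔽 : FiniteField q) where
  open LinearAlgebra 𝔽 public

  -- A reduced row echelon form is stored as a square matrix: the row with pivot a has index a,
  -- and the rows indexed outside the pivot set S vanish.
  record RREF {n : ℕ} (S D : List (Fin n)) (R : Mat n n) : Set where
    field
      off-pivots : ∀ a b → a ∉ S → R a b ≡ 0#
      pivot      : ∀ a → a ∈ S → R a a ≡ 1#
      clear      : ∀ a b → b ∈ S → a ≢ b → R a b ≡ 0#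
      echelon    : ∀ a b → b Fin.< a → R a b ≡ 0#
      support    : ∀ a b → b ∉ D → R a b ≡ 0#

    pivots⊆ : ∀ {a} → a ∈ S → a ∈ D
    pivots⊆ {a} a∈S with a ∈? D
    ... | yes a∈D = a∈D
    ... | no  a∉D = contradiction (trans (sym (pivot a a∈S)) (support a a a∉D)) 1≢0

    ·-pivot : ∀ (x : Vect n) {s} → s ∈ S → (x · R) s ≡ x s
    ·-pivot x {s} s∈S = trans (∑-single s λ a a≢s → *0≡0 (x a) (clear a s s∈S a≢s))
                          (trans (cong (x s *_) (pivot s s∈S)) (*-identityʳ _))

    -- The square encoding makes `R` a projection onto its row space: at the pivots, row `a` has the
    -- coordinates of a unit vector, and at the other indices the rows of `R` are zero.
    idempotent : (R ⊗ R) ≗ₘ R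
    idempotent a b with a ∈? S
    ... | no a∉S = trans (∑-zero λ k → 0*≡0 (R k b) (off-pivots a k a∉S)) (sym (off-pivots a b a∉S))
    ... | yes a∈S = trans (∑-single a off) (trans (cong (_* R a b) (pivot a a∈S)) (*-identityˡ _))
      where
      off : ∀ k → k ≢ a → R a k * R k b ≡ 0#
      off k k≢a with k ∈? S
      ... | yes k∈S = 0*≡0 (R k b) (clear a k k∈S (k≢a ∘ sym))
      ... | no  k∉S = *0≡0 (R a k) (off-pivots k b k∉S)

    -- Idempotence turns membership into an equation in which `x` serves as its own vector of
    -- coefficients.
    fixed : ∀ {x} → mem (rowSp R) x → x ≗ᵥ (x · R)
    fixed {x} (v , x≗) i = begin
      x i              ≡⟨ x≗ i ⟩
      (v · R) i        ≡⟨ ·-cong {x = v} {M = R ⊗ R} (λ _ → refl) idempotent i ⟨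
      (v · (R ⊗ R)) i  ≡⟨ ·-assoc v R R i ⟨
      ((v · R) · R) i  ≡⟨ ·-congˡ R x≗ i ⟨
      (x · R) i        ∎
      where open ≡-Reasoning

    vanish : ∀ {x} → mem (rowSp R) x → (∀ {s} → s ∈ S → x s ≡ 0#) → ∀ i → x i ≡ 0#
    vanish {x} x∈ x≡0 i = trans (fixed x∈ i) (∑-zero term)
      where
      term : ∀ k → x k * R k i ≡ 0#
      term k with k ∈? S
      ... | yes k∈S = 0*≡0 (R k i) (x≡0 k∈S)
      ... | no  k∉S = *0≡0 (x k) (off-pivots k i k∉S)

    -- In `x p = (x · R) p` the terms left of `p` vanish by assumption, those right of `p` by the
    -- echelon shape, and the term at `p` would vanish too if `p` were not a pivot. Hence the row
    -- space determines the pivots.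
    leading : ∀ {x} → mem (rowSp R) x → ∀ p → x p ≢ 0# → (∀ b → b Fin.< p → x b ≡ 0#) → p ∈ S
    leading {x} x∈ p xp≢0 x<p≡0 with p ∈? S
    ... | yes p∈S = p∈S
    ... | no  p∉S = contradiction (trans (fixed x∈ p) (∑-zero term)) xp≢0
      where
      term : ∀ k → x k * R k p ≡ 0#
      term k with Finₚ.<-cmp k p
      ... | tri< k<p _ _  = 0*≡0 (R k p) (x<p≡0 k k<p)
      ... | tri≈ _ refl _ = *0≡0 (x k) (off-pivots k p p∉S)
      ... | tri> _ _ p<k  = *0≡0 (x k) (echelon k p p<k)

    rebase : ∀ {S′ D′} → (∀ {a} → a ∈ S → a ∈ S′) → (∀ {a} → a ∈ S′ → a ∈ S) →
      (∀ {a} → a ∈ D → a ∈ D′) → RREF S′ D′ R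
    rebase S⊆ S⊇ D⊆ = record
      { off-pivots = λ a b a∉ → off-pivots a b (a∉ ∘ S⊆)
      ; pivot      = λ a a∈ → pivot a (S⊇ a∈)
      ; clear      = λ a b b∈ → clear a b (S⊇ b∈)
      ; echelon    = echelon
      ; support    = λ a b b∉ → support a b (b∉ ∘ D⊆)
      }

  module _ {n : ℕ} {S S′ D : List (Fin n)} {R R′ : Mat n n} (rref : RREF S D R) (rref′ : RREF S′ D R′)
           (R⊆R′ : ∀ x → mem (rowSp R) x → mem (rowSp R′) x) where
    private
      module P = RREF rref
      module P′ = RREF rref′

    pivots-⊆ : ∀ {a} → a ∈ S → a ∈ S′
    pivots-⊆ {a} a∈S = P′.leading (R⊆R′ _ (row∈ R a)) a (λ eq → 1≢0 (trans (sym (P.pivot a a∈S)) eq)) (P.echelon a)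

    -- Row `a` of `R` is fixed by `R′`, and its coordinates at the pivots of `R′`, all of them
    -- pivots of `R`, are those of a unit vector; so it equals row `a` of `R′`.
    RREF-unique : (∀ {a} → a ∈ S′ → a ∈ S) → R ≗ₘ R′
    RREF-unique S′⊆S a b with a ∈? S
    ... | no a∉S = trans (P.off-pivots a b a∉S) (sym (P′.off-pivots a b (a∉S ∘ S′⊆S)))
    ... | yes a∈S = trans (P′.fixed (R⊆R′ _ (row∈ R a)) b)
        (trans (∑-single a off) (trans (cong (_* R′ a b) (P.pivot a a∈S)) (*-identityˡ _)))
      where
      off : ∀ k → k ≢ a → R a k * R′ k b ≡ 0#
      off k k≢a with k ∈? S′
      ... | yes k∈S′ = 0*≡0 (R′ k b) (P.clear a k (S′⊆S k∈S′) (k≢a ∘ sym))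
      ... | no  k∉S′ = *0≡0 (R a k) (P′.off-pivots k b k∉S′)

  leadingEntry : ∀ {n} (x : Vect n) →
    (∀ i → x i ≡ 0#) ⊎ ∃ λ p → x p ≢ 0# × (∀ b → b Fin.< p → x b ≡ 0#)
  leadingEntry {zero}  x = inj₁ λ ()
  leadingEntry {suc n} x with x Fin.zero ≟F 0#
  ... | no x₀≢0 = inj₂ (Fin.zero , x₀≢0 , λ b ())
  ... | yes x₀≡0 with leadingEntry (x ∘ Fin.suc)
  ...   | inj₁ x≡0 = inj₁ λ { Fin.zero → x₀≡0 ; (Fin.suc i) → x≡0 i }
  ...   | inj₂ (p , xp≢0 , x<p≡0) =
    inj₂ (Fin.suc p , xp≢0 , λ { Fin.zero _ → x₀≡0 ; (Fin.suc b) (s≤s b<p) → x<p≡0 b b<p })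

  module _ {n : ℕ} {D : List (Fin n)} where

    -- One step of Gauss-Jordan elimination: reduce `v` modulo `R`; if something remains, normalise
    -- it at its leading position `p` and clear column `p` from the old rows.
    module Insert {S : List (Fin n)} {R : Mat n n} (rref : RREF S D R) (v : Vect n)
                  (v-support : ∀ b → b ∉ D → v b ≡ 0#) where
      open RREF rref

      residue : Vect n
      residue i = v i - (v · R) i

      residue-pivot : ∀ {s} → s ∈ S → residue s ≡ 0#
      residue-pivot {s} s∈S = trans (cong (λ z → v s - z) (·-pivot v s∈S)) (x-x≡0 (v s))

      residue-support : ∀ b → b ∉ D → residue b ≡ 0#
      residue-support b b∉D = 0-0≡0 (v-support b b∉D) (∑-zero λ k → *0≡0 (v k) (support k b b∉D))

      module _ (p : Fin n) (rp≢0 : residue p ≢ 0#) (r<p≡0 : ∀ b → b Fin.< p → residue b ≡ 0#) where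

        p∉S : p ∉ S
        p∉S p∈S = rp≢0 (residue-pivot p∈S)

        w : Vect n
        w i = residue p ⁻¹ * residue i

        newRow : ∀ {a b} → Dec (a ≡ p) → F
        newRow {a} {b} (yes _) = w b
        newRow {a} {b} (no _)  = R a b - R a p * w b

        R₊ : Mat n n
        R₊ a b = newRow {a} {b} (a ≟ p)

        wp≡1 : w p ≡ 1#
        wp≡1 = inverseˡ _ rp≢0

        rref₊ : RREF (p ∷ S) D R₊
        rref₊ = record
          { off-pivots = λ a b a∉ → off a b a∉ (a ≟ p)
          ; pivot      = λ a a∈ → piv a a∈ (a ≟ p)
          ; clear      = λ a b b∈ a≢b → clr a b b∈ a≢b (a ≟ p)
          ; echelon    = λ a b b<a → ech a b b<a (a ≟ p)
          ; support    = λ a b b∉ → sup a b b∉ (a ≟ p)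
          }
          where
          off : ∀ a b → a ∉ p ∷ S → (a≟p : Dec (a ≡ p)) → newRow {a} {b} a≟p ≡ 0#
          off a b a∉ (yes a≡p) = contradiction (here a≡p) a∉
          off a b a∉ (no _)    = 0-0≡0 (off-pivots a b (a∉ ∘ there)) (0*≡0 (w b) (off-pivots a p (a∉ ∘ there)))
          piv : ∀ a → a ∈ p ∷ S → (a≟p : Dec (a ≡ p)) → newRow {a} {a} a≟p ≡ 1#
          piv a _           (yes refl) = wp≡1
          piv a (here a≡p)  (no a≢p)   = contradiction a≡p a≢p
          piv a (there a∈S) (no a≢p)   = trans (cong₂ _-_ (pivot a a∈S)
            (*0≡0 (R a p) (*0≡0 (residue p ⁻¹) (residue-pivot a∈S)))) (x-0≡x 1#)
          clr : ∀ a b → b ∈ p ∷ S → a ≢ b → (a≟p : Dec (a ≡ p)) → newRow {a} {b} a≟p ≡ 0#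
          clr a b (here refl) a≢b (yes a≡p) = contradiction a≡p a≢b
          clr a b (there b∈S) a≢b (yes a≡p) = *0≡0 (residue p ⁻¹) (residue-pivot b∈S)
          clr a b (here refl) a≢b (no _)    =
            trans (cong (λ z → R a b - R a b * z) wp≡1) (trans (cong (λ z → R a b - z) (*-identityʳ _)) (x-x≡0 _))
          clr a b (there b∈S) a≢b (no _)    =
            0-0≡0 (clear a b b∈S a≢b) (*0≡0 (R a p) (*0≡0 (residue p ⁻¹) (residue-pivot b∈S)))
          ech : ∀ a b → b Fin.< a → (a≟p : Dec (a ≡ p)) → newRow {a} {b} a≟p ≡ 0#
          ech a b b<a (yes refl) = *0≡0 (residue p ⁻¹) (r<p≡0 b b<a)
          -- Clearing column `p` keeps the zeros left of `a`: either `p < a` and the multiplier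
          -- `R a p` is zero, or `b < p` and `w` is zero at `b`.
          ech a b b<a (no a≢p) with p Fin.<? a
          ... | yes p<a = 0-0≡0 (echelon a b b<a) (0*≡0 (w b) (echelon a p p<a))
          ... | no  p≮a = 0-0≡0 (echelon a b b<a) (*0≡0 (R a p) (*0≡0 (residue p ⁻¹)
            (r<p≡0 b (ℕₚ.<-≤-trans b<a (ℕₚ.≮⇒≥ p≮a)))))
          sup : ∀ a b → b ∉ D → (a≟p : Dec (a ≡ p)) → newRow {a} {b} a≟p ≡ 0#
          sup a b b∉ (yes _) = *0≡0 (residue p ⁻¹) (residue-support b b∉)
          sup a b b∉ (no _)  = 0-0≡0 (support a b b∉) (*0≡0 (R a p) (*0≡0 (residue p ⁻¹) (residue-support b b∉)))

        w≗R₊p : w ≗ᵥ R₊ p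
        w≗R₊p i with p ≟ p
        ... | yes _  = refl
        ... | no p≢p = contradiction refl p≢p

        w∈ : mem (rowSp R₊) w
        w∈ = resp (rowSp R₊) (λ i → sym (w≗R₊p i)) (row∈ R₊ p)

        old∈ : ∀ a → mem (rowSp R₊) (R a)
        old∈ a with a ≟ p in eq
        ... | yes refl = resp (rowSp R₊) (λ i → sym (off-pivots a i p∉S)) (zero∈ (rowSp R₊))
        ... | no a≢p   = resp (rowSp R₊)
          (λ i → trans (cong (λ d → newRow {a} {i} d + R a p * w i) eq)
                       (trans (+-comm _ _) (+-cancel-sub (R a i) (R a p * w i))))
          (add∈ (rowSp R₊) (row∈ R₊ a) (scale∈ (rowSp R₊) (R a p) w∈))

        v∈₊ : mem (rowSp R₊) v
        v∈₊ = resp (rowSp R₊) eq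
          (add∈ (rowSp R₊) (SumClosed (rowSp R₊) v R old∈) (scale∈ (rowSp R₊) (residue p) w∈))
          where
          eq : ∀ i → (v · R) i + residue p * w i ≡ v i
          eq i = trans (cong ((v · R) i +_) (trans (sym (*-assoc _ _ _))
                   (trans (cong (_* residue i) (inverse _ rp≢0)) (*-identityˡ _))))
                   (+-cancel-sub (v i) ((v · R) i))

        w∈W : ∀ (W : Subspace n) → (∀ a → mem W (R a)) → mem W v → mem W w
        w∈W W R∈ v∈ = scale∈ W _ (resp W
          (λ i → cong (λ z → v i - z) (*-identityˡ _)) (sub∈ W 1# v∈ (SumClosed W v R R∈)))

        R₊∈ : ∀ (W : Subspace n) → (∀ a → mem W (R a)) → mem W v → ∀ a → mem W (R₊ a)
        R₊∈ W R∈ v∈ a with a ≟ p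
        ... | yes _ = w∈W W R∈ v∈
        ... | no _  = sub∈ W (R a p) (R∈ a) (w∈W W R∈ v∈)

      -- The last component bounds the new row space from above by every subspace containing the old
      -- rows and `v`; together with the two memberships it identifies the row space. Distinctness
      -- of the pivots is carried along so that their number is the dimension.
      insert : ∃₂ λ S′ R′ → RREF S′ D R′ × (Unique S → Unique S′) × (∀ a → mem (rowSp R′) (R a)) × mem (rowSp R′) v ×
        (∀ W → (∀ a → mem W (R a)) → mem W v → ∀ a → mem W (R′ a))
      insert with leadingEntry residue
      ... | inj₁ r≡0 = S , R , rref , id , row∈ R , (v , λ i → sub≡0⇒≡ (r≡0 i)) , λ W R∈ _ → R∈
      ... | inj₂ (p , rp≢0 , r<p≡0) = p ∷ S , R₊ p rp≢0 r<p≡0 , rref₊ p rp≢0 r<p≡0 ,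
        (Allₚ.¬Any⇒All¬ S (p∉S p rp≢0 r<p≡0) ∷_) , old∈ p rp≢0 r<p≡0 , v∈₊ p rp≢0 r<p≡0 , R₊∈ p rp≢0 r<p≡0

    module _ {d} (M : Mat d n) (M-support : ∀ a b → b ∉ D → M a b ≡ 0#) where

      reduceRows : ∀ (as : List (Fin d)) → ∃₂ λ S R → RREF S D R × Unique S ×
        (∀ {a} → a ∈ as → mem (rowSp R) (M a)) × (∀ s → mem (rowSp M) (R s))
      reduceRows [] = [] , (λ _ _ → 0#) , record
          { off-pivots = λ _ _ _ → refl ; pivot = λ _ () ; clear = λ _ _ () ; echelon = λ _ _ _ → refl
          ; support = λ _ _ _ → refl } ,
        [] , (λ ()) , λ s → zero∈ (rowSp M)
      reduceRows (a ∷ as) =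
        let S , R , rref , S! , M∈ , R∈ = reduceRows as
            S′ , R′ , rref′ , grow , R⊆ , a∈ , into = Insert.insert rref (M a) (M-support a)
        in S′ , R′ , rref′ , grow S! ,
           (λ { (here refl) → a∈ ; (there x∈) → rowSp-⊆ (rowSp R′) {R} R⊆ (M∈ x∈) }) ,
           into (rowSp M) R∈ (row∈ M a)

      rowReduce : ∃₂ λ S R → RREF S D R × Unique S × SameSubspace (rowSp M) (rowSp R)
      rowReduce = let S , R , rref , S! , M∈ , R∈ = reduceRows (allFin d) in
        S , R , rref , S! , rowSp-same {M = M} {R} (λ a → M∈ (∈ₚ.∈-allFin a)) R∈

  -- Coefficients are read off at the pivots, which gives independence; subtracting the combination
  -- so prescribed leaves a vector that vanishes at all pivots, hence zero. The listing `c` is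
  -- arbitrary so that both a pivot list and the given `C` can serve.
  RREF-dim : ∀ {n k S D} {R : Mat n n} → RREF S D R → (c : Fin k → Fin n) →
    (∀ {i j} → c i ≡ c j → i ≡ j) → (∀ i → c i ∈ S) → (∀ {a} → a ∈ S → ∃ λ i → a ≡ c i) →
    HasDim (mem (rowSp R)) k
  RREF-dim {n} {k} {S} {D} {R} rref c c-inj c∈ onto = R ∘ c , (λ i → row∈ R (c i)) , indep , spans
    where
    open RREF rref
    at-pivot : ∀ (a : Vect k) i → (a · (R ∘ c)) (c i) ≡ a i
    at-pivot a i = trans (∑-single i λ j j≢i → *0≡0 (a j) (clear (c j) (c i) (c∈ i) (j≢i ∘ c-inj)))
                         (trans (cong (a i *_) (pivot (c i) (c∈ i))) (*-identityʳ _))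
    indep : LinIndep (R ∘ c)
    indep a eq i = trans (sym (at-pivot a i)) (eq (c i))
    spans : ∀ x → mem (rowSp R) x → ∃ λ a → x ≗ᵥ (a · (R ∘ c))
    spans x x∈ = x ∘ c , λ i → sub≡0⇒≡ (trans (cong (λ z → x i - z) (sym (*-identityˡ _)))
      (vanish (sub∈ (rowSp R) 1# x∈ (SumClosed (rowSp R) (x ∘ c) (R ∘ c) (row∈ R ∘ c))) zeroAt i))
      where
      zeroAt : ∀ {s} → s ∈ S → x s - 1# * (x ∘ c · (R ∘ c)) s ≡ 0#
      zeroAt s∈ with onto s∈
      ... | i , refl = trans (cong (λ z → x (c i) - z) (trans (*-identityˡ _) (at-pivot (x ∘ c) i))) (x-x≡0 _)

  RREF-dim-list : ∀ {n S D} {R : Mat n n} → Unique S → RREF S D R → HasDim (mem (rowSp R)) (length S)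
  RREF-dim-list {S = S} S! rref = RREF-dim rref (lookup S) (λ {i} {j} → lookup-distinct sym S! i j) ∈ₚ.∈-lookup
    (λ a∈ → Any.index a∈ , Anyₚ.lookup-index a∈)

-- Dimension by counting vectors.

^-injectiveʳ : ∀ {q a b} → 2 ≤ q → q ^ a ≡ q ^ b → a ≡ b
^-injectiveʳ {q} {a} {b} 2≤q eq with ℕₚ.<-cmp a b
... | tri< a<b _ _ = contradiction eq (ℕₚ.<⇒≢ (ℕₚ.^-monoʳ-< q 2≤q a<b))
... | tri≈ _ a≡b _ = a≡b
... | tri> _ _ b<a = contradiction (sym eq) (ℕₚ.<⇒≢ (ℕₚ.^-monoʳ-< q 2≤q b<a))

module Dimension {q : ℕ} (𝔽 : FiniteField q) where
  open RowReduction 𝔽 public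

  ≗ᵥ-isEquivalence : ∀ {n} → IsEquivalence (_≗ᵥ_ {n})
  ≗ᵥ-isEquivalence = record
    { refl = λ _ → refl ; sym = λ e i → sym (e i) ; trans = λ e f i → trans (e i) (f i) }

  Supp : ∀ {n} → List (Fin n) → Vect n → Set
  Supp S x = ∀ b → b ∉ S → x b ≡ 0#

  enum-field : Enumeration _≡_ (λ (_ : F) → ⊤) q
  enum-field = record { list = elements ; size = elements-card ; sound = All.universal (λ _ → tt) elements
    ; distinct = elements-unique ; covers = λ x _ → elements-complete x }

  infixl 8 _[_≔_]
  _[_≔_] : ∀ {n} → Vect n → Fin n → F → Vect n
  (x [ b ≔ c ]) i = if does (i ≟ b) then c else x i

  update-at : ∀ {n} (x : Vect n) b c → (x [ b ≔ c ]) b ≡ c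
  update-at x b c with b ≟ b
  ... | yes _  = refl
  ... | no b≢b = contradiction refl b≢b

  update-off : ∀ {n} (x : Vect n) {b i} c → i ≢ b → (x [ b ≔ c ]) i ≡ x i
  update-off x {b} {i} c i≢b with i ≟ b
  ... | yes i≡b = contradiction i≡b i≢b
  ... | no _    = refl

  -- The value at `b` is chosen first; what remains is the vector with its entry at `b` reset to
  -- zero.
  enum-Supp-∷ : ∀ {n S N} {b : Fin n} → b ∉ S → Enumeration _≗ᵥ_ (Supp S) N → Enumeration _≗ᵥ_ (Supp (b ∷ S)) (q ℕ.* N)
  enum-Supp-∷ {n} {S} {N} {b} b∉S e = enum-bind-const enum-field {λ _ → N} (λ _ _ → e) (λ c x → x [ b ≔ c ])
    (λ c x _ x∈ i i∉ → trans (update-off x c (i∉ ∘ here)) (x∈ i (i∉ ∘ there)))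
    (λ c x c′ x′ _ _ _ _ eq → trans (sym (update-at x b c)) (trans (eq b) (update-at x′ b c′)))
    (λ c x x′ _ x∈ x′∈ eq i → separate x x′ c x∈ x′∈ eq i (i ≟ b))
    (λ x x∈ → x b , tt , λ { c₀ _ refl → x [ b ≔ 0# ] , (λ i i∉S → clear x i i∉S x∈ (i ≟ b)) ,
       λ x₀ _ eq i → cover x x₀ eq i (i ≟ b) })
    (λ _ _ → refl)
    where
    separate : ∀ x x′ c → Supp S x → Supp S x′ → (x [ b ≔ c ]) ≗ᵥ (x′ [ b ≔ c ]) → ∀ i → Dec (i ≡ b) → x i ≡ x′ i
    separate x x′ c x∈ x′∈ eq i (yes refl) = trans (x∈ b b∉S) (sym (x′∈ b b∉S))
    separate x x′ c x∈ x′∈ eq i (no i≢b)   = trans (sym (update-off x c i≢b)) (trans (eq i) (update-off x′ c i≢b))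
    clear : ∀ x i → i ∉ S → Supp (b ∷ S) x → Dec (i ≡ b) → (x [ b ≔ 0# ]) i ≡ 0#
    clear x i i∉S x∈ (yes refl) = update-at x b 0#
    clear x i i∉S x∈ (no i≢b)   = trans (update-off x 0# i≢b)
      (x∈ i λ { (here i≡b) → i≢b i≡b ; (there i∈S) → i∉S i∈S })
    cover : ∀ x x₀ → (x [ b ≔ 0# ]) ≗ᵥ x₀ → ∀ i → Dec (i ≡ b) → x i ≡ (x₀ [ b ≔ x b ]) i
    cover x x₀ eq i (yes refl) = sym (update-at x₀ b (x b))
    cover x x₀ eq i (no i≢b)   = trans (sym (update-off x 0# i≢b)) (trans (eq i) (sym (update-off x₀ (x b) i≢b)))

  enum-Supp : ∀ {n} {S : List (Fin n)} → Unique S → Enumeration _≗ᵥ_ (Supp S) (q ^ length S)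
  enum-Supp [] = record { list = (λ _ → 0#) ∷ [] ; size = refl ; sound = (λ _ _ → refl) ∷ [] ; distinct = [] ∷ []
    ; covers = λ x x∈ → here (λ i → x∈ i λ ()) }
  enum-Supp (b∉ ∷ S!) = enum-Supp-∷ (Allₚ.All¬⇒¬Any b∉) (enum-Supp S!)

  enum-Vect : ∀ k → Enumeration (_≗ᵥ_ {k}) (λ _ → ⊤) (q ^ k)
  enum-Vect k = enum-cong (λ _ _ → tt) (λ x _ b b∉ → contradiction (∈ₚ.∈-allFin b) b∉)
    (resize (cong (q ^_) {y = k} (Listₚ.length-tabulate {n = k} id)) (enum-Supp (Uniqueₚ.allFin⁺ k)))

  2≤q : 2 ≤ q
  2≤q = subst (2 ≤_) elements-card (two elements (elements-complete 0#) (elements-complete 1#))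
    where
    two : ∀ xs → 0# ∈ xs → 1# ∈ xs → 2 ≤ length xs
    two (_ ∷ _ ∷ _) _           _           = s≤s (s≤s z≤n)
    two (_ ∷ [])    (here 0≡x) (here 1≡x) = contradiction (trans 0≡x (sym 1≡x)) 0≢1

  enum-HasDim : ∀ {n d} (W : Subspace n) → HasDim (mem W) d → Enumeration _≗ᵥ_ (mem W) (q ^ d)
  enum-HasDim {d = d} W (v , v∈ , indep , spans) = enum-image (_· v)
    (λ a _ → SumClosed W a v v∈)
    (λ a b _ _ eq k → sub≡0⇒≡ (indep (λ j → a j - b j)
      (λ i → trans (·-sub a b v i) (trans (cong (λ z → (a · v) i - z) (sym (eq i))) (x-x≡0 _))) k))
    (λ x x∈ → let a , x≗ = spans x x∈ in
      a , tt , λ a₀ _ a≗ i → trans (x≗ i) (·-congˡ v a≗ i))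
    (enum-Vect d)

  -- A space of dimension `d` has `q ^ d` vectors and `q` is at least 2, so counting takes the place
  -- of the exchange lemma.
  HasDim-unique : ∀ {n a b} (W : Subspace n) → HasDim (mem W) a → HasDim (mem W) b → a ≡ b
  HasDim-unique W da db =
    ^-injectiveʳ 2≤q (enum-size-≡ ≗ᵥ-isEquivalence (enum-HasDim W da) (enum-HasDim W db))

  HasDim-resp : ∀ {n d} {P Q : Vect n → Set} → (∀ x → P x → Q x) → (∀ x → Q x → P x) → HasDim P d → HasDim Q d
  HasDim-resp P⊆Q Q⊆P (v , v∈ , indep , spans) = v , (λ k → P⊆Q _ (v∈ k)) , indep , λ x → spans x ∘ Q⊆P x

  HasDim-zero : ∀ {n} (W : Subspace n) → (∀ x → mem W x → ∀ i → x i ≡ 0#) → HasDim (mem W) 0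
  HasDim-zero W W≡0 = (λ ()) , (λ ()) , (λ _ _ ()) , λ x x∈ → (λ ()) , W≡0 x x∈

  -- The direct sum is characterised by `splits`, `joins` and `meet` instead of being constructed,
  -- so that `W` may be a Krylov space already at hand.
  HasDim-⊕ : ∀ {n a b} (U V W : Subspace n) →
    (∀ x → mem W x → ∃₂ λ u v → mem U u × mem V v × (x ≗ᵥ λ i → u i + v i)) →
    (∀ u v → mem U u → mem V v → mem W (λ i → u i + v i)) →
    (∀ x → mem U x → mem V x → ∀ i → x i ≡ 0#) →
    HasDim (mem U) a → HasDim (mem V) b → HasDim (mem W) (a ℕ.+ b)
  HasDim-⊕ {n} {a} {b} U V W splits joins meet (f , f∈ , f-indep , f-spans) (g , g∈ , g-indep , g-spans) =
    basis , basis∈ , indep , spans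
    where
    basis : Mat (a ℕ.+ b) n
    basis k = [ f , g ]′ (Fin.splitAt a k)

    ⊆Wˡ : ∀ u → mem U u → mem W u
    ⊆Wˡ u u∈ = resp W (λ i → +-identityʳ (u i)) (joins u _ u∈ (zero∈ V))
    ⊆Wʳ : ∀ v → mem V v → mem W v
    ⊆Wʳ v v∈ = resp W (λ i → +-identityˡ (v i)) (joins _ v (zero∈ U) v∈)

    basis∈ : ∀ k → mem W (basis k)
    basis∈ k with Fin.splitAt a k
    ... | inj₁ i = ⊆Wˡ _ (f∈ i)
    ... | inj₂ j = ⊆Wʳ _ (g∈ j)

    expand : ∀ (c : Vect (a ℕ.+ b)) i → (c · basis) i ≡ ((λ k → c (k Fin.↑ˡ b)) · f) i + ((λ k → c (a Fin.↑ʳ k)) · g) i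
    expand c i = trans (∑-split a (λ k → c k * basis k i)) (cong₂ _+_
      (∑-cong λ k → cong (λ s → c (k Fin.↑ˡ b) * [ f , g ]′ s i) (Finₚ.splitAt-↑ˡ a k b))
      (∑-cong λ k → cong (λ s → c (a Fin.↑ʳ k) * [ f , g ]′ s i) (Finₚ.splitAt-↑ʳ a b k)))

    indep : LinIndep basis
    indep c eq k = subst (λ k → c k ≡ 0#) (Finₚ.join-splitAt a b k) (vanishes (Fin.splitAt a k))
      where
      cˡ : Vect a
      cˡ k = c (k Fin.↑ˡ b)
      cʳ : Vect b
      cʳ k = c (a Fin.↑ʳ k)
      -- A linear relation makes the `f` part the negative of the `g` part, which places it in both
      -- summands.
      inV : ∀ i → - 1# * (cʳ · g) i ≡ (cˡ · f) i
      inV i = sub≡0⇒≡ (trans (cong (_- (cˡ · f) i) (trans (sym (-‿distribˡ-* 1# _)) (cong -_ (*-identityˡ _))))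
        (trans (-‿+-comm _ _) (trans (cong -_ (trans (+-comm _ _) (trans (sym (expand c i)) (eq i)))) -0#≈0#)))
      f≡0 : ∀ i → (cˡ · f) i ≡ 0#
      f≡0 = meet _ (SumClosed U cˡ f f∈) (resp V inV (scale∈ V (- 1#) (SumClosed V cʳ g g∈)))
      g≡0 : ∀ i → (cʳ · g) i ≡ 0#
      g≡0 i = trans (sym (+-identityˡ _)) (trans (cong (_+ (cʳ · g) i) (sym (f≡0 i))) (trans (sym (expand c i)) (eq i)))
      vanishes : ∀ s → c (Fin.join a b s) ≡ 0#
      vanishes (inj₁ k) = f-indep cˡ f≡0 k
      vanishes (inj₂ k) = g-indep cʳ g≡0 k

    spans : ∀ x → mem W x → ∃ λ c → x ≗ᵥ (c · basis)
    spans x x∈ with splits x x∈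
    ... | u , v , u∈ , v∈ , x≗ with f-spans u u∈ | g-spans v v∈
    ... | α , u≗ | β , v≗ = c , λ i → trans (x≗ i) (trans (cong₂ _+_
        (trans (u≗ i) (·-congˡ f (λ k → cong [ α , β ]′ (sym (Finₚ.splitAt-↑ˡ a k b))) i))
        (trans (v≗ i) (·-congˡ g (λ k → cong [ α , β ]′ (sym (Finₚ.splitAt-↑ʳ a b k))) i)))
        (sym (expand c i)))
      where
      c : Vect (a ℕ.+ b)
      c k = [ α , β ]′ (Fin.splitAt a k)

-- Krylov spaces and profiles.

module Profiles {q : ℕ} (𝔽 : FiniteField q) where
  open Dimension 𝔽 public

  module _ {n : ℕ} (δ : Fin n → F) where

    KrylovSp : ℕ → Subspace n → Subspace n
    KrylovSp j W = record
      { mem    = Krylov δ j W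
      ; resp   = λ x≗y (w , w∈ , x≗) → w , w∈ , λ i → trans (sym (x≗y i)) (x≗ i)
      ; zero∈  = (λ _ _ → 0#) , (λ _ → zero∈ W) , λ i → sym (∑-zero {j} λ t → zeroʳ (pow (δ i) (toℕ t)))
      ; add∈   = λ (w , w∈ , x≗) (w′ , w′∈ , y≗) → (λ t i → w t i + w′ t i) , (λ t → add∈ W (w∈ t) (w′∈ t)) ,
          λ i → trans (cong₂ _+_ (x≗ i) (y≗ i)) (trans
            (sym (∑-+ (λ t → pow (δ i) (toℕ t) * w t i) (λ t → pow (δ i) (toℕ t) * w′ t i)))
            (∑-cong λ t → sym (distribˡ (pow (δ i) (toℕ t)) (w t i) (w′ t i))))
      ; scale∈ = λ c (w , w∈ , x≗) → (λ t i → c * w t i) , (λ t → scale∈ W c (w∈ t)) ,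
          λ i → trans (cong (c *_) (x≗ i)) (trans (*-∑ c (λ t → pow (δ i) (toℕ t) * w t i))
            (∑-cong λ t → *-swap c (pow (δ i) (toℕ t)) (w t i)))
      }

    -- Horner's rule. Together with `Krylov-uncons` it describes level `suc j` as `W` plus the image
    -- of level `j` under the diagonal matrix, the form used in all inductions on `j`.
    Krylov-cons : ∀ {j W u z} → mem W u → Krylov δ j W z → Krylov δ (suc j) W (λ i → u i + δ i * z i)
    Krylov-cons {j} {W} {u} {z} u∈ (w , w∈ , z≗) = w₊ , w₊∈ , λ i →
      cong₂ _+_ (sym (*-identityˡ (u i)))
        (trans (cong (δ i *_) (z≗ i)) (trans (*-∑ (δ i) (λ t → pow (δ i) (toℕ t) * w t i))
          (∑-cong λ t → sym (*-assoc (δ i) (pow (δ i) (toℕ t)) (w t i)))))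
      where
      w₊ : Fin (suc j) → Vect n
      w₊ Fin.zero    = u
      w₊ (Fin.suc t) = w t
      w₊∈ : ∀ t → mem W (w₊ t)
      w₊∈ Fin.zero    = u∈
      w₊∈ (Fin.suc t) = w∈ t

    Krylov-uncons : ∀ {j W x} → Krylov δ (suc j) W x →
      ∃₂ λ u z → mem W u × Krylov δ j W z × (x ≗ᵥ λ i → u i + δ i * z i)
    Krylov-uncons {j} (w , w∈ , x≗) = w Fin.zero , (λ i → ∑ (λ t → pow (δ i) (toℕ t) * w (Fin.suc t) i)) ,
      w∈ Fin.zero , (w ∘ Fin.suc , w∈ ∘ Fin.suc , λ i → refl) , λ i →
      trans (x≗ i) (cong₂ _+_ (*-identityˡ (w Fin.zero i)) (sym (trans
        (*-∑ (δ i) (λ t → pow (δ i) (toℕ t) * w (Fin.suc t) i))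
        (∑-cong λ t → sym (*-assoc (δ i) (pow (δ i) (toℕ t)) (w (Fin.suc t) i))))))

    Krylov-mono : ∀ {j} W W′ → (∀ x → mem W x → mem W′ x) → ∀ x → Krylov δ j W x → Krylov δ j W′ x
    Krylov-mono W W′ W⊆ x (w , w∈ , x≗) = w , (λ t → W⊆ _ (w∈ t)) , x≗

    -- A diagonal matrix acts on each coordinate separately, so a coordinate that is zero throughout
    -- `W` stays zero.
    Krylov-coord : ∀ {j W b} → (∀ x → mem W x → x b ≡ 0#) → ∀ x → Krylov δ j W x → x b ≡ 0#
    Krylov-coord {b = b} W≡0 x (w , w∈ , x≗) = trans (x≗ b) (∑-zero λ t → *0≡0 (pow (δ b) (toℕ t)) (W≡0 (w t) (w∈ t)))

    HasProfile-resp : ∀ {W W′} → SameSubspace W W′ → ∀ μ → HasProfile δ W μ → HasProfile δ W′ μ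
    HasProfile-resp {W} {W′} same μ (dims , d , d₀ , d₁) = (λ j 1≤j j≤ → move (dims j 1≤j j≤)) , d , move d₀ , move d₁
      where
      move : ∀ {j d} → HasDim (Krylov δ j W) d → HasDim (Krylov δ j W′) d
      move = HasDim-resp (Krylov-mono W W′ (proj₁ ∘ same)) (Krylov-mono W′ W (proj₂ ∘ same))

    commutator : Mat n n → Mat n n
    commutator R a b = R a b * (δ b - δ a)

    -- W = rowSp R is invariant modulo the rows of commutator R = RΔ − ΔR, so Krylov (1 + j) W splits as
    -- W ⊕ Krylov j (rowSp (commutator R)).
    module _ {S D : List (Fin n)} {R : Mat n n} (rref : RREF S D R) where
      open RREF rref
      private
        W = rowSp R
        Y = commutator R
        W′ = rowSp Y

      commutator-support : ∀ a b → b ∉ D → Y a b ≡ 0#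
      commutator-support a b b∉ = 0*≡0 _ (support a b b∉)

      commutator-pivot : ∀ a b → b ∈ S → Y a b ≡ 0#
      commutator-pivot a b b∈S with a ≟ b
      ... | yes refl = *0≡0 (R a b) (x-x≡0 (δ b))
      ... | no a≢b   = 0*≡0 _ (clear a b b∈S a≢b)

      private
        -- With the diagonal matrix written Δ: `u` equals u R and R Δ = Δ R + Y, so u Δ = (u Δ) R +
        -- u Y. The first term lies in `W`, the second in `W′`.
        Δ-split : ∀ {u} → mem W u → ∀ i → δ i * u i ≡ ((λ k → δ k * u k) · R) i + (u · Y) i
        Δ-split {u} u∈ i = sym (begin
          ((λ k → δ k * u k) · R) i + (u · Y) i                   ≡⟨ ∑-+ (λ k → δ k * u k * R k i) (λ k → u k * Y k i) ⟨
          ∑ (λ k → δ k * u k * R k i + u k * Y k i)                ≡⟨ ∑-cong term ⟩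
          ∑ (λ k → δ i * (u k * R k i))                            ≡⟨ *-∑ (δ i) (λ k → u k * R k i) ⟨
          δ i * (u · R) i                                          ≡⟨ cong (δ i *_) (fixed u∈ i) ⟨
          δ i * u i                                                ∎)
          where
          open ≡-Reasoning
          term : ∀ k → δ k * u k * R k i + u k * Y k i ≡ δ i * (u k * R k i)
          term k = begin
            δ k * u k * R k i + u k * (R k i * (δ i - δ k))    ≡⟨ cong₂ _+_ (*-assoc _ _ _) (sym (*-assoc _ _ _)) ⟩
            δ k * (u k * R k i) + u k * R k i * (δ i - δ k)    ≡⟨ cong (δ k * (u k * R k i) +_)
                                                                    (trans (*-comm _ _) (trans (distribʳ _ _ _)
                                                                      (cong (_ +_) (sym (-‿distribˡ-* _ _))))) ⟩
            δ k * (u k * R k i) + (δ i * (u k * R k i) - δ k * (u k * R k i)) ≡⟨ +-cancel-sub _ _ ⟩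
            δ i * (u k * R k i)                                ∎

        row·Y∈ : ∀ u → mem W′ (u · Y)
        row·Y∈ u = u , λ _ → refl

        -- A nonzero term has `k` a pivot with `R a k` nonzero, which forces `k = a`; so `δ k` may
        -- be replaced by `δ a`, and idempotence finishes. Consequently every vector of `W′` is
        -- `u₁ · Y` for some `u₁` in `W`.
        R⊗Y : (R ⊗ Y) ≗ₘ Y
        R⊗Y a b = begin
          ∑ (λ k → R a k * (R k b * (δ b - δ k)))   ≡⟨ ∑-cong term ⟩
          ∑ (λ k → R a k * R k b * (δ b - δ a))     ≡⟨ ∑-* (λ k → R a k * R k b) _ ⟨
          (R ⊗ R) a b * (δ b - δ a)                 ≡⟨ cong (_* (δ b - δ a)) (idempotent a b) ⟩
          Y a b                                     ∎
          where
          open ≡-Reasoning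
          term : ∀ k → R a k * (R k b * (δ b - δ k)) ≡ R a k * R k b * (δ b - δ a)
          term k with k ∈? S | k ≟ a
          ... | _       | yes refl = sym (*-assoc _ _ _)
          ... | yes k∈S | no k≢a = trans (0*≡0 _ (clear a k k∈S (k≢a ∘ sym)))
                                    (sym (0*≡0 _ (0*≡0 _ (clear a k k∈S (k≢a ∘ sym)))))
          ... | no k∉S  | no _   = trans (*0≡0 _ (0*≡0 _ (off-pivots k b k∉S)))
                                    (sym (0*≡0 _ (*0≡0 _ (off-pivots k b k∉S))))

      -- If `z` splits as `u₁ + y`, the diagonal matrix sends `u₁` to an element of `W` plus
      -- `u₁ · Y`, which becomes the new lowest term of the second summand, while the terms of `y`
      -- move up by one.
      Krylov-splits : ∀ j x → Krylov δ (suc j) W x →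
        ∃₂ λ u y → mem W u × Krylov δ j W′ y × (x ≗ᵥ λ i → u i + y i)
      Krylov-splits zero x x∈ with Krylov-uncons {W = W} x∈
      ... | u , z , u∈ , (_ , _ , z≗) , x≗ = u , (λ _ → 0#) , u∈ , zero∈ (KrylovSp 0 W′) ,
        λ i → trans (x≗ i) (cong (u i +_) (*0≡0 (δ i) (z≗ i)))
      Krylov-splits (suc j) x x∈ with Krylov-uncons {W = W} x∈
      ... | u , z , u∈ , z∈ , x≗ with Krylov-splits j z z∈
      ... | u₁ , y , u₁∈ , y∈ , z≗ =
        (λ i → u i + (Δu₁ · R) i) , (λ i → (u₁ · Y) i + δ i * y i) ,
        add∈ W u∈ (Δu₁ , λ _ → refl) , Krylov-cons {W = W′} (row·Y∈ u₁) y∈ , eq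
        where
        Δu₁ : Vect n
        Δu₁ i = δ i * u₁ i
        eq : ∀ i → x i ≡ (u i + (Δu₁ · R) i) + ((u₁ · Y) i + δ i * y i)
        eq i = begin
          x i                                                ≡⟨ x≗ i ⟩
          u i + δ i * z i                                    ≡⟨ cong (λ t → u i + δ i * t) (z≗ i) ⟩
          u i + δ i * (u₁ i + y i)                           ≡⟨ cong (u i +_) (distribˡ _ _ _) ⟩
          u i + (δ i * u₁ i + δ i * y i)                     ≡⟨ cong (λ t → u i + (t + δ i * y i)) (Δ-split u₁∈ i) ⟩
          u i + (((Δu₁ · R) i + (u₁ · Y) i) + δ i * y i)     ≡⟨ cong (u i +_) (+-assoc _ _ _) ⟩
          u i + ((Δu₁ · R) i + ((u₁ · Y) i + δ i * y i))     ≡⟨ +-assoc _ _ _ ⟨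
          (u i + (Δu₁ · R) i) + ((u₁ · Y) i + δ i * y i)     ∎
          where open ≡-Reasoning

      -- The lowest term of `y` is `u₁ · Y` with `u₁` in `W`, that is, the image `Δu₁` minus an
      -- element of `W`. That element is absorbed into `u`, and what is left is the diagonal matrix
      -- applied to `u₁ + z`, which the induction hypothesis handles.
      Krylov-joins : ∀ j u y → mem W u → Krylov δ j W′ y → Krylov δ (suc j) W (λ i → u i + y i)
      Krylov-joins zero u y u∈ (_ , _ , y≗) = resp (KrylovSp 1 W)
        (λ i → cong (u i +_) (trans (zeroʳ (δ i)) (sym (y≗ i))))
        (Krylov-cons {0} {W} u∈ (zero∈ (KrylovSp 0 W)))
      Krylov-joins (suc j) u y u∈ y∈ with Krylov-uncons {W = W′} y∈
      ... | w , z , (v , w≗) , z∈ , y≗ = resp (KrylovSp (suc (suc j)) W) eq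
        (Krylov-cons {W = W} (sub∈ W 1# u∈ (Δu₁ , λ _ → refl)) (Krylov-joins j u₁ z u₁∈ z∈))
        where
        u₁ Δu₁ : Vect n
        u₁ = v · R
        Δu₁ i = δ i * u₁ i
        u₁∈ : mem W u₁
        u₁∈ = v , λ _ → refl
        w≗u₁Y : ∀ i → (u₁ · Y) i ≡ w i
        w≗u₁Y i = trans (·-assoc v R Y i) (trans (·-cong {x = v} {M = R ⊗ Y} (λ _ → refl) R⊗Y i) (sym (w≗ i)))
        eq : ∀ i → (u i - 1# * (Δu₁ · R) i) + δ i * (u₁ i + z i) ≡ u i + y i
        eq i = begin
          (u i - 1# * (Δu₁ · R) i) + δ i * (u₁ i + z i)
            ≡⟨ cong₂ _+_ (cong (λ t → u i - t) (*-identityˡ _)) (trans (distribˡ _ _ _) (cong (_+ δ i * z i) (Δ-split u₁∈ i))) ⟩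
          (u i - (Δu₁ · R) i) + (((Δu₁ · R) i + (u₁ · Y) i) + δ i * z i)
            ≡⟨ cong ((u i - (Δu₁ · R) i) +_) (+-assoc _ _ _) ⟩
          (u i - (Δu₁ · R) i) + ((Δu₁ · R) i + ((u₁ · Y) i + δ i * z i))
            ≡⟨ +-assoc _ _ _ ⟨
          ((u i - (Δu₁ · R) i) + (Δu₁ · R) i) + ((u₁ · Y) i + δ i * z i)
            ≡⟨ cong₂ _+_ (trans (+-comm _ _) (+-cancel-sub _ _)) (trans (cong (_+ δ i * z i) (w≗u₁Y i)) (sym (y≗ i))) ⟩
          u i + y i ∎
          where open ≡-Reasoning

      -- Directness: every level over `W′` vanishes at the pivots, and a vector of `W` that vanishes
      -- there is zero.
      Krylov-dim-suc : ∀ {m d} j → HasDim (mem W) m → HasDim (Krylov δ j W′) d → HasDim (Krylov δ (suc j) W) (m ℕ.+ d)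
      Krylov-dim-suc j = HasDim-⊕ W (KrylovSp j W′) (KrylovSp (suc j) W) (Krylov-splits j) (Krylov-joins j)
        (λ x x∈W x∈W′ → vanish x∈W λ {s} s∈S → Krylov-coord {W = W′}
          (λ y (v , y≗) → trans (y≗ s) (∑-zero λ k → *0≡0 (v k) (commutator-pivot k s s∈S))) x x∈W′)

    mutual
      -- `HasDim` asks for an actual basis, so existence of a dimension needs proof. The recursion
      -- lowers `j` by passing to the commutator and row reducing it again.
      Krylov-has-dim : ∀ j {S D R} → RREF S D R → Unique S → ∃ λ d → HasDim (Krylov δ j (rowSp R)) d
      Krylov-has-dim zero    {R = R} rref S! = 0 , HasDim-zero (KrylovSp 0 (rowSp R)) (λ x (_ , _ , x≗) → x≗)
      Krylov-has-dim (suc j) {S} rref S! = let d , dim = commutator-has-dim j rref in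
        length S ℕ.+ d , Krylov-dim-suc rref j (RREF-dim-list S! rref) dim

      commutator-has-dim : ∀ j {S D R} → RREF S D R → ∃ λ d → HasDim (Krylov δ j (rowSp (commutator R))) d
      commutator-has-dim j {D = D} {R} rref =
        let S′ , R′ , rref′ , S′! , same = rowReduce {D = D} (commutator R) (commutator-support rref)
            d , dim = Krylov-has-dim j rref′ S′!
        in d , HasDim-resp (Krylov-mono (rowSp R′) (rowSp (commutator R)) (proj₂ ∘ same))
                           (Krylov-mono (rowSp (commutator R)) (rowSp R′) (proj₁ ∘ same)) dim

    module _ {S D : List (Fin n)} {R : Mat n n} (rref : RREF S D R) (S! : Unique S) where
      private
        W = rowSp R
        W′ = rowSp (commutator R)
        m = length S
        dimW : HasDim (mem W) m
        dimW = RREF-dim-list S! rref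

      -- Some dimension exists on the smaller level; raised by `m` it must agree with the given one,
      -- and `m` cancels.
      Krylov-dim-pred : ∀ {d} j → HasDim (Krylov δ (suc j) W) (m ℕ.+ d) → HasDim (Krylov δ j W′) d
      Krylov-dim-pred {d} j dim = subst (HasDim (Krylov δ j W′))
          (ℕₚ.+-cancelˡ-≡ m d′ d (HasDim-unique (KrylovSp (suc j) W) (Krylov-dim-suc rref j dimW dim′) dim)) dim′
        where
        has-dim : ∃ λ d → HasDim (Krylov δ j W′) d
        has-dim = commutator-has-dim j rref
        d′ = proj₁ has-dim
        dim′ = proj₂ has-dim

      private
        dim₀ : HasDim (Krylov δ 0 W′) 0
        dim₀ = HasDim-zero (KrylovSp 0 W′) (λ x (_ , _ , x≗) → x≗)

      profile-extend : ∀ k ks → HasProfile δ W′ (k ∷ ks) → HasProfile δ W (m ∷ k ∷ ks)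
      profile-extend k ks (dims , d , d₀ , d₁) =
        (λ { (suc zero) _ _ → Krylov-dim-suc rref 0 dimW dim₀
           ; (suc (suc j)) _ (s≤s j<) → Krylov-dim-suc rref (suc j) dimW (dims (suc j) (s≤s z≤n) j<) }) ,
        m ℕ.+ d , Krylov-dim-suc rref _ dimW d₀ , Krylov-dim-suc rref _ dimW d₁

      profile-restrict : ∀ k ks → HasProfile δ W (m ∷ k ∷ ks) → HasProfile δ W′ (k ∷ ks)
      profile-restrict k ks (dims , d , d₀ , d₁) =
        -- The stable dimension `d` need not be visibly of the form `m` plus something. Since the
        -- last profile condition concerns the same level, uniqueness replaces `d` by such a sum
        -- before `m` is cancelled.
        (λ j 1≤j j≤ → below j j≤) , sum (take l (k ∷ ks)) , below l ℕₚ.≤-refl , Krylov-dim-pred (suc l) (subst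
          (HasDim (Krylov δ (suc (suc l)) W)) (HasDim-unique (KrylovSp (suc l) W) d₀ (dims (suc l) (s≤s z≤n) ℕₚ.≤-refl)) d₁)
        where
        l = suc (length ks)
        below : ∀ j → j ≤ l → HasDim (Krylov δ j W′) (sum (take j (k ∷ ks)))
        below j j≤ = Krylov-dim-pred j (dims (suc j) (s≤s z≤n) (s≤s j≤))

      -- Levels 1 and 2 of `W` have the same dimension `m + 0`, so the row space of the commutator
      -- has dimension 0. This is the end of the recursion: `W` is invariant.
      profile-stop : HasProfile δ W (m ∷ []) → ∀ a b → commutator R a b ≡ 0#
      profile-stop (dims , d , d₀ , d₁) a b = proj₂ (proj₂ (proj₂ (proj₂ dim)) (commutator R a) row∈₁) b
        where
        dim : HasDim (Krylov δ 1 W′) 0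
        dim = Krylov-dim-pred 1 (subst (HasDim (Krylov δ 2 W))
          (HasDim-unique (KrylovSp 1 W) d₀ (dims 1 ℕₚ.≤-refl ℕₚ.≤-refl)) d₁)
        row∈₁ : Krylov δ 1 W′ (commutator R a)
        row∈₁ = resp (KrylovSp 1 W′) (λ i → trans (cong (commutator R a i +_) (zeroʳ (δ i))) (+-identityʳ _))
          (Krylov-cons {W = W′} (row∈ (commutator R) a) (zero∈ (KrylovSp 0 W′)))

      profile-stop⁻ : (∀ a b → commutator R a b ≡ 0#) → HasProfile δ W (m ∷ [])
      profile-stop⁻ Y≡0 = (λ { (suc zero) _ _ → dim 0 ; (suc (suc j)) _ (s≤s ()) }) , m ℕ.+ 0 , dim 0 , dim 1
        where
        dim : ∀ j → HasDim (Krylov δ (suc j) W) (m ℕ.+ 0)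
        dim j = Krylov-dim-suc rref j dimW (HasDim-zero (KrylovSp j W′) λ x x∈ i → Krylov-coord {W = W′}
          (λ y (v , y≗) → trans (y≗ i) (∑-zero λ k → *0≡0 (v k) (Y≡0 k i))) x x∈)

-- Counting matrices of full column rank with support a < b.

-- Here `i` is the number of columns already chosen and `q ^ i` the size of their span. The weight
-- is generic in `key` because matrices have columns in `Fin n` and tableaux have entries in ℕ.
columnWeight : {A : Set} (key : A → ℕ) (q : ℕ) (C : List A) (i : ℕ) (B : List A) → ℕ
columnWeight key q C i []       = 1
columnWeight key q C i (b ∷ bs) =
  (q ^ length (filter (λ a → key a ℕ.<? key b) C) ∸ q ^ i) ℕ.* columnWeight key q C (suc i) bs

module StrictMatrices {q : ℕ} (𝔽 : FiniteField q) where
  open Profiles 𝔽 public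

  module _ {n : ℕ} (C : List (Fin n)) where

    -- A is indexed by columns first: A b is the column b of the matrix Z supported on a < b.
    record FullRank (B : List (Fin n)) (A : Mat n n) : Set where
      field
        strict        : ∀ b a → ¬ (a ∈ C × b ∈ B × a Fin.< b) → A b a ≡ 0#
        inv           : Mat n n
        right-inverse : ∀ b → b ∈ B → (A b · inv) ≗ᵥ 𝕀 b

      off-row : ∀ b → b ∉ B → ∀ a → A b a ≡ 0#
      off-row b b∉ a = strict b a λ (_ , b∈ , _) → b∉ b∈

      -- Linear independence, which the record encodes by an explicit `inv`: coefficients supported
      -- on `B` are recovered from the combination.
      left-cancel : ∀ u → Supp B u → ((u · A) · inv) ≗ᵥ u
      left-cancel u u∈ i = trans (·-assoc u A inv i) (trans (∑-cong term) (·-𝕀 u i))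
        where
        term : ∀ k → u k * (A k · inv) i ≡ u k * 𝕀 k i
        term k with k ∈? B
        ... | yes k∈B = cong (u k *_) (right-inverse k k∈B i)
        ... | no  k∉B = trans (0*≡0 _ (u∈ k k∉B)) (sym (0*≡0 _ (u∈ k k∉B)))

    FullRank-resp : ∀ {B B′ A} → (∀ {b} → b ∈ B → b ∈ B′) → (∀ {b} → b ∈ B′ → b ∈ B) → FullRank B A → FullRank B′ A
    FullRank-resp B⊆ B⊇ full = record
      { strict = λ b a ¬p → strict b a λ (a∈ , b∈ , a<b) → ¬p (a∈ , B⊆ b∈ , a<b)
      ; inv = inv ; right-inverse = λ b b∈ → right-inverse b (B⊇ b∈) }
      where open FullRank full

    -- Completions of a partial matrix `A₀` whose columns at `P` are already fixed; this is what
    -- makes a choice column by column expressible.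
    Extends : List (Fin n) → List (Fin n) → Mat n n → Mat n n → Set
    Extends B P A₀ A = FullRank B A × (∀ c → c ∈ P → A c ≗ᵥ A₀ c)

    private
      below : Fin n → List (Fin n)
      below b = filter (λ a → toℕ a ℕ.<? toℕ b) C

    module _ (C! : Unique C) {P : List (Fin n)} {A₀ : Mat n n} (full : FullRank P A₀) (b : Fin n)
             (P<b : ∀ {p} → p ∈ P → p Fin.< b) where
      open FullRank full renaming (inv to H₀)

      private
        b∉P : b ∉ P
        b∉P b∈P = ℕₚ.<-irrefl refl (P<b b∈P)

        -- `H₀` recovers the coefficients of any combination of the old columns, so their span is
        -- the set of fixed points of this map, and membership in it is decidable.
        span : Vect n → Vect n
        span x = (x · H₀) · A₀

        InSpan : Vect n → Set
        InSpan x = x ≗ᵥ span x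

        span-cong : ∀ {x y} → x ≗ᵥ y → span x ≗ᵥ span y
        span-cong x≗y = ·-congˡ A₀ (·-congˡ H₀ x≗y)

        InSpan? : Decidable InSpan
        InSpan? x = Finₚ.all? λ i → x i ≟F span x i

        -- `A₀` is zero at indices outside `P`, so coefficients there are arbitrary; setting them to
        -- zero makes the coefficients of a vector in the span unique.
        mask : Vect n → Vect n
        mask u i = if does (i ∈? P) then u i else 0#

        mask-Supp : ∀ u → Supp P (mask u)
        mask-Supp u i i∉P with i ∈? P
        ... | yes i∈P = contradiction i∈P i∉P
        ... | no _    = refl

        mask-· : ∀ u → (mask u · A₀) ≗ᵥ (u · A₀)
        mask-· u i = ∑-cong term
          where
          term : ∀ k → mask u k * A₀ k i ≡ u k * A₀ k i
          term k with k ∈? P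
          ... | yes _  = refl
          ... | no k∉P = trans (zeroˡ _) (sym (*0≡0 (u k) (off-row k k∉P i)))

        -- An old column `c` is supported on positions below `c`, hence below `b`. So the whole span
        -- consists of admissible vectors, and the subtraction in `enum-new` counts exactly the new
        -- ones.
        enum-span : ∀ {N} → Enumeration _≗ᵥ_ (Supp P) N →
          Enumeration _≗ᵥ_ (λ x → Supp (below b) x × InSpan x) N
        enum-span = enum-image (_· A₀)
          (λ u u∈ → (λ a a∉ → ∑-zero λ c → *0≡0 (u c) (strict c a λ (a∈ , c∈ , a<c) →
                       a∉ (∈ₚ.∈-filter⁺ _ a∈ (ℕₚ.<-trans a<c (P<b c∈))))) ,
                    λ i → sym (·-congˡ A₀ (left-cancel u u∈) i))
          (λ u u′ u∈ u′∈ eq i → trans (sym (left-cancel u u∈ i)) (trans (·-congˡ H₀ eq i) (left-cancel u′ u′∈ i)))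
          (λ x (_ , x≗) → mask (x · H₀) , mask-Supp _ , λ u _ u≗ i →
            trans (x≗ i) (trans (sym (mask-· (x · H₀) i)) (·-congˡ A₀ u≗ i)))

        enum-new : ∀ {i} → Enumeration _≗ᵥ_ (Supp P) (q ^ i) →
          Enumeration _≗ᵥ_ (λ x → Supp (below b) x × ¬ InSpan x) (q ^ length (below b) ∸ q ^ i)
        enum-new e = enum-∖ ≗ᵥ-isEquivalence InSpan?
          (λ x≗y x∈ i → trans (sym (x≗y i)) (trans (x∈ i) (span-cong x≗y i)))
          (enum-Supp (Uniqueₚ.filter⁺ _ C!)) (enum-span e)

      addColumn : Vect n → Mat n n
      addColumn x c = if does (c ≟ b) then x else A₀ c

      addColumn-at : ∀ x → addColumn x b ≗ᵥ x
      addColumn-at x i with b ≟ b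
      ... | yes _  = refl
      ... | no b≢b = contradiction refl b≢b

      addColumn-old : ∀ x c → c ≢ b → addColumn x c ≗ᵥ A₀ c
      addColumn-old x c c≢b i with c ≟ b
      ... | yes c≡b = contradiction c≡b c≢b
      ... | no _    = refl

      private
        module _ (x : Vect n) (x∈ : Supp (below b) x) (x∉ : ¬ InSpan x) where
          r : Vect n
          r i = x i - span x i

          nonzero : ∃ λ p → r p ≢ 0#
          nonzero with leadingEntry r
          ... | inj₁ r≡0 = contradiction (λ i → sub≡0⇒≡ (r≡0 i)) x∉
          ... | inj₂ (p , rp≢0 , _) = p , rp≢0

          p = proj₁ nonzero

          -- The functional y ↦ (y − span y)ₚ / (x − span x)ₚ kills the old columns and sends x to 1.
          h : Vect n
          h k = (𝕀 k p - (H₀ k · A₀) p) * r p ⁻¹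

          h-apply : ∀ y → ∑ (λ k → y k * h k) ≡ (y p - span y p) * r p ⁻¹
          h-apply y = begin
            ∑ (λ k → y k * ((𝕀 k p - (H₀ k · A₀) p) * r p ⁻¹))          ≡⟨ ∑-cong (λ k → sym (*-assoc (y k) _ _)) ⟩
            ∑ (λ k → y k * (𝕀 k p - (H₀ k · A₀) p) * r p ⁻¹)            ≡⟨ ∑-* (λ k → y k * (𝕀 k p - (H₀ k · A₀) p)) _ ⟨
            ∑ (λ k → y k * (𝕀 k p - (H₀ k · A₀) p)) * r p ⁻¹            ≡⟨ cong (_* r p ⁻¹) inner ⟩
            (y p - span y p) * r p ⁻¹                                   ∎
            where
            open ≡-Reasoning
            inner : ∑ (λ k → y k * (𝕀 k p - (H₀ k · A₀) p)) ≡ y p - span y p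
            inner = begin
              ∑ (λ k → y k * (𝕀 k p - (H₀ k · A₀) p))
                ≡⟨ ∑-cong (λ k → distribˡ (y k) (𝕀 k p) (- (H₀ k · A₀) p)) ⟩
              ∑ (λ k → y k * 𝕀 k p + y k * - (H₀ k · A₀) p)
                ≡⟨ ∑-+ (λ k → y k * 𝕀 k p) (λ k → y k * - (H₀ k · A₀) p) ⟩
              (y · 𝕀) p + ∑ (λ k → y k * - (H₀ k · A₀) p)
                ≡⟨ cong₂ _+_ (·-𝕀 y p) (∑-cong λ k → trans (sym (-‿distribʳ-* (y k) _)) (-1* _)) ⟩
              y p + ∑ (λ k → - 1# * (y k * (H₀ k · A₀) p))
                ≡⟨ cong (y p +_) (*-∑ (- 1#) (λ k → y k * (H₀ k · A₀) p)) ⟨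
              y p + - 1# * (y · (H₀ ⊗ A₀)) p
                ≡⟨ cong (y p +_) (-1* _) ⟨
              y p - (y · (H₀ ⊗ A₀)) p
                ≡⟨ cong (λ t → y p - t) (·-assoc y H₀ A₀ p) ⟨
              y p - span y p ∎
              where
              -1* : ∀ z → - z ≡ - 1# * z
              -1* z = trans (cong -_ (sym (*-identityˡ z))) (-‿distribˡ-* 1# z)

          h-x : ∑ (λ k → x k * h k) ≡ 1#
          h-x = trans (h-apply x) (inverse _ (proj₂ nonzero))

          h-old : ∀ c → c ∈ P → ∑ (λ k → A₀ c k * h k) ≡ 0#
          h-old c c∈ = trans (h-apply (A₀ c)) (0*≡0 _ (trans (cong (λ t → A₀ c p - t) (begin
            ((A₀ c · H₀) · A₀) p   ≡⟨ ·-congˡ A₀ (right-inverse c c∈) p ⟩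
            (𝕀 c · A₀) p           ≡⟨ 𝕀-· c A₀ p ⟩
            A₀ c p                 ∎)) (x-x≡0 _)))
            where open ≡-Reasoning

          -- Column `b` of the inverse is the functional `h`. The other columns are corrected by
          -- multiples of `h` so as to kill `x`; on the old columns `h` is zero, so nothing changes
          -- there.
          inv₁ : Mat n n
          inv₁ k c = if does (c ≟ b) then h k else H₀ k c - (x · H₀) c * h k

          inv₁-apply : ∀ y c → (y · inv₁) c ≡
            (if does (c ≟ b) then ∑ (λ k → y k * h k) else (y · H₀) c - (x · H₀) c * ∑ (λ k → y k * h k))
          inv₁-apply y c with c ≟ b
          ... | yes _ = refl
          ... | no _  = begin
            ∑ (λ k → y k * (H₀ k c - (x · H₀) c * h k))
              ≡⟨ ∑-cong (λ k → trans (distribˡ (y k) _ _) (cong (y k * H₀ k c +_)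
                   (trans (cong (y k *_) (-‿distribˡ-* _ _)) (*-swap (y k) _ _)))) ⟩
            ∑ (λ k → y k * H₀ k c + - (x · H₀) c * (y k * h k))
              ≡⟨ ∑-+ (λ k → y k * H₀ k c) (λ k → - (x · H₀) c * (y k * h k)) ⟩
            (y · H₀) c + ∑ (λ k → - (x · H₀) c * (y k * h k))
              ≡⟨ cong ((y · H₀) c +_) (*-∑ (- (x · H₀) c) (λ k → y k * h k)) ⟨
            (y · H₀) c + - (x · H₀) c * ∑ (λ k → y k * h k)
              ≡⟨ cong ((y · H₀) c +_) (-‿distribˡ-* _ _) ⟨
            (y · H₀) c - (x · H₀) c * ∑ (λ k → y k * h k) ∎
            where open ≡-Reasoning

          new-row : (x · inv₁) ≗ᵥ 𝕀 b
          new-row c with c ≟ b | inv₁-apply x c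
          ... | yes refl | eq = trans eq (trans h-x (sym (𝕀-diag b)))
          ... | no c≢b   | eq = trans eq (trans (cong (λ t → (x · H₀) c - (x · H₀) c * t) h-x)
            (trans (cong (λ t → (x · H₀) c - t) (*-identityʳ _)) (trans (x-x≡0 _) (sym (𝕀-off (c≢b ∘ sym))))))

          old-row : ∀ d → d ∈ P → (A₀ d · inv₁) ≗ᵥ 𝕀 d
          old-row d d∈ c with c ≟ b | inv₁-apply (A₀ d) c
          ... | yes refl | eq = trans eq (trans (h-old d d∈) (sym (𝕀-off {a = d} {b} λ { refl → b∉P d∈ })))
          ... | no c≢b   | eq = trans eq (trans (cong₂ _-_ (right-inverse d d∈ c) (*0≡0 _ (h-old d d∈))) (x-0≡x _))

        addColumn-full : ∀ x → Supp (below b) x → ¬ InSpan x → FullRank (b ∷ P) (addColumn x)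
        addColumn-full x x∈ x∉ = record { strict = strict₁ ; inv = inv₁ x x∈ x∉ ; right-inverse = right₁ }
          where
          strict₁ : ∀ c a → ¬ (a ∈ C × c ∈ b ∷ P × a Fin.< c) → addColumn x c a ≡ 0#
          strict₁ c a ¬p with c ≟ b
          ... | yes refl = x∈ a λ a∈ → let a∈C , a<b = ∈ₚ.∈-filter⁻ _ {xs = C} a∈ in ¬p (a∈C , here refl , a<b)
          ... | no _     = strict c a λ (a∈ , c∈ , a<c) → ¬p (a∈ , there c∈ , a<c)
          right₁ : ∀ c → c ∈ b ∷ P → (addColumn x c · inv₁ x x∈ x∉) ≗ᵥ 𝕀 c
          right₁ c c∈ with c ≟ b | c∈
          ... | yes refl | _         = new-row x x∈ x∉
          ... | no c≢b   | here c≡b  = contradiction c≡b c≢b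
          ... | no _     | there c∈P = old-row x x∈ x∉ c c∈P

        -- If column `b` were a combination of the columns in `P`, the inverse of `A` would give
        -- entry `b` of a combination of unit vectors at indices other than `b`, which is 0 and not
        -- 1.
        column-new : ∀ {B A} → FullRank B A → b ∈ B → (∀ {p} → p ∈ P → p ∈ B) → (∀ c → c ∈ P → A c ≗ᵥ A₀ c) →
          ¬ InSpan (A b)
        column-new {B} {A} fullA b∈B P⊆B agree inSpan =
          1≢0 (trans (sym (trans (R.right-inverse b b∈B b) (𝕀-diag b))) (trans (·-congˡ R.inv inSpan b)
            (trans (·-assoc u A₀ R.inv b) (∑-zero term))))
          where
          module R = FullRank fullA
          u = A b · H₀
          term : ∀ c → u c * (A₀ c · R.inv) b ≡ 0#
          term c with c ∈? P
          ... | yes c∈P = *0≡0 (u c) (trans (·-congˡ R.inv (λ i → sym (agree c c∈P i)) b)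
            (trans (R.right-inverse c (P⊆B c∈P) b) (𝕀-off {a = c} {b} λ { refl → b∉P c∈P })))
          ... | no c∉P  = *0≡0 (u c) (∑-zero λ k → 0*≡0 _ (off-row c c∉P k))

      enum-addColumn : ∀ {B i N} → b ∈ B → (∀ {p} → p ∈ P → p ∈ B) →
        Enumeration _≗ᵥ_ (Supp P) (q ^ i) →
        (∀ A₁ → FullRank (b ∷ P) A₁ → Enumeration _≗ₘ_ (Extends B (b ∷ P) A₁) N) →
        Enumeration _≗ₘ_ (Extends B P A₀) ((q ^ length (below b) ∸ q ^ i) ℕ.* N)
      enum-addColumn {B} {i} {N} b∈B P⊆B e rest = enum-bind-const (enum-new {i} e) {λ _ → N}
        (λ x (x∈ , x∉) → rest (addColumn x) (addColumn-full x x∈ x∉))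
        -- The chosen column can be read off the completed matrix, so the pair is represented by the
        -- completion alone.
        (λ _ A → A)
        (λ x A _ (full , agree) → full , λ c c∈ i → trans (agree c (there c∈) i)
           (addColumn-old x c (λ { refl → b∉P c∈ }) i))
        (λ x A x′ A′ _ (_ , agree) _ (_ , agree′) A≗A′ i → trans (sym (trans (agree b (here refl) i) (addColumn-at x i)))
           (trans (A≗A′ b i) (trans (agree′ b (here refl) i) (addColumn-at x′ i))))
        (λ _ _ _ _ _ _ eq → eq)
        (λ A (full , agree) → A b ,
          ((λ a a∉ → FullRank.strict full b a λ (a∈ , _ , a<b) → a∉ (∈ₚ.∈-filter⁺ _ a∈ a<b)) ,
           column-new full b∈B P⊆B agree) ,
          λ x₀ _ x≗ → A , (full , λ
            { c (here refl) i → trans (x≗ i) (sym (addColumn-at x₀ i))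
            ; c (there c∈)  i → trans (agree c c∈ i) (sym (addColumn-old x₀ c (λ { refl → b∉P c∈ }) i)) }) ,
          λ A₀ _ eq → eq)
        (λ _ _ → refl)

    -- Columns are added in increasing order, as the nesting of supports requires, and accumulate in
    -- reverse. The enumeration of `Supp P` records that the current span has `q ^ i` elements.
    enum-Extends : Unique C → ∀ {i} bs P A₀ → FullRank P A₀ → AllPairs Fin._<_ bs → All (λ b → All (Fin._< b) P) bs →
      Enumeration _≗ᵥ_ (Supp P) (q ^ i) →
      Enumeration _≗ₘ_ (Extends (bs ʳ++ P) P A₀) (columnWeight toℕ q C i bs)
    enum-Extends C! [] P A₀ full _ _ _ = record
      { list = A₀ ∷ [] ; size = refl ; sound = (full , λ _ _ _ → refl) ∷ [] ; distinct = [] ∷ []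
      ; covers = λ A (fullA , agree) → here λ c i → same A fullA agree c i (c ∈? P) }
      where
      same : ∀ A → FullRank P A → (∀ c → c ∈ P → A c ≗ᵥ A₀ c) → ∀ c i → Dec (c ∈ P) → A c i ≡ A₀ c i
      same A fullA agree c i (yes c∈) = agree c c∈ i
      same A fullA agree c i (no c∉)  = trans (FullRank.off-row fullA c c∉ i) (sym (FullRank.off-row full c c∉ i))
    enum-Extends C! {i} (b ∷ bs) P A₀ full (b<bs ∷ bs<) (P<b ∷ P<bs) e =
      enum-addColumn C! full b (All.lookup P<b) {bs ʳ++ (b ∷ P)} {i}
        (Anyₚ.reverseAcc⁺ (b ∷ P) bs (inj₁ (here refl))) (λ p∈ → Anyₚ.reverseAcc⁺ (b ∷ P) bs (inj₁ (there p∈))) e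
        (λ A₁ full₁ → enum-Extends C! bs (b ∷ P) A₁ full₁ bs< (All.zipWith (λ (b< , P<) → b< ∷ P<) (b<bs , P<bs))
          (enum-Supp-∷ (λ b∈P → ℕₚ.<-irrefl refl (All.lookup P<b b∈P)) e))

    enum-FullRank : Unique C → ∀ {B} → AllPairs Fin._<_ B → Enumeration _≗ₘ_ (FullRank B) (columnWeight toℕ q C 0 B)
    enum-FullRank C! {B} B< = enum-cong
      (λ A (full , _) → FullRank-resp Anyₚ.reverse⁻ Anyₚ.reverse⁺ full)
      (λ A full → FullRank-resp Anyₚ.reverse⁺ Anyₚ.reverse⁻ full , λ _ ())
      (enum-Extends C! B [] (λ _ _ → 0#)
        (record { strict = λ _ _ _ → refl ; inv = λ _ _ → 0# ; right-inverse = λ _ () })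
        B< (All.universal (λ _ → []) B) (enum-Supp []))

-- Sorted sublists and sums over chains of disjoint sets.

module _ {A : Set} where

  subs : ℕ → List A → List (List A)
  subs zero    _        = [] ∷ []
  subs (suc k) []       = []
  subs (suc k) (x ∷ xs) = map (x ∷_) (subs k xs) ++ subs (suc k) xs

  ∈-subs⁻ : ∀ {B} k D → B ∈ subs k D → B ⊆ D × length B ≡ k
  ∈-subs⁻ zero    D        (here refl) = Sublistₚ.[]⊆-universal D , refl
  ∈-subs⁻ (suc k) (x ∷ xs) B∈ with ∈ₚ.∈-++⁻ (map (x ∷_) (subs k xs)) B∈
  ... | inj₂ B∈′ = let B⊆ , eq = ∈-subs⁻ (suc k) xs B∈′ in x ∷ʳ B⊆ , eq
  ... | inj₁ B∈′ with ∈ₚ.∈-map⁻ (x ∷_) B∈′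
  ...   | B′ , B′∈ , refl = let B⊆ , eq = ∈-subs⁻ k xs B′∈ in refl ∷ B⊆ , cong suc eq

  ∈-subs⁺ : ∀ {B D} → B ⊆ D → B ∈ subs (length B) D
  ∈-subs⁺ [] = here refl
  ∈-subs⁺ {[]}    (y ∷ʳ B⊆) = here refl
  ∈-subs⁺ {_ ∷ _} (y ∷ʳ B⊆) = ∈ₚ.∈-++⁺ʳ _ (∈-subs⁺ B⊆)
  ∈-subs⁺ (refl ∷ B⊆) = ∈ₚ.∈-++⁺ˡ (∈ₚ.∈-map⁺ _ (∈-subs⁺ B⊆))

  subs-unique : ∀ k {D} → Unique D → Unique (subs k D)
  subs-unique zero    _  = [] ∷ []
  subs-unique (suc k) [] = []
  subs-unique (suc k) {x ∷ xs} (x∉ ∷ xs!) = Uniqueₚ.++⁺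
    (Uniqueₚ.map⁺ Listₚ.∷-injectiveʳ (subs-unique k xs!)) (subs-unique (suc k) xs!) disjoint
    where
    disjoint : ∀ {B} → B ∈ map (x ∷_) (subs k xs) × B ∈ subs (suc k) xs → ⊥
    disjoint (B∈ , B∈′) with ∈ₚ.∈-map⁻ (x ∷_) B∈
    ... | _ , _ , refl = All.lookup x∉ (Sublist.lookup (proj₁ (∈-subs⁻ (suc k) xs B∈′)) (here refl)) refl

  enum-subs : ∀ k {D} → Unique D → Enumeration _≡_ (λ B → B ⊆ D × length B ≡ k) (length (subs k D))
  enum-subs k {D} D! = record { list = subs k D ; size = refl ; sound = All.tabulate (∈-subs⁻ k D)
    ; distinct = subs-unique k D! ; covers = λ { B (B⊆ , refl) → ∈-subs⁺ B⊆ } }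

  AllPairs-⊆ : ∀ {R : A → A → Set} {xs ys} → xs ⊆ ys → AllPairs R ys → AllPairs R xs
  AllPairs-⊆ []            []       = []
  AllPairs-⊆ (y ∷ʳ xs⊆)    (_ ∷ ps) = AllPairs-⊆ xs⊆ ps
  AllPairs-⊆ (refl ∷ xs⊆)  (p ∷ ps) = Sublistₚ.All-resp-⊆ xs⊆ p ∷ AllPairs-⊆ xs⊆ ps

  module _ {_<_ : A → A → Set} (<-asym : ∀ {x y} → x < y → ¬ y < x) where

    sorted⇒unique : ∀ {xs} → AllPairs _<_ xs → Unique xs
    sorted⇒unique = AllPairs.map λ { x<x refl → <-asym x<x x<x }

    sorted-≡ : ∀ {xs ys} → AllPairs _<_ xs → AllPairs _<_ ys →
      (∀ {z} → z ∈ xs → z ∈ ys) → (∀ {z} → z ∈ ys → z ∈ xs) → xs ≡ ys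
    sorted-≡ {[]}     {[]}     _ _ _ _ = refl
    sorted-≡ {[]}     {y ∷ ys} _ _ _ ⊇ = contradiction (⊇ (here refl)) λ ()
    sorted-≡ {x ∷ xs} {[]}     _ _ ⊆ _ = contradiction (⊆ (here refl)) λ ()
    sorted-≡ {x ∷ xs} {y ∷ ys} (x< ∷ xs<) (y< ∷ ys<) ⊆′ ⊇ with heads (⊆′ (here refl)) (⊇ (here refl))
      where
      heads : x ∈ y ∷ ys → y ∈ x ∷ xs → x ≡ y
      heads (here x≡y)  _           = x≡y
      heads (there _)   (here y≡x)  = sym y≡x
      heads (there x∈)  (there y∈)  = contradiction (All.lookup x< y∈) (<-asym (All.lookup y< x∈))
    ... | refl = cong (x ∷_) (sorted-≡ xs< ys< (strip x< ⊆′) (strip y< ⊇))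
      where
      strip : ∀ {us vs} → All (x <_) us → (∀ {z} → z ∈ x ∷ us → z ∈ x ∷ vs) → ∀ {z} → z ∈ us → z ∈ vs
      strip x<us f z∈ with f (there z∈)
      ... | there z∈′  = z∈′
      ... | here refl = contradiction (All.lookup x<us z∈) (λ x<x → <-asym x<x x<x)

    -- Filtering `ys` by membership in `xs` gives a sorted list with the elements of `xs`, hence
    -- `xs` itself.
    sorted-⊆ : DecidableEquality A → ∀ {xs ys} → AllPairs _<_ xs → AllPairs _<_ ys →
      (∀ {z} → z ∈ xs → z ∈ ys) → xs ⊆ ys
    sorted-⊆ _≟′_ {xs} {ys} xs< ys< xs∈ys = subst (_⊆ ys)
      (sorted-≡ (AllPairsₚ.filter⁺ ∈xs? ys<) xs<
        (λ z∈ → proj₂ (∈ₚ.∈-filter⁻ ∈xs? {xs = ys} z∈)) (λ z∈ → ∈ₚ.∈-filter⁺ ∈xs? (xs∈ys z∈) z∈))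
      (Sublistₚ.filter-⊆ ∈xs? ys)
      where
      ∈xs? : Decidable (_∈ xs)
      ∈xs? z = Any.any? (z ≟′_) xs

  module _ (_≟′_ : DecidableEquality A) where
    private
      ∉? : ∀ C → Decidable (_∉ C)
      ∉? C x = ¬? (Any.any? (x ≟′_) C)

    without : List A → List A → List A
    without D C = filter (∉? C) D

    ∈-without⁺ : ∀ {x D C} → x ∈ D → x ∉ C → x ∈ without D C
    ∈-without⁺ {C = C} = ∈ₚ.∈-filter⁺ (∉? C)

    ∈-without⁻ : ∀ {x} D C → x ∈ without D C → x ∈ D × x ∉ C
    ∈-without⁻ D C = ∈ₚ.∈-filter⁻ (∉? C) {xs = D}

    without-sorted : ∀ {R : A → A → Set} {D} C → AllPairs R D → AllPairs R (without D C)
    without-sorted C = AllPairsₚ.filter⁺ (∉? C)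

    module _ (key : A → ℕ) (q : ℕ) where

      -- The common value of both sides of the theorem. `D` holds the elements still available, `C`
      -- is the current column inside `D`, and the next one is drawn from the rest, which keeps the
      -- columns disjoint.
      chainSum : List A → List A → List ℕ → ℕ
      chainSum D C []       = 1
      chainSum D C (k ∷ ks) =
        sum (map (λ B → columnWeight key q C 0 B ℕ.* chainSum (without D C) B ks) (subs k (without D C)))

-- Counting echelon forms with a given profile.

module Counting {q : ℕ} (𝔽 : FiniteField q) where
  open StrictMatrices 𝔽 public

  infix 8 _ᵗ
  _ᵗ : ∀ {m n} → Mat m n → Mat n m
  (A ᵗ) i j = A j i

  rowSp-cong : ∀ {d n} {M N : Mat d n} → M ≗ₘ N → SameSubspace (rowSp M) (rowSp N)
  rowSp-cong {M = M} {N} M≗N = rowSp-same {M = M} {N}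
    (λ a → resp (rowSp N) (λ i → sym (M≗N a i)) (row∈ N a)) (λ a → resp (rowSp M) (M≗N a) (row∈ M a))

  Same-sym : ∀ {n} {U V : Subspace n} → SameSubspace U V → SameSubspace V U
  Same-sym U≡V x = proj₂ (U≡V x) , proj₁ (U≡V x)

  Same-trans : ∀ {n} {U V W : Subspace n} → SameSubspace U V → SameSubspace V W → SameSubspace U W
  Same-trans U≡V V≡W x = proj₁ (V≡W x) ∘ proj₁ (U≡V x) , proj₂ (U≡V x) ∘ proj₂ (V≡W x)

  module _ {n : ℕ} (δ : Fin n → F) (δ-inj : ∀ i j → δ i ≡ δ j → i ≡ j) where

    Strict : List (Fin n) → List (Fin n) → Mat n n → Set
    Strict C E Y = ∀ a b → ¬ (a ∈ C × b ∈ E × a Fin.< b) → Y a b ≡ 0#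

    infixl 6 _∖_
    _∖_ : List (Fin n) → List (Fin n) → List (Fin n)
    _∖_ = without _≟_

    pivotPart : List (Fin n) → Mat n n
    pivotPart C a b = if does (a ∈? C) then 𝕀 a b else 0#

    -- Inverse of `commutator`: the ones at the pivots, lost on the diagonal, are put back. On the
    -- diagonal the inverse of zero appears, but only multiplied by an entry that vanishes when `Y`
    -- is strict.
    assemble : List (Fin n) → Mat n n → Mat n n
    assemble C Y a b = pivotPart C a b + Y a b * (δ b - δ a) ⁻¹

    module _ {C D : List (Fin n)} where

      pivotPart-off : ∀ {a b} → a ≢ b → pivotPart C a b ≡ 0#
      pivotPart-off {a} {b} a≢b with a ∈? C
      ... | yes _ = 𝕀-off a≢b
      ... | no _  = refl

      pivotPart-∉ : ∀ {a b} → a ∉ C → pivotPart C a b ≡ 0#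
      pivotPart-∉ {a} a∉ with a ∈? C
      ... | yes a∈ = contradiction a∈ a∉
      ... | no _   = refl

      pivotPart-diag : ∀ {a} → a ∈ C → pivotPart C a a ≡ 1#
      pivotPart-diag {a} a∈ with a ∈? C
      ... | yes _ = 𝕀-diag a
      ... | no a∉ = contradiction a∈ a∉

      assemble-RREF : ∀ {Y} → (∀ {a} → a ∈ C → a ∈ D) → Strict C (D ∖ C) Y → RREF C D (assemble C Y)
      assemble-RREF {Y} C⊆D strict = record
        { off-pivots = λ a b a∉ → 0+0≡0 (pivotPart-∉ a∉) (0*≡0 _ (strict a b λ (a∈ , _) → a∉ a∈))
        ; pivot      = λ a a∈ → trans (cong₂ _+_ (pivotPart-diag a∈) (0*≡0 _ (strict a a λ (_ , _ , a<a) → ℕₚ.<-irrefl refl a<a))) (+-identityʳ 1#)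
        ; clear      = λ a b b∈ a≢b → 0+0≡0 (pivotPart-off a≢b)
            (0*≡0 _ (strict a b λ (_ , b∈E , _) → proj₂ (∈-without⁻ _≟_ D C b∈E) b∈))
        ; echelon    = λ a b b<a → 0+0≡0 (pivotPart-off λ { refl → ℕₚ.<-irrefl refl b<a })
            (0*≡0 _ (strict a b λ (_ , _ , a<b) → ℕₚ.<-asym a<b b<a))
        ; support    = λ a b b∉ → 0+0≡0 (outside a b b∉)
            (0*≡0 _ (strict a b λ (_ , b∈E , _) → b∉ (proj₁ (∈-without⁻ _≟_ D C b∈E))))
        }
        where
        outside : ∀ a b → b ∉ D → pivotPart C a b ≡ 0#
        outside a b b∉ = [ (λ { refl → pivotPart-∉ (b∉ ∘ C⊆D) }) , pivotPart-off ]′ (toSum (a ≟ b))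

      -- Distinctness of the diagonal entries enters here: off the diagonal the factor of the
      -- commutator is invertible.
      scale-cancel : ∀ {a b} x → a ≢ b → x * (δ b - δ a) ⁻¹ * (δ b - δ a) ≡ x
      scale-cancel {a} {b} x a≢b = trans (*-assoc x _ _) (trans (cong (x *_)
        (inverseˡ _ λ eq → a≢b (sym (δ-inj b a (sub≡0⇒≡ eq))))) (*-identityʳ x))

      commutator-assemble : ∀ {Y} → Strict C (D ∖ C) Y → commutator δ (assemble C Y) ≗ₘ Y
      commutator-assemble {Y} strict a b = entry-at (a ≟ b)
        where
        entry-at : ∀ {a b} → Dec (a ≡ b) → commutator δ (assemble C Y) a b ≡ Y a b
        entry-at {a} (yes refl) = trans (*0≡0 _ (x-x≡0 (δ a))) (sym (strict a a λ (_ , _ , a<a) → ℕₚ.<-irrefl refl a<a))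
        entry-at {a} {b} (no a≢b) = trans (cong (_* (δ b - δ a)) (trans (cong (_+ Y a b * (δ b - δ a) ⁻¹)
          (pivotPart-off a≢b)) (+-identityˡ _))) (scale-cancel (Y a b) a≢b)

      module _ {R : Mat n n} (rref : RREF C D R) where
        open RREF rref

        commutator-strict : Strict C (D ∖ C) (commutator δ R)
        commutator-strict a b ¬p with a ∈? C | b ∈? C | b ∈? D
        ... | no a∉  | _      | _      = 0*≡0 _ (off-pivots a b a∉)
        ... | yes _  | yes b∈ | _      = commutator-pivot δ rref a b b∈
        ... | yes _  | no _   | no b∉  = 0*≡0 _ (support a b b∉)
        ... | yes a∈ | no b∉  | yes b∈ with Finₚ.<-cmp a b
        ...   | tri< a<b _ _  = contradiction (a∈ , ∈-without⁺ _≟_ b∈ b∉ , a<b) ¬p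
        ...   | tri≈ _ refl _ = contradiction a∈ b∉
        ...   | tri> _ _ b<a  = 0*≡0 _ (echelon a b b<a)

        assemble-commutator : R ≗ₘ assemble C (commutator δ R)
        assemble-commutator a b = entry-at (a ≟ b) (a ∈? C)
          where
          entry-at : ∀ {a b} → Dec (a ≡ b) → Dec (a ∈ C) → R a b ≡ assemble C (commutator δ R) a b
          entry-at {a} {b} (no a≢b) _ = sym (trans (cong₂ _+_ (pivotPart-off a≢b) (trans (*-assoc _ _ _)
            (trans (cong (R a b *_) (*-comm _ _)) (trans (sym (*-assoc _ _ _)) (scale-cancel (R a b) a≢b))))) (+-identityˡ _))
          entry-at {a} (yes refl) (yes a∈) = sym (trans (cong₂ _+_ (pivotPart-diag a∈) (0*≡0 _ (*0≡0 _ (x-x≡0 (δ a)))))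
            (trans (+-identityʳ 1#) (sym (pivot a a∈))))
          entry-at {a} (yes refl) (no a∉) = sym (trans (0+0≡0 (pivotPart-∉ a∉) (0*≡0 _ (*0≡0 _ (x-x≡0 (δ a)))))
            (sym (off-pivots a a a∉)))

    assemble-cong : ∀ {C Y Y′} → Y ≗ₘ Y′ → assemble C Y ≗ₘ assemble C Y′
    assemble-cong {C} Y≗ a b = cong (λ y → pivotPart C a b + y * (δ b - δ a) ⁻¹) (Y≗ a b)

    commutator-cong : ∀ {R R′} → R ≗ₘ R′ → commutator δ R ≗ₘ commutator δ R′
    commutator-cong R≗ a b = cong (_* (δ b - δ a)) (R≗ a b)

    Sorted : List (Fin n) → Set
    Sorted = AllPairs Fin._<_

    -- The two predicates alternate in the recursion: `commutator` leads from the first to the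
    -- second and removes the leading part of the profile, and factoring out the echelon form of the
    -- row space leads back, with a new pivot set in the role of `C`.
    Echelon Residual : List (Fin n) → List (Fin n) → List ℕ → Mat n n → Set
    Echelon C D ks R = RREF C D R × HasProfile δ (rowSp R) (length C ∷ ks)
    Residual C E ks Y = Strict C E Y × HasProfile δ (rowSp Y) ks

    ≗ₘ-sym : ∀ {m} {X Y : Mat m n} → X ≗ₘ Y → Y ≗ₘ X
    ≗ₘ-sym e a b = sym (e a b)

    ≗ₘ-trans : ∀ {m} {X Y Z : Mat m n} → X ≗ₘ Y → Y ≗ₘ Z → X ≗ₘ Z
    ≗ₘ-trans e f a b = trans (e a b) (f a b)

    -- Without further parts the commutator must vanish, so the rows are unit vectors at the pivots.
    enum-Echelon-[] : ∀ {C D} → Unique C → (∀ {a} → a ∈ C → a ∈ D) → Enumeration _≗ₘ_ (Echelon C D []) 1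
    enum-Echelon-[] {C} {D} C! C⊆D = record
      { list = assemble C 𝟘 ∷ [] ; size = refl ; distinct = [] ∷ []
      ; sound = (rref₀ , profile-stop⁻ δ rref₀ C! (commutator-assemble {C} {D} (λ _ _ _ → refl))) ∷ []
      ; covers = λ R (rref , profile) → here (≗ₘ-trans (assemble-commutator rref)
          (assemble-cong {C} (profile-stop δ rref C! profile))) }
      where
      𝟘 : Mat n n
      𝟘 _ _ = 0#
      rref₀ : RREF C D (assemble C 𝟘)
      rref₀ = assemble-RREF C⊆D (λ _ _ _ → refl)

    enum-Echelon-∷ : ∀ {C D k ks N} → Unique C → (∀ {a} → a ∈ C → a ∈ D) →
      Enumeration _≗ₘ_ (Residual C (D ∖ C) (k ∷ ks)) N → Enumeration _≗ₘ_ (Echelon C D (k ∷ ks)) N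
    enum-Echelon-∷ {C} {D} {k} {ks} C! C⊆D = enum-image (assemble C)
      (λ Y (strict , profile) → assemble-RREF C⊆D strict ,
        profile-extend δ (assemble-RREF C⊆D strict) C! k ks
          (HasProfile-resp δ {rowSp Y} {rowSp (commutator δ (assemble C Y))}
            (rowSp-cong {M = Y} (≗ₘ-sym (commutator-assemble {C} {D} strict))) (k ∷ ks) profile))
      (λ Y Y′ (strict , _) (strict′ , _) eq → ≗ₘ-trans (≗ₘ-sym (commutator-assemble {C} {D} strict))
        (≗ₘ-trans (commutator-cong eq) (commutator-assemble {C} {D} strict′)))
      (λ R (rref , profile) → commutator δ R ,
        (commutator-strict rref , profile-restrict δ rref C! k ks profile) ,
        λ Y₀ _ Y≗ → ≗ₘ-trans (assemble-commutator rref) (assemble-cong {C} Y≗))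

    module Factor {B C E : List (Fin n)} {R : Mat n n} (rref : RREF B E R) where
      open RREF rref

      -- A nonzero term needs `a < c` from the support of `A` and `c ≤ b` from the echelon shape of
      -- `R`.
      product-strict : ∀ {A} → FullRank C B A → Strict C E (A ᵗ ⊗ R)
      product-strict {A} full a b ¬p = ∑-zero term
        where
        term : ∀ c → A c a * R c b ≡ 0#
        term c with a ∈? C | c ∈? B | a Fin.<? c
        ... | no a∉  | _      | _      = 0*≡0 _ (FullRank.strict full c a λ (a∈ , _) → a∉ a∈)
        ... | yes _  | no c∉  | _      = 0*≡0 _ (FullRank.off-row full c c∉ a)
        ... | yes _  | yes _  | no a≮c = 0*≡0 _ (FullRank.strict full c a λ (_ , _ , a<c) → a≮c a<c)
        ... | yes a∈ | yes c∈ | yes a<c with b ∈? E | b Fin.<? c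
        ...   | no b∉  | _      = *0≡0 _ (support c b b∉)
        ...   | yes _  | yes b<c = *0≡0 _ (echelon c b b<c)
        ...   | yes b∈ | no b≮c = contradiction (a∈ , b∈ , ℕₚ.<-≤-trans a<c (ℕₚ.≮⇒≥ b≮c)) ¬p

      product-pivot : ∀ (A : Mat n n) a {b} → b ∈ B → (A ᵗ ⊗ R) a b ≡ A b a
      product-pivot A a b∈ = ·-pivot ((A ᵗ) a) b∈

      -- The transpose of `inv` is a left inverse of `A ᵗ` on the indices in `B`, and the rows of
      -- `R` outside `B` are zero, so the rows of `R` are recovered from the product.
      product-same : ∀ {A} → FullRank C B A → SameSubspace (rowSp (A ᵗ ⊗ R)) (rowSp R)
      product-same {A} full = rowSp-same {M = A ᵗ ⊗ R} {R} (λ a → (A ᵗ) a , λ _ → refl) row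
        where
        open FullRank full using (inv; right-inverse; off-row)
        left-inverse : ∀ b → b ∈ B → ((inv ᵗ) b · (A ᵗ)) ≗ᵥ 𝕀 b
        left-inverse b b∈ c = trans (∑-cong λ k → *-comm (inv k b) (A c k)) (entry-at c (c ∈? B))
          where
          entry-at : ∀ c → Dec (c ∈ B) → (A c · inv) b ≡ 𝕀 b c
          entry-at c (yes c∈) = trans (right-inverse c c∈ b) (𝕀-sym c b)
          entry-at c (no c∉)  = trans (∑-zero λ k → 0*≡0 (inv k b) (off-row c c∉ k))
                                  (sym (𝕀-off {a = b} {c} λ { refl → c∉ b∈ }))
        row : ∀ b → mem (rowSp (A ᵗ ⊗ R)) (R b)
        row b with b ∈? B
        ... | no b∉  = resp (rowSp (A ᵗ ⊗ R)) (λ i → sym (off-pivots b i b∉)) (zero∈ (rowSp (A ᵗ ⊗ R)))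
        ... | yes b∈ = (inv ᵗ) b , λ i → sym (trans (sym (·-assoc ((inv ᵗ) b) (A ᵗ) R i))
                         (trans (·-congˡ R (left-inverse b b∈) i) (𝕀-· b R i)))

      module _ {Y : Mat n n} (strict : Strict C E Y) (same : SameSubspace (rowSp Y) (rowSp R)) where

        -- By `product-pivot` no other left factor is possible: the pivot columns of `R` are unit
        -- vectors.
        pivotColumns : Mat n n
        pivotColumns b a = if does (b ∈? B) then Y a b else 0#

        pivotColumns-product : Y ≗ₘ (pivotColumns ᵗ ⊗ R)
        pivotColumns-product a b = trans (fixed (proj₁ (same (Y a)) (row∈ Y a)) b) (∑-cong term)
          where
          term : ∀ c → Y a c * R c b ≡ pivotColumns c a * R c b
          term c with c ∈? B
          ... | yes _ = refl
          ... | no c∉ = trans (*0≡0 _ (off-pivots c b c∉)) (sym (zeroˡ _))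

        pivotColumns-full : FullRank C B pivotColumns
        pivotColumns-full = record { strict = strict′ ; inv = H ; right-inverse = right }
          where
          strict′ : ∀ b a → ¬ (a ∈ C × b ∈ B × a Fin.< b) → pivotColumns b a ≡ 0#
          strict′ b a ¬p with b ∈? B
          ... | yes b∈ = strict a b λ (a∈ , _ , a<b) → ¬p (a∈ , b∈ , a<b)
          ... | no _   = refl
          -- Coefficients expressing the rows of `R` through those of `Y`. Restricted to the pivot
          -- columns, where `R` has unit vectors, they form the required inverse.
          G : Mat n n
          G b = proj₁ (proj₂ (same (R b)) (row∈ R b))
          G·Y : ∀ b → R b ≗ᵥ (G b · Y)
          G·Y b = proj₂ (proj₂ (same (R b)) (row∈ R b))
          H : Mat n n
          H a b = if does (b ∈? B) then G b a else 0#
          right : ∀ c → c ∈ B → (pivotColumns c · H) ≗ᵥ 𝕀 c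
          right c c∈ b with c ∈? B | b ∈? B
          ... | no c∉ | _     = contradiction c∈ c∉
          ... | yes _ | no b∉ = trans (∑-zero λ k → zeroʳ (Y k c)) (sym (𝕀-off {a = c} {b} λ { refl → b∉ c∈ }))
          ... | yes _ | yes b∈ = trans (∑-cong λ k → *-comm (Y k c) (G b k)) (trans (sym (G·Y b c)) R≡𝕀)
            where
            R≡𝕀 : R b c ≡ 𝕀 c b
            R≡𝕀 with c ≟ b
            ... | yes refl = pivot c c∈
            ... | no c≢b   = clear b c c∈ (c≢b ∘ sym)

    HasPivotSet : List (Fin n) → List (Fin n) → Mat n n → Set
    HasPivotSet B E Y = ∃ λ R → RREF B E R × SameSubspace (rowSp Y) (rowSp R)

    -- The factorisation is unique: `R` is the echelon form of the row space of the product, and `A`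
    -- consists of its pivot columns. `R` is chosen first, hence the commuted product.
    enum-Residual-at : ∀ {B C E ks N} → Unique C → Sorted B →
      Enumeration _≗ₘ_ (Echelon B E ks) N →
      Enumeration _≗ₘ_ (λ Y → Residual C E (length B ∷ ks) Y × HasPivotSet B E Y) (columnWeight toℕ q C 0 B ℕ.* N)
    enum-Residual-at {B} {C} {E} {ks} {N} C! B< e = resize (ℕₚ.*-comm N _) (enum-bind-const e
      {λ _ → columnWeight toℕ q C 0 B}
      (λ _ _ → enum-FullRank C C! B<)
      (λ R A → A ᵗ ⊗ R)
      (λ R A (rref , profile) full → let same = Factor.product-same rref full in
        (Factor.product-strict rref full ,
         HasProfile-resp δ {rowSp R} {rowSp (A ᵗ ⊗ R)} (Same-sym {U = rowSp (A ᵗ ⊗ R)} {rowSp R} same) (length B ∷ ks) profile) ,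
        R , rref , same)
      (λ R A R′ A′ (rref , _) full (rref′ , _) full′ eq → RREF-unique rref rref′
        (λ x → proj₁ (Same-trans {U = rowSp R} {rowSp (A ᵗ ⊗ R)} {rowSp R′}
            (Same-sym {U = rowSp (A ᵗ ⊗ R)} {rowSp R} (Factor.product-same rref full))
            (Same-trans {U = rowSp (A ᵗ ⊗ R)} {rowSp (A′ ᵗ ⊗ R′)} {rowSp R′}
              (rowSp-cong {M = A ᵗ ⊗ R} {A′ ᵗ ⊗ R′} eq) (Factor.product-same rref′ full′)) x)) id)
      (λ R A A′ (rref , _) full full′ eq b a → columns rref full full′ eq a b (b ∈? B))
      (λ Y ((strict , profile) , R , rref , same) → R ,
        (rref , HasProfile-resp δ {rowSp Y} {rowSp R} same (length B ∷ ks) profile) ,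
        λ R₀ _ R≗ → Factor.pivotColumns {B} {C} rref strict same , Factor.pivotColumns-full rref strict same ,
          λ A₀ _ A≗ a b → trans (Factor.pivotColumns-product {B} {C} rref strict same a b)
            (·-cong {M = R} (λ c → A≗ c a) R≗ b))
      (λ _ _ → refl))
      where
      columns : ∀ {R A A′} → RREF B E R → FullRank C B A → FullRank C B A′ → (A ᵗ ⊗ R) ≗ₘ (A′ ᵗ ⊗ R) →
        ∀ a b → Dec (b ∈ B) → A b a ≡ A′ b a
      columns {A = A} {A′} rref full full′ eq a b (yes b∈) =
        trans (sym (Factor.product-pivot {B} {C} rref A a b∈)) (trans (eq a b) (Factor.product-pivot {B} {C} rref A′ a b∈))
      columns rref full full′ eq a b (no b∉) = trans (FullRank.off-row full b b∉ a) (sym (FullRank.off-row full′ b b∉ a))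

    Krylov-1 : ∀ W x → Krylov δ 1 W x → mem W x
    Krylov-1 W x (w , w∈ , x≗) = resp W
      (λ i → sym (trans (x≗ i) (trans (+-identityʳ _) (*-identityˡ _)))) (w∈ Fin.zero)

    Krylov-1⁻ : ∀ W x → mem W x → Krylov δ 1 W x
    Krylov-1⁻ W x x∈ = (λ _ → x) , (λ _ → x∈) , λ i → sym (trans (+-identityʳ _) (*-identityˡ _))

    pivotSet : ∀ {C E k ks Y} → Sorted E → Residual C E (k ∷ ks) Y →
      ∃ λ B → B ⊆ E × length B ≡ k × HasPivotSet B E Y
    pivotSet {C} {E} {k} {ks} {Y} E< (strict , dims , _) = B , B⊆E , size≡k , R , rref , proj₂ (proj₂ (proj₂ (proj₂ reduced)))
      where
      reduced : ∃₂ λ S R → RREF S E R × Unique S × SameSubspace (rowSp Y) (rowSp R)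
      reduced = rowReduce Y λ a b b∉ → strict a b λ (_ , b∈ , _) → b∉ b∈
      S = proj₁ reduced
      R = proj₁ (proj₂ reduced)
      rrefS : RREF S E R
      rrefS = proj₁ (proj₂ (proj₂ reduced))
      same : SameSubspace (rowSp Y) (rowSp R)
      same = proj₂ (proj₂ (proj₂ (proj₂ reduced)))
      -- Row reduction lists the pivots in the order in which they are found; filtering the sorted
      -- `E` lists the same set increasingly.
      B : List (Fin n)
      B = filter (_∈? S) E
      B⊆E : B ⊆ E
      B⊆E = Sublistₚ.filter-⊆ (_∈? S) E
      rref : RREF B E R
      rref = RREF.rebase rrefS (λ s∈ → ∈ₚ.∈-filter⁺ (_∈? S) (RREF.pivots⊆ rrefS s∈) s∈)
               (λ b∈ → proj₂ (∈ₚ.∈-filter⁻ (_∈? S) {xs = E} b∈)) id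
      dimR : HasDim (mem (rowSp R)) (length B)
      dimR = RREF-dim-list (sorted⇒unique ℕₚ.<-asym (AllPairs-⊆ B⊆E E<)) rref
      size≡k : length B ≡ k
      size≡k = trans (HasDim-unique (rowSp R) dimR (HasDim-resp
        (λ x → proj₁ (same x) ∘ Krylov-1 (rowSp Y) x) (λ x → Krylov-1⁻ (rowSp Y) x ∘ proj₂ (same x))
        (dims 1 ℕₚ.≤-refl (s≤s z≤n)))) (ℕₚ.+-identityʳ k)

    -- The commutators are classified by the pivot set of their row space, which is well defined by
    -- `pivots-⊆` and has as many elements as the first remaining part of the profile.
    enum-Echelon : ∀ ks C D → Sorted D → C ⊆ D → Enumeration _≗ₘ_ (Echelon C D ks) (chainSum _≟_ toℕ q D C ks)
    enum-Echelon [] C D D< C⊆D =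
      enum-Echelon-[] (sorted⇒unique ℕₚ.<-asym (AllPairs-⊆ C⊆D D<)) (Sublist.lookup C⊆D)
    enum-Echelon (k ∷ ks) C D D< C⊆D = enum-Echelon-∷ C! (Sublist.lookup C⊆D)
      (enum-bind (enum-subs k (sorted⇒unique ℕₚ.<-asym E<))
        (λ B (B⊆E , size) → part B B⊆E size)
        (λ _ Y → Y)
        (λ _ _ _ (residual , _) → residual)
        (λ B Y B′ Y′ (B⊆E , _) (_ , R , rref , same) (B′⊆E , _) (_ , R′ , rref′ , same′) eq →
          let R→R′ = Same-trans {U = rowSp R} {rowSp Y} {rowSp R′} (Same-sym {U = rowSp Y} {rowSp R} same)
                       (Same-trans {U = rowSp Y} {rowSp Y′} {rowSp R′} (rowSp-cong {M = Y} eq) same′)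
          in sorted-≡ ℕₚ.<-asym (AllPairs-⊆ B⊆E E<) (AllPairs-⊆ B′⊆E E<)
               (pivots-⊆ rref rref′ (λ x → proj₁ (R→R′ x))) (pivots-⊆ rref′ rref (λ x → proj₂ (R→R′ x))))
        (λ _ _ _ _ _ _ eq → eq)
        (λ Y residual → let B , B⊆E , size , pivots = pivotSet {C} E< residual in
          B , (B⊆E , size) , λ { B₀ _ refl → Y , (residual , pivots) , λ _ _ eq → eq }))
      where
      E = D ∖ C
      E< : Sorted E
      E< = without-sorted _≟_ C D<
      C! : Unique C
      C! = sorted⇒unique ℕₚ.<-asym (AllPairs-⊆ C⊆D D<)
      part : ∀ B → B ⊆ E → length B ≡ k → Enumeration _≗ₘ_ (λ Y → Residual C E (k ∷ ks) Y × HasPivotSet B E Y)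
        (columnWeight toℕ q C 0 B ℕ.* chainSum _≟_ toℕ q E B ks)
      part B B⊆E refl = enum-Residual-at C! (AllPairs-⊆ B⊆E E<) (enum-Echelon ks B E E< B⊆E)

-- From echelon matrices to subspaces.

module SubspaceCount {q : ℕ} (𝔽 : FiniteField q) where
  open Counting 𝔽 public

  private
    -- The list predicate local to HasCount has no name in scope; here it is the implicit L?, found by unification.
    linked : ∀ {n} {L? : List (Subspace n) → Set₁} → L? [] →
      (∀ W Ws → All (λ W′ → ¬ SameSubspace W W′) Ws → L? Ws → L? (W ∷ Ws)) →
      ∀ Ws → AllPairs (λ W W′ → ¬ SameSubspace W W′) Ws → L? Ws
    linked nil cons []       []       = nil
    linked nil cons (W ∷ Ws) (p ∷ ps) = cons W Ws p (linked nil cons Ws ps)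

    count-by : ∀ {n N} {L? : List (Subspace n) → Set₁} {Q : Subspace n → Set} {R : List (Subspace n) → Set₁} →
      L? [] → (∀ W Ws → All (λ W′ → ¬ SameSubspace W W′) Ws → L? Ws → L? (W ∷ Ws)) →
      ∀ Ws → length Ws ≡ N → All Q Ws → AllPairs (λ W W′ → ¬ SameSubspace W W′) Ws → R Ws →
      Σ (List (Subspace n)) λ L → length L ≡ N × All Q L × L? L × R L
    count-by {L? = L?} nil cons Ws size sound dist cov = Ws , size , sound , linked {L? = L?} nil cons Ws dist , cov

  hasCount : ∀ {n P N} (Ws : List (Subspace n)) → length Ws ≡ N → All P Ws →
    AllPairs (λ W W′ → ¬ SameSubspace W W′) Ws →
    (∀ W → P W → Σ (Subspace n) λ W′ → W′ ∈ Ws × SameSubspace W W′) → HasCount P N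
  hasCount {n} {P} {N} = count-by {L? = _} {Q = P} _ (λ _ _ p r → p , r)

  module _ {n : ℕ} (δ : Fin n → F) (δ-inj : ∀ i j → δ i ≡ δ j → i ≡ j)
           {m : ℕ} (C : Fin m → Fin n) (C< : StrictlyIncreasing C) where

    pivotList : List (Fin n)
    pivotList = map C (allFin m)

    private
      Cs = pivotList

      C-inj : ∀ {i j} → C i ≡ C j → i ≡ j
      C-inj {i} {j} eq with Finₚ.<-cmp i j
      ... | tri< i<j _ _ = contradiction (cong toℕ eq) (ℕₚ.<⇒≢ (C< i j i<j))
      ... | tri≈ _ i≡j _ = i≡j
      ... | tri> _ _ j<i = contradiction (cong toℕ (sym eq)) (ℕₚ.<⇒≢ (C< j i j<i))

      C∈ : ∀ i → C i ∈ Cs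
      C∈ i = ∈ₚ.∈-map⁺ C (∈ₚ.∈-allFin i)

      ∈C : ∀ {a} → a ∈ Cs → ∃ λ i → a ≡ C i
      ∈C a∈ = let i , _ , eq = ∈ₚ.∈-map⁻ C a∈ in i , eq

      length-Cs : length Cs ≡ m
      length-Cs = trans (Listₚ.length-map C (allFin m)) (Listₚ.length-tabulate {n = m} id)

      allFin< : ∀ k → AllPairs Fin._<_ (allFin k)
      allFin< k = AllPairsₚ.tabulate⁺-< id

      Cs< : AllPairs Fin._<_ Cs
      Cs< = AllPairsₚ.map⁺ (AllPairs.map (λ {i} {j} → C< i j) (allFin< m))

      Cs⊆ : Cs ⊆ allFin n
      Cs⊆ = sorted-⊆ ℕₚ.<-asym _≟_ Cs< (allFin< n) (λ _ → ∈ₚ.∈-allFin _)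

      RREF-pivots : ∀ {D R} → RREF Cs D R → HasPivots C (rowSp R)
      RREF-pivots {R = R} rref = R ∘ C , ((λ r → pivot (C r) (C∈ r)) , (λ r t → echelon (C r) t) ,
          λ r r′ r≢r′ → clear (C r′) (C r) (C∈ r) (r≢r′ ∘ sym ∘ C-inj)) , λ x → spans x , λ (a , x≗) →
          rowSp-⊆ (rowSp R) {R ∘ C} (row∈ R ∘ C) (a , x≗)
        where
        open RREF rref
        spans : ∀ x → mem (rowSp R) x → ∃ λ a → x ≗ᵥ (a · (R ∘ C))
        spans = proj₂ (proj₂ (proj₂ (RREF-dim rref C C-inj C∈ ∈C)))

      -- The `m` given rows are spread over a square matrix, row `r` at index `C r`, with zero rows
      -- elsewhere.
      pivots-RREF : ∀ W → HasPivots C W → ∃ λ R → RREF Cs (allFin n) R × SameSubspace W (rowSp R)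
      pivots-RREF W (R̂ , (ones , zeros , clears) , W≡) = R , rref , same
        where
        row : ∀ {a} → Dec (∃ λ r → a ≡ C r) → Vect n
        row (yes (r , _)) = R̂ r
        row (no _) _      = 0#
        R : Mat n n
        R a = row (Finₚ.any? λ r → a ≟ C r)
        R-C : ∀ r → R (C r) ≗ᵥ R̂ r
        R-C r i with Finₚ.any? (λ r′ → C r ≟ C r′)
        ... | yes (r′ , eq) = cong (λ s → R̂ s i) (sym (C-inj eq))
        ... | no ¬∃ = contradiction (r , refl) ¬∃
        R-off : ∀ {a} → a ∉ Cs → ∀ i → R a i ≡ 0#
        R-off {a} a∉ i with Finₚ.any? (λ r → a ≟ C r)
        ... | yes (r , refl) = contradiction (C∈ r) a∉
        ... | no _ = refl
        rref : RREF Cs (allFin n) R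
        rref = record
          { off-pivots = λ a b a∉ → R-off a∉ b
          ; pivot      = λ a a∈ → piv (∈C a∈)
          ; clear      = λ a b b∈ → clr a b (a ∈? Cs) (∈C b∈)
          ; echelon    = λ a b b<a → ech a b b<a (a ∈? Cs)
          ; support    = λ a b b∉ → contradiction (∈ₚ.∈-allFin b) b∉
          }
          where
          piv : ∀ {a} → (∃ λ r → a ≡ C r) → R a a ≡ 1#
          piv (r , refl) = trans (R-C r (C r)) (ones r)
          clr : ∀ a b → Dec (a ∈ Cs) → (∃ λ r → b ≡ C r) → a ≢ b → R a b ≡ 0#
          clr a b (no a∉) _ _ = R-off a∉ b
          clr a _ (yes a∈) (s , refl) a≢b with ∈C a∈
          ... | r , refl = trans (R-C r (C s)) (clears s r λ { refl → a≢b refl })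
          ech : ∀ a b → b Fin.< a → Dec (a ∈ Cs) → R a b ≡ 0#
          ech a b b<a (no a∉) = R-off a∉ b
          ech a b b<a (yes a∈) with ∈C a∈
          ... | r , refl = trans (R-C r b) (zeros r b b<a)
        R̂∈ : ∀ r → mem (rowSp R) (R̂ r)
        R̂∈ r = resp (rowSp R) (R-C r) (row∈ R (C r))
        R∈ : ∀ a → mem W (R a)
        R∈ a with Finₚ.any? (λ r → a ≟ C r)
        ... | yes (r , _) = proj₂ (W≡ (R̂ r)) (row∈ R̂ r)
        ... | no _        = zero∈ W
        same : SameSubspace W (rowSp R)
        same x = rowSp-⊆ (rowSp R) {R̂} R̂∈ ∘ proj₁ (W≡ x) , rowSp-⊆ W {R} R∈

    -- Each subspace with pivots `C` is the row space of one echelon matrix, and by `RREF-unique`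
    -- different matrices have different row spaces.
    subspace-count : ∀ ks → HasCount (λ W → HasDim (mem W) m × HasPivots C W × HasProfile δ W (m ∷ ks))
      (chainSum _≟_ toℕ q (allFin n) pivotList ks)
    subspace-count ks = hasCount (map rowSp (list e)) (trans (Listₚ.length-map rowSp (list e)) (size e))
      (Allₚ.map⁺ (All.map (λ {R} (rref , profile) → RREF-dim rref C C-inj C∈ ∈C , RREF-pivots rref ,
        subst (λ k → HasProfile δ (rowSp R) (k ∷ ks)) length-Cs profile) (sound e)))
      (AllPairsₚ.map⁺ (apart (list e) (sound e) (distinct e)))
      cov
      where
      e = enum-Echelon δ δ-inj ks Cs (allFin n) (allFin< n) Cs⊆
      P = Echelon δ δ-inj Cs (allFin n) ks
      apart : ∀ Rs → All P Rs → AllPairs (λ X Y → ¬ X ≗ₘ Y) Rs →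
        AllPairs (λ X Y → ¬ SameSubspace (rowSp X) (rowSp Y)) Rs
      apart []       []             []         = []
      apart (R ∷ Rs) ((rref , _) ∷ ps) (R≉ ∷ Rs≉) =
        All.map (λ ((rref′ , _) , R≉R′) same → R≉R′ (RREF-unique rref rref′ (λ x → proj₁ (same x)) id)) (All.zip (ps , R≉))
        ∷ apart Rs ps Rs≉
      cov : ∀ W → HasDim (mem W) m × HasPivots C W × HasProfile δ W (m ∷ ks) →
        Σ (Subspace n) λ W′ → W′ ∈ map rowSp (list e) × SameSubspace W W′
      cov W (_ , pivots , profile) with pivots-RREF W pivots
      ... | R , rref , same = pick (list e) (covers e R (rref ,
          subst (λ k → HasProfile δ (rowSp R) (k ∷ ks)) (sym length-Cs) (HasProfile-resp δ {W} {rowSp R} same (m ∷ ks) profile)))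
        where
        pick : ∀ Rs → Any (R ≗ₘ_) Rs → Σ (Subspace n) λ W′ → W′ ∈ map rowSp Rs × SameSubspace W W′
        pick (R′ ∷ Rs) (here R≗) = rowSp R′ , here refl , Same-trans {U = W} {rowSp R} {rowSp R′} same (rowSp-cong {M = R} R≗)
        pick (R′ ∷ Rs) (there m) = let W′ , W′∈ , eq = pick Rs m in W′ , there W′∈ , eq

-- Tableaux built column by column.

module Tableaux where
  open import Data.Nat using (_<_)

  Row Tableau : Set
  Row = List ℕ
  Tableau = List Row

  -- Rows of `t` beyond the length of `cs` would be lost, which is why the lemmas below assume
  -- `length t ≤ length cs` where this matters.
  prepend : Row → Tableau → Tableau
  prepend []       t       = []
  prepend (c ∷ cs) []      = (c ∷ []) ∷ prepend cs []
  prepend (c ∷ cs) (r ∷ t) = (c ∷ r) ∷ prepend cs t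

  -- Rows that become empty are discarded, so the result again has a shape with positive parts.
  peel : Tableau → Tableau
  peel []                = []
  peel ([] ∷ t)          = peel t
  peel ((x ∷ []) ∷ t)    = peel t
  peel ((x ∷ y ∷ r) ∷ t) = (y ∷ r) ∷ peel t

  NonEmptyRows : Tableau → Set
  NonEmptyRows = All (λ r → 1 ≤ length r)

  length-prepend : ∀ cs t → length (prepend cs t) ≡ length cs
  length-prepend []       t       = refl
  length-prepend (c ∷ cs) []      = cong suc (length-prepend cs [])
  length-prepend (c ∷ cs) (r ∷ t) = cong suc (length-prepend cs t)

  prepend-nonEmpty : ∀ cs t → NonEmptyRows (prepend cs t)
  prepend-nonEmpty []       t       = []
  prepend-nonEmpty (c ∷ cs) []      = s≤s z≤n ∷ prepend-nonEmpty cs []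
  prepend-nonEmpty (c ∷ cs) (r ∷ t) = s≤s z≤n ∷ prepend-nonEmpty cs t

  firstCol-prepend : ∀ cs t → firstCol (prepend cs t) ≡ cs
  firstCol-prepend []       t       = refl
  firstCol-prepend (c ∷ cs) []      = cong (c ∷_) (firstCol-prepend cs [])
  firstCol-prepend (c ∷ cs) (r ∷ t) = cong (c ∷_) (firstCol-prepend cs t)

  peel-prepend : ∀ cs {t} → NonEmptyRows t → length t ≤ length cs → peel (prepend cs t) ≡ t
  peel-prepend []       {[]}          _        _        = refl
  peel-prepend (c ∷ cs) {[]}          _        _        = peel-prepend cs [] z≤n
  peel-prepend (c ∷ cs) {(y ∷ r) ∷ t} (_ ∷ ne) (s≤s l≤) = cong ((y ∷ r) ∷_) (peel-prepend cs ne l≤)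

  -- Support and distinctness of entries do not depend on the order, so this rearrangement reduces
  -- both to the new column and the rest.
  concat-prepend : ∀ cs t → length t ≤ length cs → concat (prepend cs t) ↭ cs ++ concat t
  concat-prepend []       []      _        = ↭-refl
  concat-prepend (c ∷ cs) []      _        = prep c (concat-prepend cs [] z≤n)
  concat-prepend (c ∷ cs) (r ∷ t) (s≤s l≤) = prep c (↭-trans (Permₚ.++⁺ˡ r (concat-prepend cs t l≤))
    (↭-trans (↭-sym (Permₚ.++-assoc r cs (concat t)))
      (↭-trans (Permₚ.++⁺ʳ (concat t) (Permₚ.++-comm r cs)) (Permₚ.++-assoc cs r (concat t)))))

  -- The effect of `prepend` on shapes: a new first column of height `m`.
  widen : ℕ → List ℕ → List ℕ
  widen zero    _        = []
  widen (suc m) []       = 1 ∷ widen m []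
  widen (suc m) (l ∷ λs) = suc l ∷ widen m λs

  widen-positive : ∀ m λs → All (1 ≤_) (widen m λs)
  widen-positive zero    _        = []
  widen-positive (suc m) []       = s≤s z≤n ∷ widen-positive m []
  widen-positive (suc m) (l ∷ λs) = s≤s z≤n ∷ widen-positive m λs

  shape-prepend : ∀ cs t → length t ≤ length cs → map length (prepend cs t) ≡ widen (length cs) (map length t)
  shape-prepend []       []      _        = refl
  shape-prepend (c ∷ cs) []      _        = cong (1 ∷_) (shape-prepend cs [] z≤n)
  shape-prepend (c ∷ cs) (r ∷ t) (s≤s l≤) = cong (suc (length r) ∷_) (shape-prepend cs t l≤)

  prepend-peel : ∀ m λs t → All (1 ≤_) λs → length λs ≤ m → map length t ≡ widen m λs →
    t ≡ prepend (firstCol t) (peel t) × map length (peel t) ≡ λs × length (firstCol t) ≡ m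
  prepend-peel zero    [] [] _ _ _ = refl , refl , refl
  prepend-peel (suc m) [] ((x ∷ []) ∷ t) _ _ eq with prepend-peel m [] t [] z≤n (Listₚ.∷-injectiveʳ eq)
  ... | e₁ , e₂ , e₃ with peel t
  ... | [] = cong ((x ∷ []) ∷_) e₁ , refl , cong suc e₃
  prepend-peel (suc m) (suc l ∷ λs) ((x ∷ y ∷ r) ∷ t) (_ ∷ pos) (s≤s l≤) eq
    with prepend-peel m λs t pos l≤ (Listₚ.∷-injectiveʳ eq)
  ... | e₁ , e₂ , e₃ = cong ((x ∷ y ∷ r) ∷_) e₁ ,
    cong₂ _∷_ (ℕₚ.suc-injective (Listₚ.∷-injectiveˡ eq)) e₂ , cong suc e₃
  prepend-peel (suc m) (suc l ∷ λs) ((x ∷ []) ∷ t) _ _ ()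
  prepend-peel (suc m) (zero ∷ λs) t (() ∷ _) _ _

  -- Part `i` of the conjugate partition, counted from 0.
  height : List ℕ → ℕ → ℕ
  height ks i = length (filter (λ k → suc i ℕ.≤? k) ks)

  height-low : ∀ {ks i} → All (_≤ i) ks → height ks i ≡ 0
  height-low {ks} {i} ks≤i = cong length (Listₚ.filter-none (λ k → suc i ℕ.≤? k) (All.map ℕₚ.≤⇒≯ ks≤i))

  widen-applyUpTo : ∀ m k f → k ≤ m → (∀ i → k ≤ i → f i ≡ 0) → widen m (applyUpTo f k) ≡ applyUpTo (suc ∘ f) m
  widen-applyUpTo zero    zero    f _        _   = refl
  widen-applyUpTo (suc m) zero    f _        f≡0 =
    cong₂ _∷_ (cong suc (sym (f≡0 0 z≤n))) (widen-applyUpTo m 0 (f ∘ suc) z≤n (λ i _ → f≡0 (suc i) z≤n))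
  widen-applyUpTo (suc m) (suc k) f (s≤s k≤m) f≡0 =
    cong (suc (f 0) ∷_) (widen-applyUpTo m k (f ∘ suc) k≤m (λ i k≤i → f≡0 (suc i) (s≤s k≤i)))

  applyUpTo-cong : ∀ {A : Set} {f g : ℕ → A} n → (∀ i → i < n → f i ≡ g i) → applyUpTo f n ≡ applyUpTo g n
  applyUpTo-cong zero    eq = refl
  applyUpTo-cong (suc n) eq = cong₂ _∷_ (eq 0 (s≤s z≤n)) (applyUpTo-cong n (λ i i<n → eq (suc i) (s≤s i<n)))

  Decreasing : List ℕ → Set
  Decreasing = Linked (λ a b → b ≤ a)

  Decreasing⇒All : ∀ {k ks} → Decreasing (k ∷ ks) → All (_≤ k) ks
  Decreasing⇒All [-]         = []
  Decreasing⇒All (k′≤k ∷ dec) = k′≤k ∷ All.map (λ x≤ → ℕₚ.≤-trans x≤ k′≤k) (Decreasing⇒All dec)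

  -- The part `m` raises each of the first `m` heights by one. Indices from the largest part of `ks`
  -- on have height 0 in the tail, and there `widen` starts rows of length one.
  conj-∷ : ∀ m ks → Decreasing (m ∷ ks) → conj (m ∷ ks) ≡ widen m (conj ks)
  conj-∷ m ks dec = trans (applyUpTo-cong m λ i i<m → cong length (Listₚ.filter-accept (λ k → suc i ℕ.≤? k) i<m)) (tail ks dec)
    where
    tail : ∀ ks → Decreasing (m ∷ ks) → applyUpTo (suc ∘ height ks) m ≡ widen m (conj ks)
    tail []       _            = sym (widen-applyUpTo m 0 (λ _ → 0) z≤n (λ _ _ → refl))
    tail (k ∷ ks) (k≤m ∷ dec′) = sym (widen-applyUpTo m k (height (k ∷ ks)) k≤m λ i k≤i →
      height-low (k≤i ∷ All.map (λ x≤k → ℕₚ.≤-trans x≤k k≤i) (Decreasing⇒All dec′)))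

  conj-positive : ∀ ks → Decreasing ks → All (1 ≤_) (conj ks)
  conj-positive []       _   = []
  conj-positive (k ∷ ks) dec = subst (All (1 ≤_)) (sym (conj-∷ k ks dec)) (widen-positive k (conj ks))

  length-conj : ∀ k ks → length (conj (k ∷ ks)) ≡ k
  length-conj k ks = Listₚ.length-applyUpTo (height (k ∷ ks)) k

  length-conj-≤ : ∀ {m} ks → Decreasing (m ∷ ks) → length (conj ks) ≤ m
  length-conj-≤ []           _        = z≤n
  length-conj-≤ {m} (k ∷ ks) (k≤ ∷ _) = subst (_≤ m) (sym (length-conj k ks)) k≤

  -- The row condition between two adjacent columns, the second possibly shorter.
  dominated : Row → Row → Bool
  dominated _        []       = true
  dominated []       (_ ∷ _)  = false
  dominated (c ∷ cs) (b ∷ bs) = (c <ᵇ b) ∧ dominated cs bs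

  T-∧⁻ : ∀ {a b} → T (a ∧ b) → T a × T b
  T-∧⁻ = Equivalence.to Boolₚ.T-∧

  T-∧⁺ : ∀ {a b} → T a → T b → T (a ∧ b)
  T-∧⁺ x y = Equivalence.from Boolₚ.T-∧ (x , y)

  and-All : ∀ {bs} → T (and bs) → All T bs
  and-All {[]}     _ = []
  and-All {b ∷ bs} t = let x , y = T-∧⁻ {b} t in x ∷ and-All y

  All-and : ∀ {bs} → All T bs → T (and bs)
  All-and []       = tt
  All-and (p ∷ ps) = T-∧⁺ p (All-and ps)

  RowsIncrease : Tableau → Set
  RowsIncrease t = T (and (map strictInc t))

  RowsIncrease-prepend⁺ : ∀ cs {t} → NonEmptyRows t →
    T (dominated cs (firstCol t)) → RowsIncrease t → RowsIncrease (prepend cs t)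
  RowsIncrease-prepend⁺ []       {[]}          _        _ _ = tt
  RowsIncrease-prepend⁺ (c ∷ cs) {[]}          _        _ _ = RowsIncrease-prepend⁺ cs [] tt tt
  RowsIncrease-prepend⁺ []       {[] ∷ t}      (() ∷ _) _ _
  RowsIncrease-prepend⁺ []       {(y ∷ r) ∷ t} _        () _
  RowsIncrease-prepend⁺ (c ∷ cs) {(y ∷ r) ∷ t} (_ ∷ ne) d inc =
    let c<y , d′ = T-∧⁻ {c <ᵇ y} d
        r< , t< = T-∧⁻ {strictInc (y ∷ r)} inc
    in T-∧⁺ (T-∧⁺ c<y r<) (RowsIncrease-prepend⁺ cs ne d′ t<)

  RowsIncrease-prepend⁻ : ∀ cs {t} → NonEmptyRows t → length t ≤ length cs → RowsIncrease (prepend cs t) →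
    T (dominated cs (firstCol t)) × RowsIncrease t
  RowsIncrease-prepend⁻ cs       {[]}          _        _        _   = tt , tt
  RowsIncrease-prepend⁻ (c ∷ cs) {(y ∷ r) ∷ t} (_ ∷ ne) (s≤s l≤) inc =
    let cyr , rest = T-∧⁻ {(c <ᵇ y) ∧ strictInc (y ∷ r)} inc
        c<y , yr = T-∧⁻ {c <ᵇ y} cyr
        d , t< = RowsIncrease-prepend⁻ cs ne l≤ rest
    in T-∧⁺ c<y d , T-∧⁺ yr t<

  entry-prepend-0 : ∀ cs t i → length t ≤ length cs → entry (prepend cs t) i 0 ≡ nth cs i
  entry-prepend-0 []       []      i       _        = refl
  entry-prepend-0 (c ∷ cs) []      zero    _        = refl
  entry-prepend-0 (c ∷ cs) []      (suc i) _        = entry-prepend-0 cs [] i z≤n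
  entry-prepend-0 (c ∷ cs) (r ∷ t) zero    _        = refl
  entry-prepend-0 (c ∷ cs) (r ∷ t) (suc i) (s≤s l≤) = entry-prepend-0 cs t i l≤

  entry-prepend-suc : ∀ cs t i j → length t ≤ length cs → entry (prepend cs t) i (suc j) ≡ entry t i j
  entry-prepend-suc []       []      i       j _        = refl
  entry-prepend-suc (c ∷ cs) []      zero    j _        = refl
  entry-prepend-suc (c ∷ cs) []      (suc i) j _        = entry-prepend-suc cs [] i j z≤n
  entry-prepend-suc (c ∷ cs) (r ∷ t) zero    j _        = refl
  entry-prepend-suc (c ∷ cs) (r ∷ t) (suc i) j (s≤s l≤) = entry-prepend-suc cs t i j l≤

  ColumnsIncrease : Tableau → Set
  ColumnsIncrease t = ∀ i j b → entry t (suc i) j ≡ just b → ∃ λ a → entry t i j ≡ just a × a < b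

  nth-bound : ∀ {A : Set} (xs : List A) i {x} → nth xs i ≡ just x → i < length xs
  nth-bound (_ ∷ xs) zero    _  = s≤s z≤n
  nth-bound (_ ∷ xs) (suc i) eq = s≤s (nth-bound xs i eq)

  width : Tableau → ℕ
  width t = foldr ℕ._⊔_ 0 (map length t)

  entry-bound : ∀ t i j {b} → entry t i j ≡ just b → i < length t × j < width t
  entry-bound (r ∷ t) zero    j eq = s≤s z≤n , ℕₚ.<-≤-trans (nth-bound r j eq) (ℕₚ.m≤m⊔n (length r) (width t))
  entry-bound (r ∷ t) (suc i) j eq = let i< , j< = entry-bound t i j eq in
    s≤s i< , ℕₚ.<-≤-trans j< (ℕₚ.m≤n⊔m (length r) (width t))

  colInc⁻ : ∀ t → T (colInc t) → ColumnsIncrease t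
  colInc⁻ t inc i j b eq with Allₚ.applyUpTo⁻ _ (width t) (Allₚ.map⁻ (All.lookup
      (Allₚ.concat⁻ (and-All inc)) (∈ₚ.∈-map⁺ _ (∈ₚ.∈-upTo⁺ i<)))) j<
    where
    bounds = entry-bound t (suc i) j eq
    i< : i < length t
    i< = ℕₚ.<-trans (ℕₚ.n<1+n i) (proj₁ bounds)
    j< : j < width t
    j< = proj₂ bounds
  ... | check with entry t i j | entry t (suc i) j | eq
  ... | just a | just .b | refl = a , refl , ℕₚ.<ᵇ⇒< a b check

  -- The comparison local to colInc has no name in scope; the underscore is solved by colInc-columnCheck.
  mutual
    columnCheck : Tableau → ℕ → ℕ → Bool
    columnCheck t i j = _

    colInc-columnCheck : ∀ t →
      colInc t ≡ and (concatMap (λ i → map (columnCheck t i) (upTo (width t))) (upTo (length t)))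
    colInc-columnCheck t = refl

  colInc⁺ : ∀ t → ColumnsIncrease t → T (colInc t)
  colInc⁺ t inc = All-and (Allₚ.concat⁺ (Allₚ.map⁺ (Allₚ.applyUpTo⁺₂ _ (length t) λ i →
    Allₚ.map⁺ (Allₚ.applyUpTo⁺₂ _ (width t) λ j → check i j))))
    where
    check : ∀ i j → T (columnCheck t i j)
    check i j with entry t (suc i) j | inc i j
    ... | nothing | _ = tt
    ... | just b  | f with f b refl
    ...   | a , eq , a<b rewrite eq = ℕₚ.<⇒<ᵇ a<b

-- Generating the valid tableaux recursively.

module TableauEnumeration where
  open import Data.Nat using (_<_)
  open Tableaux public

  nth-sorted⁺ : ∀ {cs} → AllPairs _<_ cs → ∀ i b → nth cs (suc i) ≡ just b → ∃ λ a → nth cs i ≡ just a × a < b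
  nth-sorted⁺ ((c<b ∷ _) ∷ _)  zero    b refl = _ , refl , c<b
  nth-sorted⁺ (_ ∷ cs<)        (suc i) b eq   = nth-sorted⁺ cs< i b eq

  nth-sorted⁻ : ∀ cs → (∀ i b → nth cs (suc i) ≡ just b → ∃ λ a → nth cs i ≡ just a × a < b) → Linked _<_ cs
  nth-sorted⁻ []            _ = []
  nth-sorted⁻ (c ∷ [])      _ = [-]
  nth-sorted⁻ (c ∷ d ∷ cs)  f = head (f 0 d refl) ∷ nth-sorted⁻ (d ∷ cs) (λ i → f (suc i))
    where
    head : (∃ λ a → just c ≡ just a × a < d) → c < d
    head (_ , refl , c<d) = c<d

  ColumnsIncrease-prepend⁺ : ∀ {cs t} → length t ≤ length cs → AllPairs _<_ cs → ColumnsIncrease t →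
    ColumnsIncrease (prepend cs t)
  ColumnsIncrease-prepend⁺ {cs} {t} l≤ cs< inc i zero b eq =
    let a , eqₐ , a<b = nth-sorted⁺ cs< i b (trans (sym (entry-prepend-0 cs t (suc i) l≤)) eq)
    in a , trans (entry-prepend-0 cs t i l≤) eqₐ , a<b
  ColumnsIncrease-prepend⁺ {cs} {t} l≤ cs< inc i (suc j) b eq =
    let a , eqₐ , a<b = inc i j b (trans (sym (entry-prepend-suc cs t (suc i) j l≤)) eq)
    in a , trans (entry-prepend-suc cs t i j l≤) eqₐ , a<b

  ColumnsIncrease-prepend⁻ : ∀ {cs t} → length t ≤ length cs → ColumnsIncrease (prepend cs t) →
    AllPairs _<_ cs × ColumnsIncrease t
  ColumnsIncrease-prepend⁻ {cs} {t} l≤ inc =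
    Linkedₚ.Linked⇒AllPairs ℕₚ.<-trans (nth-sorted⁻ cs λ i b eq →
      let a , eqₐ , a<b = inc i 0 b (trans (entry-prepend-0 cs t (suc i) l≤) eq)
      in a , trans (sym (entry-prepend-0 cs t i l≤)) eqₐ , a<b) ,
    λ i j b eq →
      let a , eqₐ , a<b = inc i (suc j) b (trans (entry-prepend-suc cs t (suc i) j l≤) eq)
      in a , trans (sym (entry-prepend-suc cs t i j l≤)) eqₐ , a<b

  T-not⁻ : ∀ {b} → T (Data.Bool.not b) → ¬ T b
  T-not⁻ {false} _ ()

  T-not⁺ : ∀ {b} → ¬ T b → T (Data.Bool.not b)
  T-not⁺ {false} _  = tt
  T-not⁺ {true}  ¬t = ¬t tt

  noDup⁻ : ∀ xs → T (noDup xs) → Unique xs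
  noDup⁻ []       _ = []
  noDup⁻ (x ∷ xs) p = let x∉ , xs! = T-∧⁻ {all (λ y → Data.Bool.not (x ≡ᵇ y)) xs} p in
    All.map (λ n x≡y → T-not⁻ n (ℕₚ.≡⇒≡ᵇ x _ x≡y)) (Allₚ.map⁻ (and-All x∉)) ∷ noDup⁻ xs xs!

  noDup⁺ : ∀ {xs} → Unique xs → T (noDup xs)
  noDup⁺ []         = tt
  noDup⁺ (x∉ ∷ xs!) = T-∧⁺
    (All-and (Allₚ.map⁺ (All.map (λ x≢y → T-not⁺ λ x≡ᵇy → x≢y (ℕₚ.≡ᵇ⇒≡ _ _ x≡ᵇy)) x∉))) (noDup⁺ xs!)

  -- The list comparison local to validTableau has no name in scope; the underscore is solved by validTableau-unfold.
  mutual
    rowEq : Tableau → Row → Row → Bool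
    rowEq t as bs = _

    validTableau-unfold : ∀ cs t → validTableau cs t ≡
      (and (map strictInc t) ∧ colInc t ∧ noDup (concat t) ∧ rowEq t (firstCol t) cs)
    validTableau-unfold cs t with firstCol t
    ... | as = refl

  rowEq⁻ : ∀ t as bs → T (rowEq t as bs) → as ≡ bs
  rowEq⁻ t []       []       _ = refl
  rowEq⁻ t (a ∷ as) (b ∷ bs) p = let a≡b , as≡bs = T-∧⁻ {a ≡ᵇ b} p in
    cong₂ _∷_ (ℕₚ.≡ᵇ⇒≡ a b a≡b) (rowEq⁻ t as bs as≡bs)

  rowEq⁺ : ∀ t as → T (rowEq t as as)
  rowEq⁺ t []       = tt
  rowEq⁺ t (a ∷ as) = T-∧⁺ (ℕₚ.≡⇒≡ᵇ a a refl) (rowEq⁺ t as)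

  module _ {A B : Set} (f : A → List B) where

    ∈-concatMap⁺ : ∀ {xs x y} → x ∈ xs → y ∈ f x → y ∈ concatMap f xs
    ∈-concatMap⁺ {x ∷ xs} (here refl) y∈ = ∈ₚ.∈-++⁺ˡ y∈
    ∈-concatMap⁺ {x ∷ xs} (there x∈)  y∈ = ∈ₚ.∈-++⁺ʳ (f x) (∈-concatMap⁺ x∈ y∈)

    ∈-concatMap⁻ : ∀ xs {y} → y ∈ concatMap f xs → ∃ λ x → x ∈ xs × y ∈ f x
    ∈-concatMap⁻ (x ∷ xs) y∈ with ∈ₚ.∈-++⁻ (f x) y∈
    ... | inj₁ y∈fx = x , here refl , y∈fx
    ... | inj₂ y∈′  = let x′ , x′∈ , y∈fx′ = ∈-concatMap⁻ xs y∈′ in x′ , there x′∈ , y∈fx′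

    concatMap-unique : ∀ {xs} → Unique xs → (∀ {x} → x ∈ xs → Unique (f x)) →
      (∀ {x x′ y} → x ∈ xs → x′ ∈ xs → y ∈ f x → y ∈ f x′ → x ≡ x′) → Unique (concatMap f xs)
    concatMap-unique []         _  _      = []
    concatMap-unique {x ∷ xs} (x∉ ∷ xs!) f! apart = Uniqueₚ.++⁺ (f! (here refl))
      (concatMap-unique xs! (f! ∘ there) (λ x∈ x′∈ → apart (there x∈) (there x′∈)))
      λ (y∈ , y∈′) → let x′ , x′∈ , y∈fx′ = ∈-concatMap⁻ xs y∈′ in
        All.lookup x∉ x′∈ (apart (here refl) (there x′∈) y∈ y∈fx′)

  map-unique : ∀ {A B : Set} {f : A → B} {xs} → Unique xs →
    (∀ {x y} → x ∈ xs → y ∈ xs → f x ≡ f y → x ≡ y) → Unique (map f xs)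
  map-unique []         _   = []
  map-unique (x∉ ∷ xs!) inj =
    Allₚ.map⁺ (All.tabulate λ y∈ eq → All.lookup x∉ y∈ (inj (here refl) (there y∈) eq)) ∷
    map-unique xs! (λ x∈ y∈ → inj (there x∈) (there y∈))

  range : ℕ → Row
  range = applyUpTo suc

  range-sorted : ∀ n → AllPairs _<_ (range n)
  range-sorted n = AllPairsₚ.applyUpTo⁺₁ suc n (λ i<j _ → s≤s i<j)

  unique-resp-↭ : ∀ {xs ys : Row} → xs ↭ ys → Unique xs → Unique ys
  unique-resp-↭ p = Permₛ.Unique-resp-↭ (Perm.↭⇒↭ₛ p)
    where import Data.List.Relation.Binary.Permutation.Setoid.Properties (≡.setoid ℕ) as Permₛ

  unique-++⁻ : ∀ (xs : Row) {ys} → Unique (xs ++ ys) → Unique ys × (∀ {x} → x ∈ xs → x ∉ ys)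
  unique-++⁻ []       ys!            = ys! , λ ()
  unique-++⁻ (x ∷ xs) (x∉ ∷ xs++ys!) = let ys! , disjoint = unique-++⁻ xs xs++ys! in ys! ,
    λ { (here refl) y∈ → All.lookup (Allₚ.++⁻ʳ xs x∉) y∈ refl ; (there z∈) → disjoint z∈ }

  sorted-unique : ∀ {xs} → AllPairs _<_ xs → Unique xs
  sorted-unique = sorted⇒unique ℕₚ.<-asym

  ∈-wordsOf⁻ : ∀ n ℓ {r} → r ∈ wordsOf n ℓ → length r ≡ ℓ × All (_∈ range n) r
  ∈-wordsOf⁻ n zero    (here refl) = refl , []
  ∈-wordsOf⁻ n (suc ℓ) r∈ with ∈-concatMap⁻ (λ a → map (a ∷_) (wordsOf n ℓ)) (range n) r∈
  ... | a , a∈ , r∈′ with ∈ₚ.∈-map⁻ (a ∷_) r∈′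
  ... | r , r∈ℓ , refl = let eq , r⊆ = ∈-wordsOf⁻ n ℓ r∈ℓ in cong suc eq , a∈ ∷ r⊆

  ∈-wordsOf⁺ : ∀ {n r} → All (_∈ range n) r → r ∈ wordsOf n (length r)
  ∈-wordsOf⁺ []             = here refl
  ∈-wordsOf⁺ {n} (a∈ ∷ r⊆) = ∈-concatMap⁺ _ a∈ (∈ₚ.∈-map⁺ _ (∈-wordsOf⁺ r⊆))

  wordsOf-unique : ∀ n ℓ → Unique (wordsOf n ℓ)
  wordsOf-unique n zero    = [] ∷ []
  wordsOf-unique n (suc ℓ) = concatMap-unique _ (sorted-unique (range-sorted n))
    (λ _ → Uniqueₚ.map⁺ Listₚ.∷-injectiveʳ (wordsOf-unique n ℓ))
    (λ _ _ y∈ y∈′ → let _ , _ , eq = ∈ₚ.∈-map⁻ _ y∈ ; _ , _ , eq′ = ∈ₚ.∈-map⁻ _ y∈′ in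
      Listₚ.∷-injectiveˡ (trans (sym eq) eq′))

  ∈-fillings⁻ : ∀ n λs {t} → t ∈ fillings n λs → map length t ≡ λs × All (_∈ range n) (concat t)
  ∈-fillings⁻ n []       (here refl) = refl , []
  ∈-fillings⁻ n (ℓ ∷ λs) t∈ with ∈-concatMap⁻ (λ r → map (r ∷_) (fillings n λs)) (wordsOf n ℓ) t∈
  ... | r , r∈ , t∈′ with ∈ₚ.∈-map⁻ (r ∷_) t∈′
  ... | t , t∈λs , refl = let eq , r⊆ = ∈-wordsOf⁻ n ℓ r∈ ; eqs , t⊆ = ∈-fillings⁻ n λs t∈λs in
    cong₂ _∷_ eq eqs , Allₚ.++⁺ r⊆ t⊆

  ∈-fillings⁺ : ∀ {n} t → All (_∈ range n) (concat t) → t ∈ fillings n (map length t)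
  ∈-fillings⁺ []      _  = here refl
  ∈-fillings⁺ (r ∷ t) t⊆ = ∈-concatMap⁺ _ (∈-wordsOf⁺ (Allₚ.++⁻ˡ r t⊆))
    (∈ₚ.∈-map⁺ _ (∈-fillings⁺ t (Allₚ.++⁻ʳ r t⊆)))

  fillings-unique : ∀ n λs → Unique (fillings n λs)
  fillings-unique n []       = [] ∷ []
  fillings-unique n (ℓ ∷ λs) = concatMap-unique _ (wordsOf-unique n ℓ)
    (λ _ → Uniqueₚ.map⁺ Listₚ.∷-injectiveʳ (fillings-unique n λs))
    (λ _ _ y∈ y∈′ → let _ , _ , eq = ∈ₚ.∈-map⁻ _ y∈ ; _ , _ , eq′ = ∈ₚ.∈-map⁻ _ y∈′ in
      Listₚ.∷-injectiveˡ (trans (sym eq) eq′))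

  record Valid (D : Row) (λs : List ℕ) (cs : Row) (t : Tableau) : Set where
    field
      shape   : map length t ≡ λs
      entries : All (_∈ D) (concat t)
      rows    : RowsIncrease t
      columns : ColumnsIncrease t
      unique  : Unique (concat t)
      first   : firstCol t ≡ cs

  validFillings : ℕ → List ℕ → Row → List Tableau
  validFillings n λs cs = filterᵇ (validTableau cs) (fillings n λs)

  private
    valid? : ∀ cs → Decidable (λ t → T (validTableau cs t))
    valid? cs t = Boolₚ.T? (validTableau cs t)

  ∈-validFillings⁻ : ∀ n λs cs {t} → t ∈ validFillings n λs cs → Valid (range n) λs cs t
  ∈-validFillings⁻ n λs cs {t} t∈ =
    let t∈′ , v = ∈ₚ.∈-filter⁻ (valid? cs) {xs = fillings n λs} t∈
        shape , entries = ∈-fillings⁻ n λs t∈′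
        rows , v₁ = T-∧⁻ {and (map strictInc t)} (subst T (validTableau-unfold cs t) v)
        cols , v₂ = T-∧⁻ {colInc t} v₁
        uniq , first = T-∧⁻ {noDup (concat t)} v₂
    in record { shape = shape ; entries = entries ; rows = rows ; columns = colInc⁻ t cols
              ; unique = noDup⁻ (concat t) uniq ; first = rowEq⁻ t (firstCol t) cs first }

  ∈-validFillings⁺ : ∀ n λs cs {t} → Valid (range n) λs cs t → t ∈ validFillings n λs cs
  ∈-validFillings⁺ n λs cs {t} v = ∈ₚ.∈-filter⁺ (valid? cs)
    (subst (λ s → t ∈ fillings n s) shape (∈-fillings⁺ t entries))
    (subst T (sym (validTableau-unfold cs t)) (T-∧⁺ rows (T-∧⁺ (colInc⁺ t columns) (T-∧⁺ (noDup⁺ unique)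
      (subst (λ s → T (rowEq t (firstCol t) s)) first (rowEq⁺ t (firstCol t)))))))
    where open Valid v

  validFillings-unique : ∀ n λs cs → Unique (validFillings n λs cs)
  validFillings-unique n λs cs = Uniqueₚ.filter⁺ (valid? cs) (fillings-unique n λs)

  infixl 6 _∖_
  _∖_ : Row → Row → Row
  _∖_ = without ℕ._≟_

  shape-length : ∀ {t : Tableau} {λs} → map length t ≡ λs → length t ≡ length λs
  shape-length {t} eq = trans (sym (Listₚ.length-map length t)) (cong length eq)

  shape-nonEmpty : ∀ {t : Tableau} {λs} → map length t ≡ λs → All (1 ≤_) λs → NonEmptyRows t
  shape-nonEmpty refl pos = Allₚ.map⁻ pos

  Valid-prepend⁺ : ∀ {D λs cs bs t} → AllPairs _<_ cs → All (_∈ D) cs → All (1 ≤_) λs → length λs ≤ length cs →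
    T (dominated cs bs) → Valid (D ∖ cs) λs bs t → Valid D (widen (length cs) λs) cs (prepend cs t)
  Valid-prepend⁺ {D} {λs} {cs} {bs} {t} cs< cs⊆ pos l≤ dom v = record
    { shape   = trans (shape-prepend cs t t≤) (cong (widen (length cs)) shape)
    ; entries = Permₚ.All-resp-↭ (↭-sym perm) (Allₚ.++⁺ cs⊆ (All.map (proj₁ ∘ ∈-without⁻ ℕ._≟_ D cs) entries))
    ; rows    = RowsIncrease-prepend⁺ cs (shape-nonEmpty shape pos) (subst (T ∘ dominated cs) (sym first) dom) rows
    ; columns = ColumnsIncrease-prepend⁺ t≤ cs< columns
    ; unique  = unique-resp-↭ (↭-sym perm) (Uniqueₚ.++⁺ (sorted-unique cs<) unique
                  λ (x∈cs , x∈t) → proj₂ (∈-without⁻ ℕ._≟_ D cs (All.lookup entries x∈t)) x∈cs)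
    ; first   = firstCol-prepend cs t
    }
    where
    open Valid v
    t≤ : length t ≤ length cs
    t≤ = subst (_≤ length cs) (sym (shape-length {t} shape)) l≤
    perm = concat-prepend cs t t≤

  Valid-prepend⁻ : ∀ {D m λs cs t} → All (1 ≤_) λs → length λs ≤ m → Valid D (widen m λs) cs t →
    ∃ λ t′ → t ≡ prepend cs t′ × Valid (D ∖ cs) λs (firstCol t′) t′ × T (dominated cs (firstCol t′)) × AllPairs _<_ cs × All (_∈ D) cs
  Valid-prepend⁻ {D} {m} {λs} {cs} {t} pos l≤ v = t′ , t≡ , record
    { shape   = shape′
    ; entries = All.tabulate λ x∈ → ∈-without⁺ ℕ._≟_ (All.lookup (Allₚ.++⁻ʳ cs entries′) x∈)
                  (λ x∈cs → proj₂ (unique-++⁻ cs unique′) x∈cs x∈)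
    ; rows    = proj₂ split
    ; columns = proj₂ cols
    ; unique  = proj₁ (unique-++⁻ cs unique′)
    ; first   = refl
    } , proj₁ split , proj₁ cols , Allₚ.++⁻ˡ cs entries′
    where
    open Valid v
    peeled = prepend-peel m λs t pos l≤ shape
    t′ = peel t
    t≡ : t ≡ prepend cs t′
    t≡ = trans (proj₁ peeled) (cong (λ c → prepend c t′) first)
    shape′ : map length t′ ≡ λs
    shape′ = proj₁ (proj₂ peeled)
    t′≤ : length t′ ≤ length cs
    t′≤ = ≡.subst₂ _≤_ (sym (shape-length {t′} shape′)) (trans (sym (proj₂ (proj₂ peeled))) (cong length first)) l≤
    perm : concat t ↭ cs ++ concat t′
    perm = subst (λ s → concat s ↭ cs ++ concat t′) (sym t≡) (concat-prepend cs t′ t′≤)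
    entries′ : All (_∈ D) (cs ++ concat t′)
    entries′ = Permₚ.All-resp-↭ perm entries
    unique′ : Unique (cs ++ concat t′)
    unique′ = unique-resp-↭ perm unique
    split = RowsIncrease-prepend⁻ cs (shape-nonEmpty shape′ pos) t′≤ (subst RowsIncrease t≡ rows)
    cols = ColumnsIncrease-prepend⁻ {cs} {t′} t′≤ (subst ColumnsIncrease t≡ columns)

  -- The recursion copies that of `chainSum`, except that only columns compatible with increasing
  -- rows are kept.
  tableaux : Row → Row → List ℕ → List Tableau
  tableaux D cs []       = prepend cs [] ∷ []
  tableaux D cs (k ∷ ks) = concatMap (λ bs → map (prepend cs) (tableaux (D ∖ cs) bs ks))
    (filterᵇ (dominated cs) (subs k (D ∖ cs)))

  private
    dominated? : ∀ cs → Decidable (λ bs → T (dominated cs bs))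
    dominated? cs bs = Boolₚ.T? (dominated cs bs)

  ∈-tableaux⁻ : ∀ ks {D cs t} → AllPairs _<_ D → cs ⊆ D → Decreasing (length cs ∷ ks) →
    t ∈ tableaux D cs ks → Valid D (conj (length cs ∷ ks)) cs t
  ∈-tableaux⁻ [] {D} {cs} D< cs⊆ dec (here refl) = subst (λ s → Valid D s cs (prepend cs [])) (sym (conj-∷ (length cs) [] dec))
    (Valid-prepend⁺ {bs = []} (AllPairs-⊆ cs⊆ D<) (All.tabulate (Sublist.lookup cs⊆)) [] z≤n (nothingDominated cs)
      record { shape = refl ; entries = [] ; rows = tt ; columns = λ _ _ _ () ; unique = [] ; first = refl })
    where
    nothingDominated : ∀ cs → T (dominated cs [])
    nothingDominated []      = tt
    nothingDominated (_ ∷ _) = tt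
  ∈-tableaux⁻ (k ∷ ks) {D} {cs} D< cs⊆ dec@(_ ∷ dec′) t∈
    with ∈-concatMap⁻ (λ bs → map (prepend cs) (tableaux (D ∖ cs) bs ks)) (filterᵇ (dominated cs) (subs k (D ∖ cs))) t∈
  ... | bs , bs∈ , t∈′ with ∈ₚ.∈-filter⁻ (dominated? cs) {xs = subs k (D ∖ cs)} bs∈ | ∈ₚ.∈-map⁻ (prepend cs) t∈′
  ... | bs∈′ , dom | t , t∈″ , refl with ∈-subs⁻ k (D ∖ cs) bs∈′
  ... | bs⊆ , refl = subst (λ s → Valid D s cs (prepend cs t)) (sym (conj-∷ (length cs) (k ∷ ks) dec))
    (Valid-prepend⁺ (AllPairs-⊆ cs⊆ D<) (All.tabulate (Sublist.lookup cs⊆)) (conj-positive (k ∷ ks) dec′)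
      (length-conj-≤ (k ∷ ks) dec) dom
      (∈-tableaux⁻ ks (without-sorted ℕ._≟_ cs D<) bs⊆ dec′ t∈″))

  ∈-tableaux⁺ : ∀ ks {D cs t} → AllPairs _<_ D → Decreasing (length cs ∷ ks) →
    Valid D (conj (length cs ∷ ks)) cs t → t ∈ tableaux D cs ks
  ∈-tableaux⁺ [] {D} {cs} {t} D< dec v
    with Valid-prepend⁻ {m = length cs} [] z≤n (subst (λ s → Valid D s cs t) (conj-∷ (length cs) [] dec) v)
  ... | [] , refl , _ = here refl
  ... | _ ∷ _ , _ , v′ , _ with Valid.shape v′
  ...   | ()
  ∈-tableaux⁺ (k ∷ ks) {D} {cs} {t} D< dec@(_ ∷ dec′) v
    with Valid-prepend⁻ {m = length cs} (conj-positive (k ∷ ks) dec′) (length-conj-≤ (k ∷ ks) dec)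
      (subst (λ s → Valid D s cs t) (conj-∷ (length cs) (k ∷ ks) dec) v)
  ... | t′ , refl , v′ , dom , cs< , cs⊆ = ∈-concatMap⁺ _
      (∈ₚ.∈-filter⁺ (dominated? cs) (subst (λ l → bs ∈ subs l (D ∖ cs)) bs≡k (∈-subs⁺ bs⊆)) dom)
      (∈ₚ.∈-map⁺ (prepend cs) (∈-tableaux⁺ ks E< (subst (λ l → Decreasing (l ∷ ks)) (sym bs≡k) dec′)
        (subst (λ l → Valid (D ∖ cs) (conj (l ∷ ks)) bs t′) (sym bs≡k) v′)))
    where
    bs = firstCol t′
    E< = without-sorted ℕ._≟_ cs D<
    sub : ∃ λ t″ → t′ ≡ prepend bs t″ × Valid (D ∖ cs ∖ bs) (conj ks) (firstCol t″) t″ × T (dominated bs (firstCol t″))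
            × AllPairs _<_ bs × All (_∈ D ∖ cs) bs
    sub = Valid-prepend⁻ {m = k} (conj-positive ks (Linked.tail dec′)) (length-conj-≤ ks dec′)
      (subst (λ s → Valid (D ∖ cs) s bs t′) (conj-∷ k ks dec′) v′)
    bs⊆ : bs ⊆ D ∖ cs
    bs⊆ = sorted-⊆ ℕₚ.<-asym ℕ._≟_ (proj₁ (proj₂ (proj₂ (proj₂ (proj₂ sub))))) E<
      (All.lookup (proj₂ (proj₂ (proj₂ (proj₂ (proj₂ sub))))))
    bs≡k : length bs ≡ k
    bs≡k = trans (sym (length-prepend bs (proj₁ sub))) (trans (cong length (sym (proj₁ (proj₂ sub))))
      (trans (shape-length {t′} (Valid.shape v′)) (length-conj k ks)))

  -- No tableau arises twice: `peel` recovers the part right of `cs`, and its first column recovers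
  -- the choice of `bs`.
  tableaux-unique : ∀ ks {D cs} → AllPairs _<_ D → cs ⊆ D → Decreasing (length cs ∷ ks) → Unique (tableaux D cs ks)
  tableaux-unique [] _ _ _ = [] ∷ []
  tableaux-unique (k ∷ ks) {D} {cs} D< cs⊆ (k≤ ∷ dec) = concatMap-unique _
    (Uniqueₚ.filter⁺ (dominated? cs) (subs-unique k (sorted-unique E<)))
    (λ {bs} bs∈ → map-unique (rest-unique bs∈) λ t∈ t′∈ eq → trans (sym (peel-rest bs∈ t∈)) (trans (cong peel eq) (peel-rest bs∈ t′∈)))
    (λ bs∈ bs′∈ t∈ t′∈ → same bs∈ bs′∈ (∈ₚ.∈-map⁻ (prepend cs) t∈) (∈ₚ.∈-map⁻ (prepend cs) t′∈))
    where
    E< = without-sorted ℕ._≟_ cs D<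
    Bs = filterᵇ (dominated cs) (subs k (D ∖ cs))
    column : ∀ {bs} → bs ∈ Bs → bs ⊆ D ∖ cs × length bs ≡ k
    column bs∈ = ∈-subs⁻ k (D ∖ cs) (proj₁ (∈ₚ.∈-filter⁻ (dominated? cs) {xs = subs k (D ∖ cs)} bs∈))
    dec-at : ∀ {bs} → bs ∈ Bs → Decreasing (length bs ∷ ks)
    dec-at bs∈ = subst (λ l → Decreasing (l ∷ ks)) (sym (proj₂ (column bs∈))) dec
    rest-unique : ∀ {bs} → bs ∈ Bs → Unique (tableaux (D ∖ cs) bs ks)
    rest-unique bs∈ = tableaux-unique ks E< (proj₁ (column bs∈)) (dec-at bs∈)
    rest-valid : ∀ {bs t} → bs ∈ Bs → t ∈ tableaux (D ∖ cs) bs ks → Valid (D ∖ cs) (conj (k ∷ ks)) bs t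
    rest-valid {bs} {t} bs∈ t∈ = subst (λ l → Valid (D ∖ cs) (conj (l ∷ ks)) bs t) (proj₂ (column bs∈))
      (∈-tableaux⁻ ks E< (proj₁ (column bs∈)) (dec-at bs∈) t∈)
    peel-rest : ∀ {bs t} → bs ∈ Bs → t ∈ tableaux (D ∖ cs) bs ks → peel (prepend cs t) ≡ t
    peel-rest {t = t} bs∈ t∈ = let shape = Valid.shape (rest-valid bs∈ t∈) in
      peel-prepend cs (shape-nonEmpty shape (conj-positive (k ∷ ks) dec))
        (subst (_≤ length cs) (sym (trans (shape-length {t} shape) (length-conj k ks))) k≤)
    same : ∀ {bs bs′ t} → bs ∈ Bs → bs′ ∈ Bs →
      (∃ λ u → u ∈ tableaux (D ∖ cs) bs ks × t ≡ prepend cs u) →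
      (∃ λ u → u ∈ tableaux (D ∖ cs) bs′ ks × t ≡ prepend cs u) → bs ≡ bs′
    same bs∈ bs′∈ (u , u∈ , eq) (u′ , u′∈ , eq′) = trans (sym (Valid.first (rest-valid bs∈ u∈)))
      (trans (cong firstCol (trans (sym (peel-rest bs∈ u∈)) (trans (cong peel (trans (sym eq) eq′)) (peel-rest bs′∈ u′∈))))
        (Valid.first (rest-valid bs′∈ u′∈)))

-- The weight of a tableau as a product over adjacent columns.

module TableauWeights where
  open import Data.Nat using (_+_; _*_; _<_)
  open TableauEnumeration public

  prodTo : ℕ → (ℕ → ℕ) → ℕ
  prodTo zero    f = 1
  prodTo (suc n) f = f 0 * prodTo n (f ∘ suc)

  prodTo-cong : ∀ n {f g} → (∀ i → i < n → f i ≡ g i) → prodTo n f ≡ prodTo n g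
  prodTo-cong zero    eq = refl
  prodTo-cong (suc n) eq = cong₂ _*_ (eq 0 (s≤s z≤n)) (prodTo-cong n (λ i i<n → eq (suc i) (s≤s i<n)))

  prodTo-one : ∀ n {f} → (∀ i → i < n → f i ≡ 1) → prodTo n f ≡ 1
  prodTo-one zero    eq = refl
  prodTo-one (suc n) eq = cong₂ _*_ (eq 0 (s≤s z≤n)) (prodTo-one n (λ i i<n → eq (suc i) (s≤s i<n)))

  *-interchange : ∀ a b c d → (a * b) * (c * d) ≡ (a * c) * (b * d)
  *-interchange = solve-∀

  prodTo-* : ∀ n f g → prodTo n (λ i → f i * g i) ≡ prodTo n f * prodTo n g
  prodTo-* zero    f g = refl
  prodTo-* (suc n) f g = trans (cong (f 0 * g 0 *_) (prodTo-* n (f ∘ suc) (g ∘ suc)))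
    (*-interchange (f 0) (g 0) _ _)

  prodTo-truncate : ∀ {k m} f → k ≤ m → (∀ i → k ≤ i → i < m → f i ≡ 1) → prodTo m f ≡ prodTo k f
  prodTo-truncate {zero}  {m}     f _         f≡1 = prodTo-one m (λ i → f≡1 i z≤n)
  prodTo-truncate {suc k} {suc m} f (s≤s k≤m) f≡1 =
    cong (f 0 *_) (prodTo-truncate (f ∘ suc) k≤m (λ i k≤i i<m → f≡1 (suc i) (s≤s k≤i) (s≤s i<m)))

  product-upTo : ∀ (f g : ℕ → ℕ) n → product (map f (applyUpTo g n)) ≡ prodTo n (f ∘ g)
  product-upTo f g zero    = refl
  product-upTo f g (suc n) = cong (f (g 0) *_) (product-upTo f (g ∘ suc) n)

  product-concatMap : ∀ (f : ℕ → List ℕ) xs → product (concatMap f xs) ≡ product (map (product ∘ f) xs)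
  product-concatMap f []       = refl
  product-concatMap f (x ∷ xs) = trans (ListActionₚ.product-++ (f x) (concatMap f xs))
    (cong (product (f x) *_) (product-concatMap f xs))

  countTo : ℕ → (ℕ → Bool) → ℕ
  countTo zero    p = 0
  countTo (suc n) p = (if p 0 then 1 else 0) + countTo n (p ∘ suc)

  countTo-cong : ∀ n {p p′} → (∀ i → p i ≡ p′ i) → countTo n p ≡ countTo n p′
  countTo-cong zero    eq = refl
  countTo-cong (suc n) eq = cong₂ (λ b k → (if b then 1 else 0) + k) (eq 0) (countTo-cong n (eq ∘ suc))

  countTo-truncate : ∀ {k m} p → k ≤ m → (∀ i → k ≤ i → p i ≡ false) → countTo m p ≡ countTo k p
  countTo-truncate {zero}  {zero}  p _         _  = refl
  countTo-truncate {zero}  {suc m} p _         p≡ rewrite p≡ 0 z≤n = countTo-truncate {0} {m} (p ∘ suc) z≤n (λ i _ → p≡ (suc i) z≤n)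
  countTo-truncate {suc k} {suc m} p (s≤s k≤m) p≡ =
    cong ((if p 0 then 1 else 0) +_) (countTo-truncate (p ∘ suc) k≤m (λ i k≤i → p≡ (suc i) (s≤s k≤i)))

  length-filterᵇ : ∀ (p : ℕ → Bool) (f : ℕ → ℕ) n → length (filterᵇ p (applyUpTo f n)) ≡ countTo n (p ∘ f)
  length-filterᵇ p f zero = refl
  length-filterᵇ p f (suc n) with p (f 0)
  ... | true  = cong suc (length-filterᵇ p (f ∘ suc) n)
  ... | false = length-filterᵇ p (f ∘ suc) n

  -- The row length local to cq has no name in scope; the underscore is solved by cq-tailLength.
  mutual
    tailLength : ℕ → Tableau → ℕ → ℕ
    tailLength q t i = _

    cq-tailLength : ∀ q t → cq q t ≡
      product (concatMap (λ i → map (λ j → qint q (cij t i (suc j))) (upTo (tailLength q t i))) (upTo (length t)))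
    cq-tailLength q t = refl

  rowLength : Tableau → ℕ → ℕ
  rowLength []      i       = 0
  rowLength (r ∷ t) zero    = length r
  rowLength (r ∷ t) (suc i) = rowLength t i

  tailLength-rowLength : ∀ q t i → tailLength q t i ≡ rowLength t i ∸ 1
  tailLength-rowLength q []      i       = refl
  tailLength-rowLength q (r ∷ t) zero    = refl
  tailLength-rowLength q (r ∷ t) (suc i) = tailLength-rowLength q t i

  rowWeight : ℕ → Tableau → ℕ → ℕ
  rowWeight q t i = prodTo (rowLength t i ∸ 1) (λ j → qint q (cij t i (suc j)))

  cq-prodTo : ∀ q t → cq q t ≡ prodTo (length t) (rowWeight q t)
  cq-prodTo q t = trans (cq-tailLength q t) (trans (product-concatMap _ (upTo (length t)))
    (trans (product-upTo _ id (length t)) (prodTo-cong (length t) λ i _ →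
      trans (product-upTo _ id (tailLength q t i)) (cong (λ l → prodTo l (λ j → qint q (cij t i (suc j)))) (tailLength-rowLength q t i)))))

  rowLength-prepend : ∀ cs t i → length t ≤ length cs → rowLength (prepend cs t) i ∸ 1 ≡ rowLength t i
  rowLength-prepend []       []      i       _        = refl
  rowLength-prepend (c ∷ cs) []      zero    _        = refl
  rowLength-prepend (c ∷ cs) []      (suc i) _        = rowLength-prepend cs [] i z≤n
  rowLength-prepend (c ∷ cs) (r ∷ t) zero    _        = refl
  rowLength-prepend (c ∷ cs) (r ∷ t) (suc i) (s≤s l≤) = rowLength-prepend cs t i l≤

  rowLength-positive : ∀ t i → NonEmptyRows t → i < length t → 1 ≤ rowLength t i
  rowLength-positive (r ∷ t) zero    (1≤ ∷ _) _         = 1≤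
  rowLength-positive (r ∷ t) (suc i) (_ ∷ ne) (s≤s i<) = rowLength-positive t i ne i<

  rowLength-beyond : ∀ t i → length t ≤ i → rowLength t i ≡ 0
  rowLength-beyond []      i       _        = refl
  rowLength-beyond (r ∷ t) (suc i) (s≤s l≤) = rowLength-beyond t i l≤

  nth-exists : ∀ {A : Set} (xs : List A) i → i < length xs → ∃ λ x → nth xs i ≡ just x
  nth-exists (x ∷ xs) zero    _        = x , refl
  nth-exists (x ∷ xs) (suc i) (s≤s i<) = nth-exists xs i i<

  entry-exists : ∀ t i j → j < rowLength t i → ∃ λ v → entry t i j ≡ just v
  entry-exists (r ∷ t) zero    j j< = nth-exists r j j<
  entry-exists (r ∷ t) (suc i) j j< = entry-exists t i j j<

  entry-beyond : ∀ t i j → length t ≤ i → entry t i j ≡ nothing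
  entry-beyond []      i       j _        = refl
  entry-beyond (r ∷ t) (suc i) j (s≤s l≤) = entry-beyond t i j l≤

  below : ℕ → Maybe ℕ → Bool
  below v nothing  = false
  below v (just a) = a <ᵇ v

  -- The comparison local to cij has no name in scope; the underscore is solved by cij-entryBelow.
  mutual
    entryBelow : Tableau → ℕ → ℕ → ℕ → ℕ → Bool
    entryBelow t i j v i′ = _

    cij-entryBelow : ∀ t i j {v} → entry t i j ≡ just v →
      cij t i j ≡ length (filterᵇ (entryBelow t i j v) (applyUpTo (λ k → i + k) (length t ∸ i)))
    cij-entryBelow t i j eq with entry t i j
    cij-entryBelow t i j refl | just v = refl

  entryBelow-below : ∀ t i j v i′ → entryBelow t i j v i′ ≡ below v (entry t i′ (j ∸ 1))
  entryBelow-below t i j v i′ with entry t i′ (j ∸ 1)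
  ... | nothing = refl
  ... | just _  = refl

  cij-countTo : ∀ t i j {v} → entry t i j ≡ just v →
    cij t i j ≡ countTo (length t ∸ i) (λ k → below v (entry t (i + k) (j ∸ 1)))
  cij-countTo t i j {v} eq = trans (cij-entryBelow t i j eq)
    (trans (length-filterᵇ (entryBelow t i j v) (i +_) (length t ∸ i))
      (countTo-cong (length t ∸ i) λ k → entryBelow-below t i j v (i + k)))

  -- Beyond the new column the counts compare the same entries as in `t`; the extra rows of the
  -- longer tableau have no entry there and contribute nothing.
  cij-prepend-suc : ∀ cs t i j {v} → length t ≤ length cs → entry t i (suc j) ≡ just v →
    cij (prepend cs t) i (suc (suc j)) ≡ cij t i (suc j)
  cij-prepend-suc cs t i j {v} l≤ eq = begin
    cij (prepend cs t) i (suc (suc j))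
      ≡⟨ cij-countTo (prepend cs t) i (suc (suc j)) (trans (entry-prepend-suc cs t i (suc j) l≤) eq) ⟩
    countTo (length (prepend cs t) ∸ i) (λ k → below v (entry (prepend cs t) (i + k) (suc j)))
      ≡⟨ countTo-cong (length (prepend cs t) ∸ i) (λ k → cong (below v) (entry-prepend-suc cs t (i + k) j l≤)) ⟩
    countTo (length (prepend cs t) ∸ i) (λ k → below v (entry t (i + k) j))
      ≡⟨ cong (λ m → countTo (m ∸ i) (λ k → below v (entry t (i + k) j))) (length-prepend cs t) ⟩
    countTo (length cs ∸ i) (λ k → below v (entry t (i + k) j))
      ≡⟨ countTo-truncate _ (ℕₚ.∸-monoˡ-≤ i l≤) (λ k k≥ → cong (below v)
           (entry-beyond t (i + k) j (ℕₚ.≤-trans (ℕₚ.m≤n+m∸n (length t) i) (ℕₚ.+-monoʳ-≤ i k≥)))) ⟩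
    countTo (length t ∸ i) (λ k → below v (entry t (i + k) j))
      ≡⟨ cij-countTo t i (suc j) eq ⟨
    cij t i (suc j) ∎
    where open ≡-Reasoning

  smaller : ℕ → Row → ℕ
  smaller b cs = length (filter (λ a → a ℕ.<? b) cs)

  countTo-drop : ∀ b cs i → countTo (length cs ∸ i) (λ k → below b (nth cs (i + k))) ≡ smaller b (drop i cs)
  countTo-drop b []       zero    = refl
  countTo-drop b []       (suc i) = refl
  countTo-drop b (c ∷ cs) (suc i) = countTo-drop b cs i
  countTo-drop b (c ∷ cs) zero with c <ᵇ b
  ... | true  = cong suc (countTo-drop b cs zero)
  ... | false = countTo-drop b cs zero

  smaller-none : ∀ {b cs} → All (b ≤_) cs → smaller b cs ≡ 0
  smaller-none {b} ≥b = cong length (Listₚ.filter-none (λ a → a ℕ.<? b) (All.map ℕₚ.≤⇒≯ ≥b))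

  -- The entries below `b` form an initial segment of the increasing list, so dropping `i` entries
  -- removes `i` of them, or all if there are fewer. This converts the restriction to lower rows in
  -- the tableau statistic into a subtraction.
  smaller-drop : ∀ b {cs} i → AllPairs _<_ cs → smaller b (drop i cs) ≡ smaller b cs ∸ i
  smaller-drop b zero    _  = refl
  smaller-drop b (suc i) [] = refl
  smaller-drop b {c ∷ cs} (suc i) (c< ∷ cs<) with c ℕ.<? b
  ... | yes c<b = trans (smaller-drop b i cs<) (cong (λ k → k ∸ suc i) (sym (cong length (Listₚ.filter-accept (λ a → a ℕ.<? b) {xs = cs} c<b))))
  ... | no  c≮b = trans (smaller-none (Allₚ.drop⁺ i cs≥b)) (cong (_∸ suc i) (sym (smaller-none {b} {c ∷ cs} (ℕₚ.≮⇒≥ c≮b ∷ cs≥b))))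
    where
    cs≥b : All (b ≤_) cs
    cs≥b = All.map (λ c<x → ℕₚ.≤-trans (ℕₚ.≮⇒≥ c≮b) (ℕₚ.<⇒≤ c<x)) c<

  -- The q-integers contributed by the cells of one column, compared with the column to its left.
  -- Rows are counted from 0, so `i` is the number of rows above.
  columnProduct : ℕ → Row → ℕ → Row → ℕ
  columnProduct q cs i []       = 1
  columnProduct q cs i (b ∷ bs) = qint q (smaller b cs ∸ i) * columnProduct q cs (suc i) bs

  prodTo-columnProduct : ∀ q cs bs i f →
    (∀ j b → nth bs j ≡ just b → f j ≡ qint q (smaller b cs ∸ (i + j))) → prodTo (length bs) f ≡ columnProduct q cs i bs
  prodTo-columnProduct q cs []       i f eq = refl
  prodTo-columnProduct q cs (b ∷ bs) i f eq = cong₂ _*_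
    (trans (eq 0 b refl) (cong (λ k → qint q (smaller b cs ∸ k)) (ℕₚ.+-identityʳ i)))
    (prodTo-columnProduct q cs bs (suc i) (f ∘ suc) λ j b′ eq′ →
      trans (eq (suc j) b′ eq′) (cong (λ k → qint q (smaller b′ cs ∸ k)) (ℕₚ.+-suc i j)))

  cq-single : ∀ q cs → cq q (prepend cs []) ≡ 1
  cq-single q cs = trans (cq-prodTo q (prepend cs [])) (prodTo-one (length (prepend cs [])) λ i _ →
    cong (λ l → prodTo l (λ j → qint q (cij (prepend cs []) i (suc j)))) (rowLength-prepend cs [] i z≤n))

  -- In each row meeting `bs` the first factor compares `cs` with `bs`, and the others form the row
  -- weight in the smaller tableau; rows below the end of `bs` have a single cell and weight 1.
  cq-prepend : ∀ q cs bs u → AllPairs _<_ cs → length u ≤ length bs → length bs ≤ length cs →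
    cq q (prepend cs (prepend bs u)) ≡ columnProduct q cs 0 bs * cq q (prepend bs u)
  cq-prepend q cs bs u cs< u≤ bs≤ = begin
    cq q P                                                          ≡⟨ cq-prodTo q P ⟩
    prodTo (length P) (rowWeight q P)                               ≡⟨ cong (λ l → prodTo l (rowWeight q P)) (length-prepend cs t) ⟩
    prodTo (length cs) (rowWeight q P)                              ≡⟨ prodTo-truncate (rowWeight q P) bs≤ short ⟩
    prodTo (length bs) (rowWeight q P)                              ≡⟨ prodTo-cong (length bs) long ⟩
    prodTo (length bs) (λ i → qint q (cij P i 1) * rowWeight q t i) ≡⟨ prodTo-* (length bs) _ _ ⟩
    prodTo (length bs) (λ i → qint q (cij P i 1)) * prodTo (length bs) (rowWeight q t)
      ≡⟨ cong₂ _*_ (prodTo-columnProduct q cs bs 0 _ first)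
           (trans (cong (λ l → prodTo l (rowWeight q t)) (sym (length-prepend bs u))) (sym (cq-prodTo q t))) ⟩
    columnProduct q cs 0 bs * cq q t                                ∎
    where
    open ≡-Reasoning
    t = prepend bs u
    P = prepend cs t
    t≤ : length t ≤ length cs
    t≤ = subst (_≤ length cs) (sym (length-prepend bs u)) bs≤
    row : ∀ i → rowWeight q P i ≡ prodTo (rowLength t i) (λ j → qint q (cij P i (suc j)))
    row i = cong (λ l → prodTo l (λ j → qint q (cij P i (suc j)))) (rowLength-prepend cs t i t≤)
    short : ∀ i → length bs ≤ i → i < length cs → rowWeight q P i ≡ 1
    short i bs≤i _ = trans (row i) (cong (λ l → prodTo l (λ j → qint q (cij P i (suc j))))
      (rowLength-beyond t i (subst (_≤ i) (sym (length-prepend bs u)) bs≤i)))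
    long : ∀ i → i < length bs → rowWeight q P i ≡ qint q (cij P i 1) * rowWeight q t i
    long i i< = trans (row i) (split (rowLength t i)
      (rowLength-positive t i (prepend-nonEmpty bs u) (subst (i <_) (sym (length-prepend bs u)) i<))
      λ j j< → let v , eq = entry-exists t i (suc j) j< in cij-prepend-suc cs t i j t≤ eq)
      where
      split : ∀ l → 1 ≤ l → (∀ j → suc j < l → cij P i (suc (suc j)) ≡ cij t i (suc j)) →
        prodTo l (λ j → qint q (cij P i (suc j))) ≡ qint q (cij P i 1) * prodTo (l ∸ 1) (λ j → qint q (cij t i (suc j)))
      split (suc l) _ eq = cong (qint q (cij P i 1) *_) (prodTo-cong l (λ j j<l → cong (qint q) (eq j (s≤s j<l))))
    first : ∀ i b → nth bs i ≡ just b → qint q (cij P i 1) ≡ qint q (smaller b cs ∸ i)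
    first i b eq = cong (qint q) (begin
      cij P i 1
        ≡⟨ cij-countTo P i 1 (trans (entry-prepend-suc cs t i 0 t≤) (trans (entry-prepend-0 bs u i u≤) eq)) ⟩
      countTo (length P ∸ i) (λ k → below b (entry P (i + k) 0))
        ≡⟨ countTo-cong (length P ∸ i) (λ k → cong (below b) (entry-prepend-0 cs t (i + k) t≤)) ⟩
      countTo (length P ∸ i) (λ k → below b (nth cs (i + k)))
        ≡⟨ cong (λ m → countTo (m ∸ i) (λ k → below b (nth cs (i + k)))) (length-prepend cs t) ⟩
      countTo (length cs ∸ i) (λ k → below b (nth cs (i + k)))
        ≡⟨ countTo-drop b cs i ⟩
      smaller b (drop i cs)
        ≡⟨ smaller-drop b i cs< ⟩
      smaller b cs ∸ i ∎)

-- The tableau sum as a sum over chains.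

module TableauSums where
  open import Data.Nat using (_+_; _*_; _<_)
  open TableauWeights public

  qint-suc : ∀ q d → qint q (suc d) ≡ 1 + q * qint q d
  qint-suc q d = cong suc (shift (q ^_) d)
    where
    shift : ∀ f d → sum (applyUpTo (λ k → q * f k) d) ≡ q * sum (applyUpTo f d)
    shift f zero    = sym (ℕₚ.*-zeroʳ q)
    shift f (suc d) = trans (cong (q * f 0 +_) (shift (f ∘ suc) d)) (sym (ℕₚ.*-distribˡ-+ q (f 0) _))

  -- The geometric series with `q = suc p`, in a form free of truncated subtraction.
  geometric : ∀ p d → suc (p * qint (suc p) d) ≡ suc p ^ d
  geometric p zero    = cong suc (ℕₚ.*-zeroʳ p)
  geometric p (suc d) = begin
    suc (p * qint (suc p) (suc d))           ≡⟨ cong (λ x → suc (p * x)) (qint-suc (suc p) d) ⟩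
    suc (p * (1 + suc p * qint (suc p) d))   ≡⟨ rearrange p (qint (suc p) d) ⟩
    suc p * suc (p * qint (suc p) d)         ≡⟨ cong (suc p *_) (geometric p d) ⟩
    suc p ^ suc d                            ∎
    where
    open ≡-Reasoning
    rearrange : ∀ p x → 1 + (p * (1 + (1 + p) * x)) ≡ (1 + p) * (1 + p * x)
    rearrange = solve-∀

  -- For `a ≤ i` both sides are zero, since both truncated differences are; this is what later lets
  -- columns that break the row condition drop out.
  q^a∸q^i : ∀ {q} → 1 ≤ q → ∀ a i → q ^ a ∸ q ^ i ≡ (q ∸ 1) * q ^ i * qint q (a ∸ i)
  q^a∸q^i {suc p} _ a i with ℕₚ.≤-total i a
  ... | inj₂ a≤i = trans (ℕₚ.m≤n⇒m∸n≡0 (ℕₚ.^-monoʳ-≤ (suc p) a≤i))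
    (sym (trans (cong (λ d → p * suc p ^ i * qint (suc p) d) (ℕₚ.m≤n⇒m∸n≡0 a≤i)) (ℕₚ.*-zeroʳ (p * suc p ^ i))))
  ... | inj₁ i≤a = begin
    suc p ^ a ∸ suc p ^ i                            ≡⟨ cong (λ e → suc p ^ e ∸ suc p ^ i) (ℕₚ.m+[n∸m]≡n i≤a) ⟨
    suc p ^ (i + d) ∸ suc p ^ i                      ≡⟨ cong (_∸ suc p ^ i) (ℕₚ.^-distribˡ-+-* (suc p) i d) ⟩
    suc p ^ i * suc p ^ d ∸ suc p ^ i                ≡⟨ cong (λ x → suc p ^ i * x ∸ suc p ^ i) (geometric p d) ⟨
    suc p ^ i * suc (p * qint (suc p) d) ∸ suc p ^ i ≡⟨ cong (_∸ suc p ^ i) (ℕₚ.*-suc (suc p ^ i) _) ⟩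
    suc p ^ i + suc p ^ i * (p * qint (suc p) d) ∸ suc p ^ i ≡⟨ ℕₚ.m+n∸m≡n (suc p ^ i) _ ⟩
    suc p ^ i * (p * qint (suc p) d)                 ≡⟨ swap (suc p ^ i) p (qint (suc p) d) ⟩
    p * suc p ^ i * qint (suc p) d                   ∎
    where
    open ≡-Reasoning
    d = a ∸ i
    swap : ∀ x y z → x * (y * z) ≡ y * x * z
    swap = solve-∀

  -- The sum of `k` consecutive numbers from `i` on: the exponent collected from the factors `q ^ i`
  -- of one column.
  stairs : ℕ → ℕ → ℕ
  stairs i zero    = 0
  stairs i (suc k) = i + stairs (suc i) k

  stairs-suc : ∀ i k → stairs (suc i) k ≡ k + stairs i k
  stairs-suc i zero    = refl
  stairs-suc i (suc k) = trans (cong (suc i +_) (stairs-suc (suc i) k)) (rearrange i k (stairs (suc i) k))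
    where
    rearrange : ∀ i k x → (1 + i) + (k + x) ≡ (1 + k) + (i + x)
    rearrange = solve-∀

  stairs-choose : ∀ k → stairs 0 k ≡ k choose 2
  stairs-choose zero    = refl
  stairs-choose (suc k) = begin
    stairs 1 k            ≡⟨ stairs-suc 0 k ⟩
    k + stairs 0 k        ≡⟨ cong₂ _+_ (sym (nC1≡n k)) (stairs-choose k) ⟩
    k choose 1 + k choose 2 ≡⟨ nCk+nC[k+1]≡[n+1]C[k+1] k 1 ⟩
    suc k choose 2        ∎
    where open ≡-Reasoning

  columnWeight-columnProduct : ∀ {q} → 1 ≤ q → ∀ cs i bs →
    columnWeight id q cs i bs ≡ (q ∸ 1) ^ length bs * q ^ stairs i (length bs) * columnProduct q cs i bs
  columnWeight-columnProduct 1≤q cs i [] = refl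
  columnWeight-columnProduct {q} 1≤q cs i (b ∷ bs) = begin
    (q ^ smaller b cs ∸ q ^ i) * columnWeight id q cs (suc i) bs
      ≡⟨ cong₂ _*_ (q^a∸q^i 1≤q (smaller b cs) i) (columnWeight-columnProduct 1≤q cs (suc i) bs) ⟩
    (p * q ^ i * qint q (smaller b cs ∸ i)) * (p ^ k * q ^ stairs (suc i) k * columnProduct q cs (suc i) bs)
      ≡⟨ rearrange p (q ^ i) (qint q (smaller b cs ∸ i)) (p ^ k) (q ^ stairs (suc i) k) _ ⟩
    p ^ suc k * (q ^ i * q ^ stairs (suc i) k) * columnProduct q cs i (b ∷ bs)
      ≡⟨ cong (λ x → p ^ suc k * x * columnProduct q cs i (b ∷ bs)) (ℕₚ.^-distribˡ-+-* q i (stairs (suc i) k)) ⟨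
    p ^ suc k * q ^ stairs i (suc k) * columnProduct q cs i (b ∷ bs) ∎
    where
    open ≡-Reasoning
    p = q ∸ 1
    k = length bs
    rearrange : ∀ p a b c d e → (p * a * b) * (c * d * e) ≡ (p * c) * (a * d) * (b * e)
    rearrange = solve-∀

  -- At the first failing row `i`, no entry of `cs` from row `i` on is below `b`, so at most `i`
  -- entries are below `b` altogether and the factor at `b` vanishes.
  columnWeight-undominated : ∀ {q} → 1 ≤ q → ∀ {cs} → AllPairs _<_ cs → ∀ i bs →
    ¬ T (dominated (drop i cs) bs) → columnWeight id q cs i bs ≡ 0
  columnWeight-undominated 1≤q {cs} cs< i [] ¬dom = contradiction (trivial (drop i cs)) ¬dom
    where
    trivial : ∀ ds → T (dominated ds [])
    trivial []      = tt
    trivial (_ ∷ _) = tt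
  columnWeight-undominated {q} 1≤q {cs} cs< i (b ∷ bs) ¬dom = go (drop i cs) refl
    where
    few : ∀ ds → drop i cs ≡ ds → smaller b ds ≡ 0 → columnWeight id q cs i (b ∷ bs) ≡ 0
    few ds refl eq = cong (_* columnWeight id q cs (suc i) bs) (ℕₚ.m≤n⇒m∸n≡0
      (ℕₚ.^-monoʳ-≤ q ⦃ ℕ.>-nonZero 1≤q ⦄ (ℕₚ.m∸n≡0⇒m≤n {smaller b cs} {i} (trans (sym (smaller-drop b i cs<)) eq))))
    drop-suc : ∀ (xs : Row) i {d ds} → drop i xs ≡ d ∷ ds → drop (suc i) xs ≡ ds
    drop-suc (x ∷ xs) zero    refl = refl
    drop-suc (x ∷ xs) (suc i) eq   = drop-suc xs i eq
    go : ∀ ds → drop i cs ≡ ds → columnWeight id q cs i (b ∷ bs) ≡ 0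
    go []       eq = few [] eq refl
    go (d ∷ ds) eq with d ℕ.<? b
    ... | no d≮b = few (d ∷ ds) eq (smaller-none {b} {d ∷ ds} (ℕₚ.≮⇒≥ d≮b ∷
        All.map (λ d<x → ℕₚ.≤-trans (ℕₚ.≮⇒≥ d≮b) (ℕₚ.<⇒≤ d<x)) (AllPairs.head (subst (AllPairs _<_) eq (AllPairsₚ.drop⁺ i cs<)))))
    ... | yes d<b = trans (cong ((q ^ smaller b cs ∸ q ^ i) *_) (columnWeight-undominated 1≤q cs< (suc i) bs
        λ dom → ¬dom (subst (λ e → T (dominated e (b ∷ bs))) (sym eq)
          (T-∧⁺ (ℕₚ.<⇒<ᵇ d<b) (subst (λ e → T (dominated e bs)) (drop-suc cs i eq) dom)))))
        (ℕₚ.*-zeroʳ (q ^ smaller b cs ∸ q ^ i))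

  module _ {A : Set} where

    sum-cong : ∀ {f g : A → ℕ} xs → (∀ {x} → x ∈ xs → f x ≡ g x) → sum (map f xs) ≡ sum (map g xs)
    sum-cong []       eq = refl
    sum-cong (x ∷ xs) eq = cong₂ _+_ (eq (here refl)) (sum-cong xs (eq ∘ there))

    *-sum : ∀ c (f : A → ℕ) xs → c * sum (map f xs) ≡ sum (map (λ x → c * f x) xs)
    *-sum c f []       = ℕₚ.*-zeroʳ c
    *-sum c f (x ∷ xs) = trans (ℕₚ.*-distribˡ-+ c (f x) _) (cong (c * f x +_) (*-sum c f xs))

    sum-filterᵇ : ∀ (p : A → Bool) (f : A → ℕ) xs → (∀ {x} → x ∈ xs → ¬ T (p x) → f x ≡ 0) →
      sum (map f (filterᵇ p xs)) ≡ sum (map f xs)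
    sum-filterᵇ p f []       _  = refl
    sum-filterᵇ p f (x ∷ xs) eq with p x in px
    ... | true  = cong (f x +_) (sum-filterᵇ p f xs (eq ∘ there))
    ... | false = trans (sum-filterᵇ p f xs (eq ∘ there)) (cong (_+ sum (map f xs)) (sym (eq (here refl) (subst T px))))

    sum-concatMap : ∀ {B : Set} (f : B → ℕ) (g : A → List B) xs →
      sum (map f (concatMap g xs)) ≡ sum (map (λ x → sum (map f (g x))) xs)
    sum-concatMap f g []       = refl
    sum-concatMap f g (x ∷ xs) = trans (cong sum (Listₚ.map-++ f (g x) (concatMap g xs)))
      (trans (ListActionₚ.sum-++ (map f (g x)) _) (cong (sum (map f (g x)) +_) (sum-concatMap f g xs)))

  tableaux-prepend : ∀ ks {D bs t} → AllPairs _<_ D → bs ⊆ D → Decreasing (length bs ∷ ks) → t ∈ tableaux D bs ks →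
    ∃ λ u → t ≡ prepend bs u × length u ≤ length bs
  tableaux-prepend ks {D} {bs} {t} D< bs⊆ dec t∈ =
    let u , t≡ , v , _ = Valid-prepend⁻ {m = length bs} (conj-positive ks (Linked.tail dec)) (length-conj-≤ ks dec)
          (subst (λ s → Valid D s bs t) (conj-∷ (length bs) ks dec) (∈-tableaux⁻ ks D< bs⊆ dec t∈))
    in u , t≡ , subst (_≤ length bs) (sym (shape-length {u} (Valid.shape v))) (length-conj-≤ ks dec)

  prefactor : ℕ → List ℕ → ℕ
  prefactor q ks = (q ∸ 1) ^ sum ks * q ^ sum (map (_choose 2) ks)

  -- Induction on the columns: the share of `k` in the prefactor, times the column product, is the
  -- column weight by `columnWeight-columnProduct` and `stairs-choose`. Columns absent from
  -- `tableaux` have weight zero in the chain sum.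
  tableaux-chainSum : ∀ {q} → 1 ≤ q → ∀ ks {D cs} → AllPairs _<_ D → cs ⊆ D → Decreasing (length cs ∷ ks) →
    prefactor q ks * sum (map (cq q) (tableaux D cs ks)) ≡ chainSum ℕ._≟_ id q D cs ks
  tableaux-chainSum {q} 1≤q [] {cs = cs} _ _ _ =
    trans (ℕₚ.+-identityʳ _) (trans (ℕₚ.+-identityʳ _) (cq-single q cs))
  tableaux-chainSum {q} 1≤q (k ∷ ks) {D} {cs} D< cs⊆ (k≤ ∷ dec) = begin
    prefactor q (k ∷ ks) * sum (map (cq q) (tableaux D cs (k ∷ ks)))
      ≡⟨ cong (prefactor q (k ∷ ks) *_) (sum-concatMap (cq q) (λ bs → map (prepend cs) (tableaux E bs ks)) Bs) ⟩
    prefactor q (k ∷ ks) * sum (map (λ bs → sum (map (cq q) (map (prepend cs) (tableaux E bs ks)))) Bs)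
      ≡⟨ *-sum (prefactor q (k ∷ ks)) _ Bs ⟩
    sum (map (λ bs → prefactor q (k ∷ ks) * sum (map (cq q) (map (prepend cs) (tableaux E bs ks)))) Bs)
      ≡⟨ sum-cong Bs (λ bs∈ → step (∈-subs⁻ k E (proj₁ (∈ₚ.∈-filter⁻ dominated? {xs = subs k E} bs∈)))) ⟩
    sum (map (λ bs → columnWeight id q cs 0 bs * chainSum ℕ._≟_ id q E bs ks) Bs)
      ≡⟨ sum-filterᵇ (dominated cs) _ (subs k E) (λ {bs} _ ¬dom →
           cong (_* chainSum ℕ._≟_ id q E bs ks) (columnWeight-undominated 1≤q cs< 0 bs ¬dom)) ⟩
    sum (map (λ bs → columnWeight id q cs 0 bs * chainSum ℕ._≟_ id q E bs ks) (subs k E)) ∎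
    where
    open ≡-Reasoning
    E = D ∖ cs
    E< = without-sorted ℕ._≟_ cs D<
    cs< = AllPairs-⊆ cs⊆ D<
    Bs = filterᵇ (dominated cs) (subs k E)
    dominated? : Decidable (λ bs → T (dominated cs bs))
    dominated? bs = Boolₚ.T? (dominated cs bs)
    rearrange : ∀ a b c d e f → (a * b) * (c * d) * (e * f) ≡ (a * c * e) * (b * d * f)
    rearrange = solve-∀
    step : ∀ {bs} → bs ⊆ E × length bs ≡ k →
      prefactor q (k ∷ ks) * sum (map (cq q) (map (prepend cs) (tableaux E bs ks))) ≡
      columnWeight id q cs 0 bs * chainSum ℕ._≟_ id q E bs ks
    step {bs} (bs⊆ , refl) = begin
      prefactor q (k ∷ ks) * sum (map (cq q) (map (prepend cs) ts))
        ≡⟨ cong (λ l → prefactor q (k ∷ ks) * sum l) (Listₚ.map-∘ ts) ⟨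
      prefactor q (k ∷ ks) * sum (map (cq q ∘ prepend cs) ts)
        ≡⟨ cong (prefactor q (k ∷ ks) *_) (sum-cong ts weigh) ⟩
      prefactor q (k ∷ ks) * sum (map (λ t → columnProduct q cs 0 bs * cq q t) ts)
        ≡⟨ cong (prefactor q (k ∷ ks) *_) (*-sum (columnProduct q cs 0 bs) (cq q) ts) ⟨
      prefactor q (k ∷ ks) * (columnProduct q cs 0 bs * sum (map (cq q) ts))
        ≡⟨ cong₂ (λ x y → x * y * (columnProduct q cs 0 bs * sum (map (cq q) ts)))
             (ℕₚ.^-distribˡ-+-* (q ∸ 1) k (sum ks)) (ℕₚ.^-distribˡ-+-* q (k choose 2) _) ⟩
      (q ∸ 1) ^ k * (q ∸ 1) ^ sum ks * (q ^ (k choose 2) * q ^ sum (map (_choose 2) ks))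
        * (columnProduct q cs 0 bs * sum (map (cq q) ts))
        ≡⟨ rearrange ((q ∸ 1) ^ k) _ (q ^ (k choose 2)) _ (columnProduct q cs 0 bs) _ ⟩
      ((q ∸ 1) ^ k * q ^ (k choose 2) * columnProduct q cs 0 bs) * (prefactor q ks * sum (map (cq q) ts))
        ≡⟨ cong₂ _*_
             (trans (cong (λ e → (q ∸ 1) ^ k * q ^ e * columnProduct q cs 0 bs) (sym (stairs-choose k)))
               (sym (columnWeight-columnProduct 1≤q cs 0 bs)))
             (tableaux-chainSum 1≤q ks E< bs⊆ dec) ⟩
      columnWeight id q cs 0 bs * chainSum ℕ._≟_ id q E bs ks ∎
      where
      ts = tableaux E bs ks
      weigh : ∀ {t} → t ∈ ts → cq q (prepend cs t) ≡ columnProduct q cs 0 bs * cq q t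
      weigh t∈ with tableaux-prepend ks E< bs⊆ dec t∈
      ... | u , refl , u≤ = cq-prepend q cs bs u cs< u≤ k≤

  -- Both lists are free of repetitions and have the same members, so the sum of weights is the same
  -- although the orders differ.
  validFillings↭tableaux : ∀ n ks {cs} → cs ⊆ range n → Decreasing (length cs ∷ ks) →
    validFillings n (conj (length cs ∷ ks)) cs ↭ tableaux (range n) cs ks
  validFillings↭tableaux n ks {cs} cs⊆ dec = ∼bag⇒↭ (unique∧set⇒bag
    (validFillings-unique n (conj (length cs ∷ ks)) cs) (tableaux-unique ks (range-sorted n) cs⊆ dec)
    (mk⇔ (∈-tableaux⁺ ks (range-sorted n) dec ∘ ∈-validFillings⁻ n (conj (length cs ∷ ks)) cs)
         (∈-validFillings⁺ n (conj (length cs ∷ ks)) cs ∘ ∈-tableaux⁻ ks (range-sorted n) cs⊆ dec)))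

  tableauSum-chainSum : ∀ {q} → 1 ≤ q → ∀ n ks {cs} → cs ⊆ range n → Decreasing (length cs ∷ ks) →
    prefactor q ks * tableauSum q n (conj (length cs ∷ ks)) cs ≡ chainSum ℕ._≟_ id q (range n) cs ks
  tableauSum-chainSum {q} 1≤q n ks cs⊆ dec = trans
    (cong (prefactor q ks *_) (ListActionₚ.sum-↭ (Permₚ.map⁺ (cq q) (validFillings↭tableaux n ks cs⊆ dec))))
    (tableaux-chainSum 1≤q ks (range-sorted n) cs⊆ dec)

-- Relabelling columns in `Fin n` by the entries 1 to n.

module _ {A B : Set} (_≟₁_ : DecidableEquality A) (_≟₂_ : DecidableEquality B) (key₁ : A → ℕ) (key₂ : B → ℕ)
  (f : A → B) (f-inj : ∀ {x y} → f x ≡ f y → x ≡ y) (f-key : ∀ x y → (key₂ (f x) <ᵇ key₂ (f y)) ≡ (key₁ x <ᵇ key₁ y))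
  (q : ℕ) where

  subs-map : ∀ k D → subs k (map f D) ≡ map (map f) (subs k D)
  subs-map zero    D       = refl
  subs-map (suc k) []      = refl
  subs-map (suc k) (x ∷ D) = begin
    map (f x ∷_) (subs k (map f D)) ++ subs (suc k) (map f D)
      ≡⟨ cong₂ (λ u v → map (f x ∷_) u ++ v) (subs-map k D) (subs-map (suc k) D) ⟩
    map (f x ∷_) (map (map f) (subs k D)) ++ map (map f) (subs (suc k) D)
      ≡⟨ cong (_++ map (map f) (subs (suc k) D)) (trans (sym (Listₚ.map-∘ (subs k D))) (Listₚ.map-∘ (subs k D))) ⟩
    map (map f) (map (x ∷_) (subs k D)) ++ map (map f) (subs (suc k) D)
      ≡⟨ Listₚ.map-++ (map f) (map (x ∷_) (subs k D)) (subs (suc k) D) ⟨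
    map (map f) (subs (suc k) (x ∷ D)) ∎
    where open ≡-Reasoning

  without-map : ∀ D C → without _≟₂_ (map f D) (map f C) ≡ map f (without _≟₁_ D C)
  without-map []      C = refl
  without-map (x ∷ D) C with Any.any? (f x ≟₂_) (map f C) | Any.any? (x ≟₁_) C
  ... | yes _   | yes _  = without-map D C
  ... | no _    | no _   = cong (f x ∷_) (without-map D C)
  ... | yes fx∈ | no x∉  = contradiction (Any.map f-inj (Anyₚ.map⁻ fx∈)) x∉
  ... | no fx∉  | yes x∈ = contradiction (∈ₚ.∈-map⁺ f x∈) fx∉

  columnWeight-map : ∀ C i B → columnWeight key₂ q (map f C) i (map f B) ≡ columnWeight key₁ q C i B
  columnWeight-map C i []      = refl
  columnWeight-map C i (b ∷ B) = cong₂ (λ l w → (q ^ l ∸ q ^ i) ℕ.* w) (smaller-map C) (columnWeight-map C (suc i) B)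
    where
    smaller-map : ∀ C → length (filter (λ a → key₂ a ℕ.<? key₂ (f b)) (map f C)) ≡ length (filter (λ a → key₁ a ℕ.<? key₁ b) C)
    smaller-map []      = refl
    smaller-map (c ∷ C) rewrite f-key c b with key₁ c <ᵇ key₁ b
    ... | true  = cong suc (smaller-map C)
    ... | false = smaller-map C

  chainSum-map : ∀ ks D C → chainSum _≟₂_ key₂ q (map f D) (map f C) ks ≡ chainSum _≟₁_ key₁ q D C ks
  chainSum-map []       D C = refl
  chainSum-map (k ∷ ks) D C = begin
    sum (map weight₂ (subs k (without _≟₂_ (map f D) (map f C))))
      ≡⟨ cong (λ E → sum (map (λ B → columnWeight key₂ q (map f C) 0 B ℕ.* chainSum _≟₂_ key₂ q E B ks) (subs k E))) (without-map D C) ⟩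
    sum (map weight₂′ (subs k (map f (without _≟₁_ D C))))
      ≡⟨ cong (λ s → sum (map weight₂′ s)) (subs-map k (without _≟₁_ D C)) ⟩
    sum (map weight₂′ (map (map f) (subs k (without _≟₁_ D C))))
      ≡⟨ cong sum (Listₚ.map-∘ (subs k (without _≟₁_ D C))) ⟨
    sum (map (weight₂′ ∘ map f) (subs k (without _≟₁_ D C)))
      ≡⟨ cong sum (Listₚ.map-cong (λ B → cong₂ ℕ._*_ (columnWeight-map C 0 B) (chainSum-map ks (without _≟₁_ D C) B))
           (subs k (without _≟₁_ D C))) ⟩
    chainSum _≟₁_ key₁ q D C (k ∷ ks) ∎
    where
    open ≡-Reasoning
    weight₂ weight₂′ : List B → ℕ
    weight₂ B = columnWeight key₂ q (map f C) 0 B ℕ.* chainSum _≟₂_ key₂ q (without _≟₂_ (map f D) (map f C)) B ks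
    weight₂′ B = columnWeight key₂ q (map f C) 0 B ℕ.* chainSum _≟₂_ key₂ q (map f (without _≟₁_ D C)) B ks

label : ∀ {n} → Fin n → ℕ
label i = suc (toℕ i)

map-label-allFin : ∀ n → map label (allFin n) ≡ applyUpTo suc n
map-label-allFin n = trans (Listₚ.map-tabulate id label) (tabulate-toℕ n suc)
  where
  tabulate-toℕ : ∀ n (g : ℕ → ℕ) → Data.List.tabulate {n = n} (g ∘ toℕ) ≡ applyUpTo g n
  tabulate-toℕ zero    g = refl
  tabulate-toℕ (suc n) g = cong (g 0 ∷_) (tabulate-toℕ n (g ∘ suc))

sigma-chainSum : ∀ {q n m} → 1 ≤ q → (C : Fin m → Fin n) → StrictlyIncreasing C → ∀ ks → IsPartition (m ∷ ks) →
  chainSum _≟_ toℕ q (allFin n) (map C (allFin m)) ks ≡ sigma q n m C (m ∷ ks)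
sigma-chainSum {q} {n} {m} 1≤q C C< ks (_ , dec) = begin
  chainSum _≟_ toℕ q (allFin n) (map C (allFin m)) ks
    ≡⟨ chainSum-map _≟_ ℕ._≟_ toℕ id label (Finₚ.toℕ-injective ∘ ℕₚ.suc-injective) (λ _ _ → refl) q ks (allFin n) (map C (allFin m)) ⟨
  chainSum ℕ._≟_ id q (map label (allFin n)) (map label (map C (allFin m))) ks
    ≡⟨ cong₂ (λ D cs → chainSum ℕ._≟_ id q D cs ks) (map-label-allFin n) (sym (Listₚ.map-∘ (allFin m))) ⟩
  chainSum ℕ._≟_ id q (TableauSums.range n) cs ks
    ≡⟨ TableauSums.tableauSum-chainSum 1≤q n ks cs⊆ (subst (λ l → Linked (λ a b → b ≤ a) (l ∷ ks)) (sym length-cs) dec) ⟨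
  TableauSums.prefactor q ks ℕ.* tableauSum q n (conj (length cs ∷ ks)) cs
    ≡⟨ cong (λ l → TableauSums.prefactor q ks ℕ.* tableauSum q n (conj (l ∷ ks)) cs) length-cs ⟩
  sigma q n m C (m ∷ ks) ∎
  where
  open ≡-Reasoning
  cs : List ℕ
  cs = map (λ i → suc (toℕ (C i))) (allFin m)
  length-cs : length cs ≡ m
  length-cs = trans (Listₚ.length-map _ (allFin m)) (Listₚ.length-tabulate {n = m} id)
  cs⊆ : cs ⊆ applyUpTo suc n
  cs⊆ = sorted-⊆ ℕₚ.<-asym ℕ._≟_
    (AllPairsₚ.map⁺ (AllPairs.map (λ {i} {j} i<j → s≤s (C< i j i<j)) (AllPairsₚ.tabulate⁺-< {f = id} id)))
    (TableauSums.range-sorted n)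
    (λ x∈ → let i , _ , eq = ∈ₚ.∈-map⁻ _ x∈ in
      subst (_∈ applyUpTo suc n) (sym eq) (∈ₚ.∈-applyUpTo⁺ suc (Finₚ.toℕ<n (C i))))

theorem4p14 : ∀ {q : ℕ} (𝔽 : FiniteField q) (n : ℕ)
    (δ : Fin n → FiniteField.F 𝔽) →
    (∀ i j → δ i ≡ δ j → i ≡ j) →
    (m : ℕ) (C : Fin m → Fin n) → StrictlyIncreasing C →
    (μs : List ℕ) → IsPartition (m ∷ μs) →
    LinAlg.HasCount 𝔽 {n}
    (λ W → LinAlg.HasDim 𝔽 (LinAlg.Subspace.mem W) m
    × LinAlg.HasPivots 𝔽 C W
    × LinAlg.HasProfile 𝔽 δ W (m ∷ μs))
    (sigma q n m C (m ∷ μs))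
theorem4p14 𝔽 n δ δ-inj m C C< μs partition =
  subst (HasCount _) (sigma-chainSum (ℕₚ.<⇒≤ 2≤q) C C< μs partition) (subspace-count δ δ-inj C C< μs)
  where open SubspaceCount 𝔽
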